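{- Given a set of $n$ points in the plane, $k\in\Theta(n)$, and $\varepsilon>0$, a $(1+\varepsilon)$-approximation of the smallest axis-aligned $k$-enclosing square can be computed in time $\mathcal{O}\left(n+\frac{1}{\varepsilon^2}\log\frac{1}{\varepsilon}\right)$.
   Context: The smallest axis-aligned $k$-enclosing square of a finite planar point set is an axis-parallel square of minimum side length that encloses (at least) $k$ of the points. A $(1+\varepsilon)$-approximation is an axis-parallel square that encloses at least $k$ of the points and whose side length is at most $(1+\varepsilon)$ times the minimum side length. -}

module Defs where

open import Algebra.Core using (Op₁; Op₂)
open import Algebra.Bundles using (CommutativeRing)
open import Algebra.Structures using (IsCommutativeRing)
import Algebra.Definitions.RawMonoid as Multiples
open import Data.Bool.Base using (Bool; true; false; _∧_; if_then_else_) renaming (not to ¬ᵇ_)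
open import Data.Fin.Base using (Fin; toℕ)
open import Data.Fin.Subset using (Subset; _∈_; ∣_∣)
open import Data.Nat.Base as ℕ using (ℕ; zero; suc)
open import Data.Nat.Logarithm using (⌈log₂_⌉)
open import Data.Nat.Properties using (_≟_) renaming (_≤?_ to _≤ⁿ?_)
open import Data.Product.Base using (∃; ∃-syntax; Σ-syntax; _×_; proj₁)
open import Data.Vec.Base using (Vec; lookup)
open import Function.Definitions using (Injective)
open import Relation.Binary.Core using (Rel)
open import Relation.Binary.Structures using (IsDecTotalOrder)
import Relation.Binary.Construct.NonStrictToStrict as ToStrict
open import Relation.Binary.PropositionalEquality.Core using (_≡_)
open import Relation.Nullary.Decidable.Core using (does)
open import Relation.Nullary.Negation.Core using (¬_)
open import Level using (0ℓ)

-- The real numbers, axiomatised up to isomorphism.  The order is decidable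
-- because comparison is a primitive of the real RAM below.  Classically
-- `archimedean` follows from `complete`; it is listed because the derivation
-- is not constructive.  Nothing is assumed about 0# ⁻¹.

record CompleteOrderedField : Set₁ where
  infix  4 _≈_ _≤_
  infixl 6 _+_
  infixl 7 _*_ _/_
  infix  8 -_
  infix  9 _⁻¹
  field
    Carrier           : Set
    _≈_ _≤_           : Rel Carrier 0ℓ
    _+_ _*_           : Op₂ Carrier
    -_ _⁻¹            : Op₁ Carrier
    0# 1#             : Carrier
    isCommutativeRing : IsCommutativeRing _≈_ _+_ _*_ -_ 0# 1#
    isDecTotalOrder   : IsDecTotalOrder _≈_ _≤_
    0≉1               : ¬ (0# ≈ 1#)
    *-inverseʳ        : ∀ x → ¬ (x ≈ 0#) → x * x ⁻¹ ≈ 1#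
    +-monoˡ-≤         : ∀ z {x y} → x ≤ y → x + z ≤ y + z
    *-nonNeg          : ∀ {x y} → 0# ≤ x → 0# ≤ y → 0# ≤ x * y

  commutativeRing : CommutativeRing 0ℓ 0ℓ
  commutativeRing = record { isCommutativeRing = isCommutativeRing }

  open CommutativeRing commutativeRing public using (_-_; +-rawMonoid)
  open IsDecTotalOrder isDecTotalOrder public using (_≤?_)
  open ToStrict _≈_ _≤_ public using (_<_)

  _/_ : Op₂ Carrier
  x / y = x * y ⁻¹

  fromℕ : ℕ → Carrier
  fromℕ n = Multiples._×_ +-rawMonoid n 1#

  UpperBound : (Carrier → Set) → Carrier → Set
  UpperBound S u = ∀ x → S x → x ≤ u

  field
    archimedean : ∀ x → ∃[ n ] x ≤ fromℕ n
    complete    : ∀ (S : Carrier → Set) → ∃ S → ∃ (UpperBound S) →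
                  ∃[ u ] UpperBound S u × (∀ v → UpperBound S v → u ≤ v)

  -- Floor and ceiling, truncated to 0 on negative arguments: the greatest
  -- m ≤ n with m ≤ x, and the least m ≤ n with x ≤ m, for some n ≥ x.

  floorFrom : Carrier → ℕ → ℕ
  floorFrom x zero    = zero
  floorFrom x (suc n) = if does (fromℕ (suc n) ≤? x) then suc n else floorFrom x n

  ceilingFrom : Carrier → ℕ → ℕ
  ceilingFrom x zero    = zero
  ceilingFrom x (suc n) = if does (x ≤? fromℕ n) then ceilingFrom x n else suc n

  floor ceiling : Carrier → ℕ
  floor   x = floorFrom x (proj₁ (archimedean x))
  ceiling x = ceilingFrom x (proj₁ (archimedean x))

module Geometry (ℝ : CompleteOrderedField) where
  open CompleteOrderedField ℝ

  record Point : Set where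
    constructor _,_
    field
      xcoord ycoord : Carrier

  open Point public

  _≈ₚ_ : Rel Point 0ℓ
  p ≈ₚ q = (xcoord p ≈ xcoord q) × (ycoord p ≈ ycoord q)

  IsPointSet : ∀ {n} → (Fin n → Point) → Set
  IsPointSet P = Injective _≡_ _≈ₚ_ P

  -- A closed axis-parallel square.  Side 0 is allowed, since otherwise no
  -- smallest 1-enclosing square would exist.

  record Square : Set where
    field
      left bottom side : Carrier
      side-nonNeg      : 0# ≤ side

  open Square public

  _∈□_ : Point → Square → Set
  p ∈□ Q = (left Q ≤ xcoord p × xcoord p ≤ left Q + side Q)
         × (bottom Q ≤ ycoord p × ycoord p ≤ bottom Q + side Q)

  Encloses : ∀ {n} → ℕ → (Fin n → Point) → Square → Set
  Encloses {n} k P Q =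
    Σ[ S ∈ Subset n ] (k ℕ.≤ ∣ S ∣ × (∀ {i} → i ∈ S → P i ∈□ Q))

  IsSmallest : ∀ {n} → ℕ → (Fin n → Point) → Square → Set
  IsSmallest k P Q =
    Encloses k P Q × (∀ Q′ → Encloses k P Q′ → side Q ≤ side Q′)

  IsApproximation : ∀ {n} → Carrier → ℕ → (Fin n → Point) → Square → Set
  IsApproximation ε k P Q =
    Encloses k P Q ×
    (∃[ Q* ] IsSmallest k P Q* × side Q ≤ (1# + ε) * side Q*)

-- A unit-cost real RAM (with floor), programmed in structured form.
-- There is one memory of natural numbers and one of reals, both indirectly
-- addressable.  `call` carries no arguments and no local variables.

infix  9 int[_] real[_]
infixl 7 _⊗_ _⊘_
infixl 6 _⊕_ _⊖_
infix  4 _≤ⁱ_ _≤ʳ_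
infixr 3 _and_
infix  2 int[_]≔_ real[_]≔_
infixr 1 _⨾_

mutual
  data IntExp : Set where
    const       : ℕ → IntExp
    int[_]      : IntExp → IntExp
    _⊕_ _⊖_ _⊗_ : IntExp → IntExp → IntExp   -- _⊖_ is truncated subtraction
    floor       : RealExp → IntExp

  data RealExp : Set where
    cast            : IntExp → RealExp
    real[_]         : IntExp → RealExp
    _⊕_ _⊖_ _⊗_ _⊘_ : RealExp → RealExp → RealExp

data BoolExp : Set where
  _≤ⁱ_  : IntExp → IntExp → BoolExp
  _≤ʳ_  : RealExp → RealExp → BoolExp
  not   : BoolExp → BoolExp
  _and_ : BoolExp → BoolExp → BoolExp

data Cmd (p : ℕ) : Set where
  skip       : Cmd p
  int[_]≔_   : IntExp → IntExp → Cmd p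
  real[_]≔_  : IntExp → RealExp → Cmd p
  _⨾_        : Cmd p → Cmd p → Cmd p
  cond       : BoolExp → Cmd p → Cmd p → Cmd p
  while      : BoolExp → Cmd p → Cmd p
  call       : Fin p → Cmd p

record Program : Set where
  field
    {size} : ℕ
    bodies : Vec (Cmd size) size
    main   : Cmd size

-- Every node of an expression costs one time unit.

mutual
  costⁱ : IntExp → ℕ
  costⁱ (const _) = 1
  costⁱ int[ a ]  = suc (costⁱ a)
  costⁱ (a ⊕ b)   = suc (costⁱ a ℕ.+ costⁱ b)
  costⁱ (a ⊖ b)   = suc (costⁱ a ℕ.+ costⁱ b)
  costⁱ (a ⊗ b)   = suc (costⁱ a ℕ.+ costⁱ b)
  costⁱ (floor x) = suc (costʳ x)

  costʳ : RealExp → ℕ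
  costʳ (cast a)  = suc (costⁱ a)
  costʳ real[ a ] = suc (costⁱ a)
  costʳ (x ⊕ y)   = suc (costʳ x ℕ.+ costʳ y)
  costʳ (x ⊖ y)   = suc (costʳ x ℕ.+ costʳ y)
  costʳ (x ⊗ y)   = suc (costʳ x ℕ.+ costʳ y)
  costʳ (x ⊘ y)   = suc (costʳ x ℕ.+ costʳ y)

costᵇ : BoolExp → ℕ
costᵇ (a ≤ⁱ b)  = suc (costⁱ a ℕ.+ costⁱ b)
costᵇ (x ≤ʳ y)  = suc (costʳ x ℕ.+ costʳ y)
costᵇ (not b)   = suc (costᵇ b)
costᵇ (b and c) = suc (costᵇ b ℕ.+ costᵇ c)

update : ∀ {A : Set} → (ℕ → A) → ℕ → A → ℕ → A
update m a v b = if does (a ≟ b) then v else m b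

module Machine (ℝ : CompleteOrderedField) where
  private module R = CompleteOrderedField ℝ
  open Geometry ℝ

  record State : Set where
    constructor ⟨_,_⟩
    field
      ints  : ℕ → ℕ
      reals : ℕ → R.Carrier

  open State public

  mutual
    ⟦_⟧ⁱ : IntExp → State → ℕ
    ⟦ const n ⟧ⁱ  s = n
    ⟦ int[ a ] ⟧ⁱ s = ints s (⟦ a ⟧ⁱ s)
    ⟦ a ⊕ b ⟧ⁱ    s = ⟦ a ⟧ⁱ s ℕ.+ ⟦ b ⟧ⁱ s
    ⟦ a ⊖ b ⟧ⁱ    s = ⟦ a ⟧ⁱ s ℕ.∸ ⟦ b ⟧ⁱ s
    ⟦ a ⊗ b ⟧ⁱ    s = ⟦ a ⟧ⁱ s ℕ.* ⟦ b ⟧ⁱ s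
    ⟦ floor x ⟧ⁱ  s = R.floor (⟦ x ⟧ʳ s)

    ⟦_⟧ʳ : RealExp → State → R.Carrier
    ⟦ cast a ⟧ʳ    s = R.fromℕ (⟦ a ⟧ⁱ s)
    ⟦ real[ a ] ⟧ʳ s = reals s (⟦ a ⟧ⁱ s)
    ⟦ x ⊕ y ⟧ʳ     s = ⟦ x ⟧ʳ s R.+ ⟦ y ⟧ʳ s
    ⟦ x ⊖ y ⟧ʳ     s = ⟦ x ⟧ʳ s R.- ⟦ y ⟧ʳ s
    ⟦ x ⊗ y ⟧ʳ     s = ⟦ x ⟧ʳ s R.* ⟦ y ⟧ʳ s
    ⟦ x ⊘ y ⟧ʳ     s = ⟦ x ⟧ʳ s R./ ⟦ y ⟧ʳ s

  ⟦_⟧ᵇ : BoolExp → State → Bool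
  ⟦ a ≤ⁱ b ⟧ᵇ  s = does (⟦ a ⟧ⁱ s ≤ⁿ? ⟦ b ⟧ⁱ s)
  ⟦ x ≤ʳ y ⟧ᵇ  s = does (⟦ x ⟧ʳ s R.≤? ⟦ y ⟧ʳ s)
  ⟦ not b ⟧ᵇ   s = ¬ᵇ ⟦ b ⟧ᵇ s
  ⟦ b and c ⟧ᵇ s = ⟦ b ⟧ᵇ s ∧ ⟦ c ⟧ᵇ s

  -- Δ ⊢ c , s ⇓ s′ , t : with procedure bodies Δ, command c started in s
  -- halts in s′ after t time units.

  infix 4 _⊢_,_⇓_,_

  data _⊢_,_⇓_,_ {p} (Δ : Vec (Cmd p) p) :
                 Cmd p → State → State → ℕ → Set where
    ⇓-skip  : ∀ {s} → Δ ⊢ skip , s ⇓ s , 1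
    ⇓-int   : ∀ {s a e} →
              Δ ⊢ int[ a ]≔ e , s
                ⇓ ⟨ update (ints s) (⟦ a ⟧ⁱ s) (⟦ e ⟧ⁱ s) , reals s ⟩
                , suc (costⁱ a ℕ.+ costⁱ e)
    ⇓-real  : ∀ {s a e} →
              Δ ⊢ real[ a ]≔ e , s
                ⇓ ⟨ ints s , update (reals s) (⟦ a ⟧ⁱ s) (⟦ e ⟧ʳ s) ⟩
                , suc (costⁱ a ℕ.+ costʳ e)
    ⇓-seq   : ∀ {s s′ s″ c d t u} →
              Δ ⊢ c , s ⇓ s′ , t → Δ ⊢ d , s′ ⇓ s″ , u →
              Δ ⊢ c ⨾ d , s ⇓ s″ , t ℕ.+ u
    ⇓-then  : ∀ {s s′ b c d t} → ⟦ b ⟧ᵇ s ≡ true →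
              Δ ⊢ c , s ⇓ s′ , t →
              Δ ⊢ cond b c d , s ⇓ s′ , suc (costᵇ b ℕ.+ t)
    ⇓-else  : ∀ {s s′ b c d t} → ⟦ b ⟧ᵇ s ≡ false →
              Δ ⊢ d , s ⇓ s′ , t →
              Δ ⊢ cond b c d , s ⇓ s′ , suc (costᵇ b ℕ.+ t)
    ⇓-done  : ∀ {s b c} → ⟦ b ⟧ᵇ s ≡ false →
              Δ ⊢ while b c , s ⇓ s , suc (costᵇ b)
    ⇓-while : ∀ {s s′ s″ b c t u} → ⟦ b ⟧ᵇ s ≡ true →
              Δ ⊢ c , s ⇓ s′ , t → Δ ⊢ while b c , s′ ⇓ s″ , u →
              Δ ⊢ while b c , s ⇓ s″ , suc (costᵇ b ℕ.+ (t ℕ.+ u))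
    ⇓-call  : ∀ {s s′ i t} → Δ ⊢ lookup Δ i , s ⇓ s′ , t →
              Δ ⊢ call i , s ⇓ s′ , suc t

  Runs : Program → State → State → ℕ → Set
  Runs prog s s′ t = Program.bodies prog ⊢ Program.main prog , s ⇓ s′ , t

  -- Cells not mentioned here may hold anything initially.

  record IsInput {n} (P : Fin n → Point) (k : ℕ) (ε : R.Carrier)
                 (s : State) : Set where
    field
      n-cell : ints s 0 ≡ n
      k-cell : ints s 1 ≡ k
      ε-cell : reals s 0 ≡ ε
      x-cell : ∀ i → reals s (1 ℕ.+ 2 ℕ.* toℕ i) ≡ xcoord (P i)
      y-cell : ∀ i → reals s (2 ℕ.+ 2 ℕ.* toℕ i) ≡ ycoord (P i)

  record IsOutput (Q : Square) (s : State) : Set where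
    field
      left-cell   : reals s 0 ≡ left Q
      bottom-cell : reals s 1 ≡ bottom Q
      side-cell   : reals s 2 ≡ side Q

-- n + (1/ε)² log (1/ε), with the logarithm rounded up to a natural number (to
-- ⌈log₂ ⌈1/ε⌉ ⌉).  Since n ≥ 1, the rounding changes the expression by at most
-- a constant factor when ε ≤ 1; for ε ≥ 1 the logarithm becomes 0.

module Bound (ℝ : CompleteOrderedField) where
  open CompleteOrderedField ℝ

  bound : ℕ → Carrier → Carrier
  bound n ε = fromℕ n + (ε ⁻¹ * ε ⁻¹) * fromℕ ⌈log₂ ceiling (ε ⁻¹) ⌉

{-# OPTIONS --safe #-}

-- Let k ≥ n / c.  A k-enclosing square Q contains, among the n x-coordinates,
-- one of rank (i + 1) k - 1 for some i < c, and likewise a y-coordinate.  So one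
-- of at most c² centres, each found by selection in time O(n) (median of medians
-- of groups of five), lies in Q.  The k-th smallest distance d, in the maximum
-- norm, of the points to such a centre satisfies d ≤ side Q ≤ 2 d for an optimal
-- Q.  Put a grid of width d / M with M = ⌊2 / ε⌋ + 1 on the window of radius 2 d
-- around the centre: an optimal Q is covered by a grid square whose side exceeds
-- side Q by at most 2 d / M ≤ ε side Q.  Prefix sums of the numbers of points per
-- cell give the number of points of a grid square in constant time, and the
-- smallest k-enclosing grid square is found in O(M²) steps by running through the
-- corners once, while decreasing the current best side by one cell at a time
-- whenever this is possible at the current corner.  The total O(c² (n + 1 / ε²))
-- is within the bound, even without its logarithmic factor.

module Submission where

open import Defs
open import Algebra.Bundles using (CommutativeRing)
import Algebra.Properties.Monoid.Mult as MonoidMult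
import Algebra.Properties.Ring as RingProperties
import Algebra.Properties.Semiring.Mult as SemiringMult
import Algebra.Solver.Ring.NaturalCoefficients.Default as NaturalCoefficients
open import Data.Bool.Base using (Bool; true; false; if_then_else_; _∧_; _∨_) renaming (not to ¬ᵇ_)
open import Data.Bool.Properties using (∧-comm; ∧-zeroʳ; not-involutive)
open import Data.Empty using (⊥; ⊥-elim)
open import Data.Fin.Base using (Fin; toℕ) renaming (zero to fzero)
open import Data.Fin.Subset using (Subset; _∈_; ∣_∣)
open import Data.List.Base using ([]; _∷_)
open import Data.Nat.Base as ℕ using (ℕ; zero; suc; z≤n; s≤s)
open import Data.Nat.DivMod using (m≡m%n+[m/n]*n; m%n<n; m/n*n≤m)
open import Data.Nat.Induction using (<-rec)
open import Data.Nat.Logarithm using (⌈log₂_⌉; ⌈log₂⌉-mono-≤; ⌈log₂2^n⌉≡n)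
import Data.Nat.Properties as ℕ
open import Data.Nat.Tactic.RingSolver using (solve)
open import Data.Product.Base using (∃-syntax; Σ-syntax; _×_; _,_; proj₁; proj₂)
open import Data.Sum.Base using (_⊎_; inj₁; inj₂)
import Data.Vec.Base as Vec
open import Data.Vec.Base using (here; there)
open import Data.Vec.Properties using (lookup∘tabulate; []=⇒lookup)
open import Relation.Binary.Definitions using (tri<; tri≈; tri>; Total; Transitive)
open import Relation.Binary.PropositionalEquality using (_≡_; refl; sym; trans; cong; cong₂; cong-app; subst; subst₂)
open import Relation.Binary.Structures using (module IsDecTotalOrder)
open import Relation.Nullary using (¬_; Dec; does; yes; no)
open import Relation.Nullary.Decidable using (dec-true; dec-false)

-- The machine has two flat memories with arbitrary initial contents, and its calls have neither
-- arguments nor local variables. The algorithm is therefore written and verified one level up, in a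
-- language of unbounded named arrays that counts commands only; a run of t steps there becomes a
-- machine run of at most K t time units, where K depends on the program text alone. The recursion
-- of selection keeps its own stack in two arrays, indexed by the start of the current segment.
--
-- The program is fixed before c is chosen: the loops over ranks stop as soon as (i + 1) k exceeds
-- n, and n ≤ c k bounds how often they run. Nor does the program know an optimal square, so the
-- loop invariants speak about all optimal squares at once, sorted by the pair of ranks that hits
-- them. That an optimal square exists is part of the conclusion and has a proof of its own, by a
-- finite set of candidate sides.

-- To derive l ≤ r from hypotheses summing up to L ≤ R, it suffices to check
-- an identity in the semiring ℕ.
linear : ∀ {l r L R} s → L ℕ.≤ R → l ℕ.+ R ℕ.+ s ≡ r ℕ.+ L → l ℕ.≤ r
linear {l} {r} {L} {R} s h e = ℕ.+-cancelʳ-≤ R l r (begin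
    l ℕ.+ R  ≤⟨ ℕ.m≤m+n _ s ⟩
    l ℕ.+ R ℕ.+ s       ≡⟨ e ⟩
    r ℕ.+ L  ≤⟨ ℕ.+-monoʳ-≤ r h ⟩
    r ℕ.+ R  ∎)
  where open ℕ.≤-Reasoning

≤-split : ∀ {m n} → m ℕ.≤ n → m ℕ.< n ⊎ m ≡ n
≤-split = ℕ.m≤n⇒m<n∨m≡n

infixl 6 _+≤_
_+≤_ : ∀ {a b c d} → a ℕ.≤ b → c ℕ.≤ d → a ℕ.+ c ℕ.≤ b ℕ.+ d
_+≤_ = ℕ.+-mono-≤

-- Memory updates and injective address encodings

update-here : ∀ {A : Set} (f : ℕ → A) a v → update f a v a ≡ v
update-here f a v = cong (λ b → if b then v else f a) (dec-true (a ℕ.≟ a) refl)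

update-there : ∀ {A : Set} (f : ℕ → A) a v {b} → ¬ (a ≡ b) → update f a v b ≡ f b
update-there f a v {b} q = cong (λ c → if c then v else f b) (dec-false (a ℕ.≟ b) q)

-- Every positive number is uniquely a power of two times an odd number, so different a give
-- disjoint infinite sets of addresses: one memory holds any number of unbounded arrays. Array names
-- are literals, so the power is a constant of the program.
code : ℕ → ℕ → ℕ
code a i = 2 ℕ.^ a ℕ.* (1 ℕ.+ 2 ℕ.* i)

code-pos : ∀ a i → 1 ℕ.≤ code a i
code-pos a i = ℕ.*-mono-≤ {1} {2 ℕ.^ a} {1} (ℕ.m^n>0 2 a) (s≤s z≤n)

odd≢even : ∀ i j → ¬ (1 ℕ.+ 2 ℕ.* i ≡ 2 ℕ.* j)
odd≢even i zero ()
odd≢even zero (suc j) e with trans e (ℕ.*-suc 2 j)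
... | ()
odd≢even (suc i) (suc j) e = odd≢even i j (ℕ.+-cancelˡ-≡ 2 _ _
  (trans (trans (cong suc (sym (ℕ.*-suc 2 i))) e) (ℕ.*-suc 2 j)))

code-injective : ∀ a b {i j} → code a i ≡ code b j → a ≡ b × i ≡ j
code-injective zero zero {i} {j} e =
  refl , ℕ.*-cancelˡ-≡ i j 2 (ℕ.suc-injective (trans (sym (ℕ.*-identityˡ _)) (trans e (ℕ.*-identityˡ _))))
code-injective zero (suc b) {i} {j} e =
  ⊥-elim (odd≢even i (code b j) (trans (sym (ℕ.*-identityˡ _)) (trans e (ℕ.*-assoc 2 (2 ℕ.^ b) _))))
code-injective (suc a) zero {i} {j} e =
  ⊥-elim (odd≢even j (code a i) (trans (sym (ℕ.*-identityˡ _)) (trans (sym e) (ℕ.*-assoc 2 (2 ℕ.^ a) _))))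
code-injective (suc a) (suc b) {i} {j} e with code-injective a b {i} {j}
  (ℕ.*-cancelˡ-≡ _ _ 2 (trans (sym (ℕ.*-assoc 2 (2 ℕ.^ a) _)) (trans e (ℕ.*-assoc 2 (2 ℕ.^ b) _))))
... | p , q = cong suc p , q

-- A pairing without division: pairs with sum s lie between s² and s² + s, hence before (s + 1)².
-- Unlike row-major order it needs no row length.
pair : ℕ → ℕ → ℕ
pair i j = (i ℕ.+ j) ℕ.* (i ℕ.+ j) ℕ.+ i

square-step : ∀ s → s ℕ.* s ℕ.+ s ℕ.< suc s ℕ.* suc s
square-step s = linear s (z≤n {0}) (solve (s ∷ []))

pair-sum : ∀ i j i′ j′ → i ℕ.+ j ℕ.< i′ ℕ.+ j′ → pair i j ℕ.< pair i′ j′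
pair-sum i j i′ j′ h = begin-strict
    pair i j  ≤⟨ ℕ.+-monoʳ-≤ (s ℕ.* s) (ℕ.m≤m+n i j) ⟩
    s ℕ.* s ℕ.+ s  <⟨ square-step s ⟩
    suc s ℕ.* suc s  ≤⟨ ℕ.*-mono-≤ h h ⟩
    (i′ ℕ.+ j′) ℕ.* (i′ ℕ.+ j′)      ≤⟨ ℕ.m≤m+n _ i′ ⟩
    pair i′ j′ ∎
  where open ℕ.≤-Reasoning
        s : ℕ
        s = i ℕ.+ j

pair-injective : ∀ i j i′ j′ → pair i j ≡ pair i′ j′ → i ≡ i′ × j ≡ j′
pair-injective i j i′ j′ e with ℕ.<-cmp (i ℕ.+ j) (i′ ℕ.+ j′)
... | tri< h _ _ = ⊥-elim (ℕ.<⇒≢ (pair-sum i j i′ j′ h) e)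
... | tri> _ _ h = ⊥-elim (ℕ.<⇒≢ (pair-sum i′ j′ i j h) (sym e))
... | tri≈ _ h _ = i≡ , ℕ.+-cancelˡ-≡ i j j′ (trans h (cong (ℕ._+ j′) (sym i≡)))
  where
  i≡ : i ≡ i′
  i≡ = ℕ.+-cancelˡ-≡ ((i ℕ.+ j) ℕ.* (i ℕ.+ j)) i i′ (trans e (cong (λ s → s ℕ.* s ℕ.+ i′) (sym h)))

-- Counting indices with a Boolean property

bit : Bool → ℕ
bit b = if b then 1 else 0

count : (ℕ → Bool) → ℕ → ℕ
count P zero    = 0
count P (suc n) = bit (P n) ℕ.+ count P n

bit-mono : ∀ b c → (b ≡ true → c ≡ true) → bit b ℕ.≤ bit c
bit-mono false c h = z≤n
bit-mono true c h with c | h refl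
... | .true | refl = ℕ.≤-refl

count-mono : ∀ {P Q} n → (∀ {i} → i ℕ.< n → P i ≡ true → Q i ≡ true) → count P n ℕ.≤ count Q n
count-mono zero h = z≤n
count-mono {P} {Q} (suc n) h = bit-mono (P n) (Q n) (h ℕ.≤-refl) +≤ count-mono n (λ i< → h (ℕ.m<n⇒m<1+n i<))

count-cong : ∀ {P Q} n → (∀ {i} → i ℕ.< n → P i ≡ Q i) → count P n ≡ count Q n
count-cong zero h = refl
count-cong (suc n) h = cong₂ (λ b c → bit b ℕ.+ c) (h ℕ.≤-refl) (count-cong n (λ i< → h (ℕ.m<n⇒m<1+n i<)))

always : ℕ → Bool
always _ = true

count-true : ∀ n → count always n ≡ n
count-true zero = refl
count-true (suc n) = cong suc (count-true n)

count-≤ : ∀ P n → count P n ℕ.≤ n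
count-≤ P n = subst (count P n ℕ.≤_) (count-true n) (count-mono n (λ _ _ → refl))

count-grow : ∀ P {m n} → m ℕ.≤ n → count P m ℕ.≤ count P n
count-grow P {m} {zero} z≤n = z≤n
count-grow P {m} {suc n} h with ≤-split h
... | inj₁ (s≤s m≤n) = ℕ.≤-trans (count-grow P m≤n) (ℕ.m≤n+m _ (bit (P n)))
... | inj₂ refl = ℕ.≤-refl

bit-split : ∀ b c → bit b ≡ bit (b ∧ c) ℕ.+ bit (b ∧ ¬ᵇ c)
bit-split false c = refl
bit-split true false = refl
bit-split true true = refl

count-sum : ∀ P Q R → (∀ i → bit (P i) ≡ bit (Q i) ℕ.+ bit (R i)) → ∀ n → count P n ≡ count Q n ℕ.+ count R n
count-sum P Q R h zero = refl
count-sum P Q R h (suc n) rewrite h n | count-sum P Q R h n = swap (bit (Q n)) (bit (R n)) (count Q n) (count R n)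
  where
  swap : ∀ a b c d → a ℕ.+ b ℕ.+ (c ℕ.+ d) ≡ a ℕ.+ c ℕ.+ (b ℕ.+ d)
  swap a b c d = solve (a ∷ b ∷ c ∷ d ∷ [])

count-split : ∀ (P Q : ℕ → Bool) n → count P n ≡ count (λ i → P i ∧ Q i) n ℕ.+ count (λ i → P i ∧ ¬ᵇ Q i) n
count-split P Q = count-sum P (λ i → P i ∧ Q i) (λ i → P i ∧ ¬ᵇ Q i) (λ i → bit-split (P i) (Q i))

count-complement : ∀ P n → count P n ℕ.+ count (λ i → ¬ᵇ P i) n ≡ n
count-complement P n = trans (sym (count-split always P n)) (count-true n)

count-shift : ∀ (P : ℕ → Bool) a b → count P (a ℕ.+ b) ≡ count P a ℕ.+ count (λ j → P (a ℕ.+ j)) b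
count-shift P a zero = trans (cong (count P) (ℕ.+-identityʳ a)) (sym (ℕ.+-identityʳ _))
count-shift P a (suc b) = trans (cong (count P) (ℕ.+-suc a b))
  (trans (cong (bit (P (a ℕ.+ b)) ℕ.+_) (count-shift P a b))
         (move (bit (P (a ℕ.+ b))) (count P a) (count (λ j → P (a ℕ.+ j)) b)))
  where
  move : ∀ x y z → x ℕ.+ (y ℕ.+ z) ≡ y ℕ.+ (x ℕ.+ z)
  move x y z = solve (x ∷ y ∷ z ∷ [])

count-witness : ∀ P n → 1 ℕ.≤ count P n → ∃[ i ] i ℕ.< n × P i ≡ true
count-witness P (suc n) h with P n in eq
... | true  = n , ℕ.≤-refl , eq
... | false with count-witness P n h
...   | i , i< , p = i , ℕ.m<n⇒m<1+n i< , p

-- The first s * h indices form h consecutive blocks of length s, and each block satisfying `Q`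
-- contributes at least c. Groups of five are the case s = 5 and c = 3.
count-groups : ∀ (P Q : ℕ → Bool) s c h → (∀ {g} → g ℕ.< h → Q g ≡ true → c ℕ.≤ count (λ j → P (s ℕ.* g ℕ.+ j)) s) →
               c ℕ.* count Q h ℕ.≤ count P (s ℕ.* h)
count-groups P Q s c zero H rewrite ℕ.*-zeroʳ c = z≤n
count-groups P Q s c (suc h) H = begin
    c ℕ.* (bit (Q h) ℕ.+ count Q h)  ≡⟨ ℕ.*-distribˡ-+ c (bit (Q h)) _ ⟩
    c ℕ.* bit (Q h) ℕ.+ c ℕ.* count Q h  ≤⟨ last (Q h) (H ℕ.≤-refl) +≤ count-groups P Q s c h (λ g< → H (ℕ.m<n⇒m<1+n g<)) ⟩
    count (λ j → P (s ℕ.* h ℕ.+ j)) s ℕ.+ count P (s ℕ.* h)  ≡⟨ ℕ.+-comm _ (count P (s ℕ.* h)) ⟩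
    count P (s ℕ.* h) ℕ.+ count (λ j → P (s ℕ.* h ℕ.+ j)) s  ≡⟨ sym (count-shift P (s ℕ.* h) s) ⟩
    count P (s ℕ.* h ℕ.+ s)  ≡⟨ cong (count P) (trans (ℕ.+-comm (s ℕ.* h) s) (sym (ℕ.*-suc s h))) ⟩
    count P (s ℕ.* suc h)  ∎
  where
  open ℕ.≤-Reasoning
  last : ∀ b {x} → (b ≡ true → c ℕ.≤ x) → c ℕ.* bit b ℕ.≤ x
  last true k = ℕ.≤-trans (ℕ.≤-reflexive (ℕ.*-identityʳ c)) (k refl)
  last false k = ℕ.≤-trans (ℕ.≤-reflexive (ℕ.*-zeroʳ c)) z≤n

-- The relation is a parameter so that reversing the order turns a minimum into a maximum.
-- Reflexivity is read off from totality.
extremum : ∀ {A : Set} (_⊑_ : A → A → Set) → Total _⊑_ → Transitive _⊑_ →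
           ∀ (f : ℕ → A) P n → 1 ℕ.≤ count P n →
           ∃[ i ] i ℕ.< n × P i ≡ true × (∀ {j} → j ℕ.< n → P j ≡ true → f i ⊑ f j)
extremum _⊑_ total trans′ f P (suc n) h with P n in eq
extremum _⊑_ total trans′ f P (suc n) h | false with extremum _⊑_ total trans′ f P n h
... | i , i< , p , least = i , ℕ.m<n⇒m<1+n i< , p , below
  where
  below : ∀ {j} → j ℕ.< suc n → P j ≡ true → f i ⊑ f j
  below (s≤s j≤n) q with ≤-split j≤n
  ... | inj₁ j<n = least j<n q
  ... | inj₂ refl with trans (sym eq) q
  ...   | ()
extremum _⊑_ total trans′ f P (suc n) h | true with 1 ℕ.≤? count P n
... | no none = n , ℕ.≤-refl , eq , below
  where
  below : ∀ {j} → j ℕ.< suc n → P j ≡ true → f n ⊑ f j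
  below {j} (s≤s j≤n) q with ≤-split j≤n
  ... | inj₁ j<n = ⊥-elim (none (ℕ.≤-trans (subst (λ b → 1 ℕ.≤ bit b ℕ.+ count P j) (sym q) (s≤s z≤n)) (count-grow P j<n)))
  ... | inj₂ refl with total (f n) (f n)
  ...   | inj₁ r = r
  ...   | inj₂ r = r
... | yes some with extremum _⊑_ total trans′ f P n some
...   | i , i< , p , least with total (f i) (f n)
...     | inj₁ r = i , ℕ.m<n⇒m<1+n i< , p , below
  where
  below : ∀ {j} → j ℕ.< suc n → P j ≡ true → f i ⊑ f j
  below (s≤s j≤n) q with ≤-split j≤n
  ... | inj₁ j<n = least j<n q
  ... | inj₂ refl = r
...     | inj₂ r = n , ℕ.≤-refl , eq , below
  where
  below : ∀ {j} → j ℕ.< suc n → P j ≡ true → f n ⊑ f j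
  below (s≤s j≤n) q with ≤-split j≤n
  ... | inj₁ j<n = trans′ r (least j<n q)
  ... | inj₂ refl with total (f n) (f n)
  ...   | inj₁ s = s
  ...   | inj₂ s = s

∧-intro : ∀ {b c} → b ≡ true → c ≡ true → b ∧ c ≡ true
∧-intro refl refl = refl

∧-elim : ∀ {b c} → b ∧ c ≡ true → b ≡ true × c ≡ true
∧-elim {true} {true} _ = refl , refl

not-true : ∀ {b} → ¬ᵇ b ≡ true → b ≡ false
not-true {false} _ = refl

true≢false : ∀ {b} → b ≡ true → ¬ (b ≡ false)
true≢false refl ()

does-false : ∀ {P : Set} (d : Dec P) → does d ≡ false → ¬ P
does-false (no ¬p) _ = ¬p

does-true : ∀ {P : Set} (d : Dec P) → does d ≡ true → P
does-true (yes p) _ = p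

-- Ranks in an array of reals

module Ranks (ℝ : CompleteOrderedField) where
  open CompleteOrderedField ℝ
  open IsDecTotalOrder isDecTotalOrder public using ()
    renaming (refl to ≤-refl; trans to ≤-trans; total to ≤-total; antisym to ≤-antisym; reflexive to ≤-reflexive; module Eq to Eq)

  le lt : Carrier → Carrier → Bool
  le x y = does (x ≤? y)
  lt x y = ¬ᵇ le y x

  le-intro : ∀ {x y} → x ≤ y → le x y ≡ true
  le-intro {x} {y} = dec-true (x ≤? y)

  le-elim : ∀ {x y} → le x y ≡ true → x ≤ y
  le-elim {x} {y} = does-true (x ≤? y)

  le-false : ∀ {x y} → le x y ≡ false → ¬ (x ≤ y)
  le-false {x} {y} = does-false (x ≤? y)

  lt-intro : ∀ {x y} → ¬ (y ≤ x) → lt x y ≡ true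
  lt-intro {x} {y} h = cong ¬ᵇ_ (dec-false (y ≤? x) h)

  lt-elim : ∀ {x y} → lt x y ≡ true → ¬ (y ≤ x)
  lt-elim {x} {y} h = le-false (not-true h)

  ≰⇒≥ : ∀ {x y} → ¬ (x ≤ y) → y ≤ x
  ≰⇒≥ {x} {y} h with ≤-total x y
  ... | inj₁ p = ⊥-elim (h p)
  ... | inj₂ p = p

  countLe countLt : (ℕ → Carrier) → Carrier → ℕ → ℕ
  countLe f v = count (λ i → le (f i) v)
  countLt f v = count (λ i → lt (f i) v)

  -- Ranks start at 0. Stated by counts, the notion needs no sorted array and copes with ties; it
  -- determines v up to `≈`.
  record HasRank (f : ℕ → Carrier) (m r : ℕ) (v : Carrier) : Set where
    constructor hasRank
    field
      below : countLt f v m ℕ.≤ r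
      upto  : r ℕ.< countLe f v m

  open HasRank public

  -- Take the least entry with more than r entries at or below it; the largest entry shows that
  -- there is one. If more than r entries were strictly below it, the largest of those would qualify
  -- too, contradicting minimality.
  rank-exists : ∀ f m r → r ℕ.< m → ∃[ i ] i ℕ.< m × HasRank f m r (f i)
  rank-exists f m r r<m
    with extremum (λ x y → y ≤ x) (λ x y → ≤-total y x) (λ p q → ≤-trans q p) f always m
           (subst (1 ℕ.≤_) (sym (count-true m)) (ℕ.≤-trans (s≤s z≤n) r<m))
  ... | top , top< , _ , greatest
    with extremum _≤_ ≤-total ≤-trans f (λ i → does (r ℕ.<? countLe f (f i) m)) m
           (ℕ.≤-trans (subst (λ b → 1 ℕ.≤ bit b ℕ.+ count (λ i → does (r ℕ.<? countLe f (f i) m)) top)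
                              (sym (dec-true (r ℕ.<? countLe f (f top) m)
                                (ℕ.≤-trans r<m (subst (ℕ._≤ countLe f (f top) m) (count-true m)
                                  (count-mono m (λ j< _ → le-intro (greatest j< refl))))))) (s≤s z≤n))
                       (count-grow (λ i → does (r ℕ.<? countLe f (f i) m)) top<))
  ... | i , i< , p , least = i , i< , hasRank (ℕ.≮⇒≥ few) (does-true (r ℕ.<? _) p)
    where
    few : ¬ (r ℕ.< countLt f (f i) m)
    few many with extremum (λ x y → y ≤ x) (λ x y → ≤-total y x) (λ p q → ≤-trans q p) f (λ j → lt (f j) (f i)) m
                    (ℕ.≤-trans (s≤s z≤n) many)
    ... | u , u< , u<i , largest = lt-elim u<i (least u< (dec-true (r ℕ.<? _) (ℕ.≤-trans many
            (count-mono m (λ j< q → le-intro (largest j< q))))))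

  ≤-from-Lt : ∀ {x y z} → lt x y ≡ true → y ≤ z → lt x z ≡ true
  ≤-from-Lt x<y y≤z = lt-intro λ z≤x → lt-elim x<y (≤-trans y≤z z≤x)

  countLt+ : ∀ f v m → count (λ i → le v (f i)) m ℕ.+ countLt f v m ≡ m
  countLt+ f v m = count-complement (λ i → le v (f i)) m

  HasRank-cong : ∀ {f g m r v} → (∀ {i} → i ℕ.< m → f i ≡ g i) → HasRank f m r v → HasRank g m r v
  HasRank-cong {m = m} {r} {v} f≡g (hasRank b u) = hasRank
    (subst (ℕ._≤ r) (count-cong m (λ i< → cong (λ x → lt x v) (f≡g i<))) b)
    (subst (r ℕ.<_) (count-cong m (λ i< → cong (λ x → le x v) (f≡g i<))) u)

  -- The array g of kept entries is described only by counts of arbitrary Boolean properties, so the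
  -- positions of the entries never matter. If v exceeded π, all m′ kept entries would be below v,
  -- which is too many for rank r < m′.
  rank-less : ∀ {f g m m′ r v π} → m′ ≡ countLt f π m →
              (∀ (Q : Carrier → Bool) → count (λ i → Q (g i)) m′ ≡ count (λ i → lt (f i) π ∧ Q (f i)) m) →
              r ℕ.< m′ → HasRank g m′ r v → HasRank f m r v
  rank-less {f} {g} {m} {m′} {r} {v} {π} m′≡ kept r<m′ (hasRank b u) = hasRank few
      (ℕ.≤-trans u (ℕ.≤-trans (ℕ.≤-reflexive (kept (λ x → le x v))) (count-mono m (λ _ h → proj₂ (∧-elim {lt (f _) π} h)))))
    where
    few : countLt f v m ℕ.≤ r
    few with v ≤? π
    ... | yes v≤π = ℕ.≤-trans (count-mono m (λ _ h → ∧-intro (≤-from-Lt h v≤π) h))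
                      (ℕ.≤-trans (ℕ.≤-reflexive (sym (kept (λ x → lt x v)))) b)
    ... | no v≰π = ⊥-elim (ℕ.<⇒≱ r<m′ (begin
        m′  ≡⟨ m′≡ ⟩
        countLt f π m  ≤⟨ count-mono m (λ _ h → ∧-intro h (≤-from-Lt h (≰⇒≥ v≰π))) ⟩
        count (λ i → lt (f i) π ∧ lt (f i) v) m  ≡⟨ sym (kept (λ x → lt x v)) ⟩
        countLt g v m′  ≤⟨ b ⟩
        r  ∎))
      where open ℕ.≤-Reasoning

  -- Discarding the entries that are at most π lowers the rank by their number. The value v cannot
  -- be below π, since its positive count in g yields a kept entry at most v, and kept entries
  -- exceed π.
  rank-greater : ∀ {f g m m′ r v π} → m′ ≡ count (λ i → lt π (f i)) m →
                 (∀ (Q : Carrier → Bool) → count (λ i → Q (g i)) m′ ≡ count (λ i → lt π (f i) ∧ Q (f i)) m) →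
                 countLe f π m ℕ.≤ r → HasRank g m′ (r ℕ.∸ countLe f π m) v → HasRank f m r v
  rank-greater {f} {g} {m} {m′} {r} {v} {π} m′≡ kept e≤r (hasRank b u) = hasRank few many
    where
    open ℕ.≤-Reasoning
    e : ℕ
    e = countLe f π m
    upper : ∀ Q → count (λ i → Q (f i) ∧ lt π (f i)) m ≡ count (λ i → Q (g i)) m′
    upper Q = trans (count-cong m (λ {i} _ → ∧-comm (Q (f i)) (lt π (f i)))) (sym (kept Q))
    few : countLt f v m ℕ.≤ r
    few = begin
      countLt f v m  ≡⟨ count-split (λ i → lt (f i) v) (λ i → lt π (f i)) m ⟩
      count (λ i → lt (f i) v ∧ lt π (f i)) m ℕ.+ count (λ i → lt (f i) v ∧ ¬ᵇ lt π (f i)) m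
        ≤⟨ ℕ.≤-trans (ℕ.≤-reflexive (upper (λ x → lt x v))) b +≤
           count-mono m (λ {i} _ h → trans (sym (not-involutive (le (f i) π))) (proj₂ (∧-elim {lt (f i) v} h))) ⟩
      r ℕ.∸ e ℕ.+ e  ≡⟨ ℕ.m∸n+n≡m e≤r ⟩
      r  ∎
    many : r ℕ.< countLe f v m
    many with π ≤? v
    ... | yes π≤v = begin
      suc r  ≡⟨ cong suc (sym (ℕ.m∸n+n≡m e≤r)) ⟩
      suc (r ℕ.∸ e) ℕ.+ e
        ≤⟨ ℕ.≤-trans u (ℕ.≤-reflexive (sym (upper (λ x → le x v)))) +≤
           count-mono m (λ {i} _ h → ∧-intro (le-intro (≤-trans (le-elim h) π≤v)) (trans (not-involutive (le (f i) π)) h)) ⟩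
      count (λ i → le (f i) v ∧ lt π (f i)) m ℕ.+ count (λ i → le (f i) v ∧ ¬ᵇ lt π (f i)) m
                                                             ≡⟨ sym (count-split (λ i → le (f i) v) (λ i → lt π (f i)) m) ⟩
      countLe f v m  ∎
    ... | no π≰v with count-witness _ m (ℕ.≤-trans (s≤s z≤n) (ℕ.≤-trans u (ℕ.≤-reflexive (kept (λ x → le x v)))))
    ...   | i , _ , h with ∧-elim {lt π (f i)} h
    ...     | π<fi , fi≤v = ⊥-elim (lt-elim π<fi (≤-trans (le-elim fi≤v) (≰⇒≥ π≰v)))

  module _ (f μ : ℕ → Carrier) (m h r : ℕ) (π : Carrier) (5h≤m : 5 ℕ.* h ℕ.≤ m)
           (groups : ∀ {g} → g ℕ.< h → HasRank (λ j → f (5 ℕ.* g ℕ.+ j)) 5 2 (μ g))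
           (half≤ : 2 ℕ.* r ℕ.≤ h) (≤half : h ℕ.≤ 2 ℕ.* r ℕ.+ 1) (middle : HasRank μ h r π) where

    -- At least r + 1 ≥ (h + 1) / 2 group medians are at most π, and each brings three entries of
    -- its group. Both sides are doubled to avoid halves.
    pivot-above : 3 ℕ.* h ℕ.≤ 2 ℕ.* countLe f π m
    pivot-above = begin
        3 ℕ.* h  ≤⟨ ℕ.*-monoʳ-≤ 3 ≤half ⟩
        3 ℕ.* (2 ℕ.* r ℕ.+ 1)  ≤⟨ rearrange r ⟩
        2 ℕ.* (3 ℕ.* suc r)  ≤⟨ ℕ.*-monoʳ-≤ 2 (ℕ.*-monoʳ-≤ 3 (upto middle)) ⟩
        2 ℕ.* (3 ℕ.* countLe μ π h)      ≤⟨ ℕ.*-monoʳ-≤ 2 (count-groups (λ i → le (f i) π) (λ g → le (μ g) π) 5 3 h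
                                              λ {g} g< μ≤π → ℕ.≤-trans (upto (groups g<)) (count-mono {λ j → le (f (5 ℕ.* g ℕ.+ j)) (μ g)} {λ j → le (f (5 ℕ.* g ℕ.+ j)) π} 5
                                                λ _ fi≤μ → le-intro (≤-trans (le-elim fi≤μ) (le-elim μ≤π)))) ⟩
        2 ℕ.* countLe f π (5 ℕ.* h)      ≤⟨ ℕ.*-monoʳ-≤ 2 (count-grow _ 5h≤m) ⟩
        2 ℕ.* countLe f π m  ∎
      where
      open ℕ.≤-Reasoning
      rearrange : ∀ r → 3 ℕ.* (2 ℕ.* r ℕ.+ 1) ℕ.≤ 2 ℕ.* (3 ℕ.* suc r)
      rearrange r = linear 3 (z≤n {0}) (solve (r ∷ []))

    -- By complement: at most r ≤ h / 2 medians are below π, and in each other group at most two of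
    -- the five entries are below the median.
    pivot-below : 3 ℕ.* h ℕ.≤ 2 ℕ.* count (λ i → le π (f i)) m
    pivot-below = begin
        3 ℕ.* h  ≤⟨ rearrange {count (λ g → le π (μ g)) h} {countLt μ π h} (countLt+ μ π h) (ℕ.≤-trans (ℕ.*-monoʳ-≤ 2 (below middle)) half≤) ⟩
        2 ℕ.* (3 ℕ.* count (λ g → le π (μ g)) h)   ≤⟨ ℕ.*-monoʳ-≤ 2 (count-groups (λ i → le π (f i)) (λ g → le π (μ g)) 5 3 h
                                                        λ {g} g< π≤μ → ℕ.≤-trans (three {count (λ j → le (μ g) (f (5 ℕ.* g ℕ.+ j))) 5} {countLt (λ j → f (5 ℕ.* g ℕ.+ j)) (μ g) 5} (countLt+ (λ j → f (5 ℕ.* g ℕ.+ j)) (μ g) 5) (below (groups g<)))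
                                                          (count-mono {λ j → le (μ g) (f (5 ℕ.* g ℕ.+ j))} {λ j → le π (f (5 ℕ.* g ℕ.+ j))} 5 λ _ μ≤fi → le-intro (≤-trans (le-elim π≤μ) (le-elim μ≤fi)))) ⟩
        2 ℕ.* count (λ i → le π (f i)) (5 ℕ.* h)   ≤⟨ ℕ.*-monoʳ-≤ 2 (count-grow _ 5h≤m) ⟩
        2 ℕ.* count (λ i → le π (f i)) m  ∎
      where
      open ℕ.≤-Reasoning
      three : ∀ {a b} → a ℕ.+ b ≡ 5 → b ℕ.≤ 2 → 3 ℕ.≤ a
      three {a} {b} e b≤2 = ℕ.+-cancelʳ-≤ 2 3 a (subst (ℕ._≤ a ℕ.+ 2) e (ℕ.+-monoʳ-≤ a b≤2))
      identity : ∀ a b → 3 ℕ.* (a ℕ.+ b) ℕ.+ 3 ℕ.* (a ℕ.+ b) ℕ.+ 0 ≡ 2 ℕ.* (3 ℕ.* a) ℕ.+ 3 ℕ.* (2 ℕ.* b)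
      identity a b = solve (a ∷ b ∷ [])
      rearrange : ∀ {a b h} → a ℕ.+ b ≡ h → 2 ℕ.* b ℕ.≤ h → 3 ℕ.* h ℕ.≤ 2 ℕ.* (3 ℕ.* a)
      rearrange {a} {b} refl 2b≤h = linear 0 (ℕ.*-monoʳ-≤ 3 2b≤h) (identity a b)

-- A small language of arrays, compiled into the machine language.  Arrays are
-- named by natural numbers and unbounded; scalars are the entries 0.  The input
-- is read only and is never moved.  There is one parameterless procedure.

infix  9 _‼_ _‼ʳ_
infixl 7 _*ᵉ_ _*ʳ_ _/ʳ_
infixl 6 _+ᵉ_ _-ᵉ_ _+ʳ_ _-ʳ_
infix  4 _≤ᵉ_ _≤ʳᵉ_
infixr 3 _andᵉ_
infix  2 _[_]≔_ _[_]≔ʳ_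
infixr 1 _⨟_

mutual
  data IE : Set where
    lit            : ℕ → IE
    nᵉ kᵉ          : IE
    _‼_            : ℕ → IE → IE
    _+ᵉ_ _-ᵉ_ _*ᵉ_ : IE → IE → IE
    floorᵉ         : RE → IE

  data RE : Set where
    castᵉ               : IE → RE
    εᵉ                  : RE
    xᵉ yᵉ               : IE → RE
    _‼ʳ_                : ℕ → IE → RE
    _+ʳ_ _-ʳ_ _*ʳ_ _/ʳ_ : RE → RE → RE

data BE : Set where
  _≤ᵉ_   : IE → IE → BE
  _≤ʳᵉ_  : RE → RE → BE
  notᵉ   : BE → BE
  _andᵉ_ : BE → BE → BE

data Com : Set where
  _[_]≔_  : ℕ → IE → IE → Com
  _[_]≔ʳ_ : ℕ → IE → RE → Com
  _⨟_     : Com → Com → Com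
  ifᵉ     : BE → Com → Com → Com
  whileᵉ  : BE → Com → Com
  recurse : Com

ivar : ℕ → IE
ivar a = a ‼ lit 0

rvar : ℕ → RE
rvar a = a ‼ʳ lit 0

infix 2 _:=_ _:=ʳ_
_:=_ : ℕ → IE → Com
a := e = a [ lit 0 ]≔ e

_:=ʳ_ : ℕ → RE → Com
a :=ʳ e = a [ lit 0 ]≔ʳ e

codeⁱ : ℕ → IntExp → IntExp
codeⁱ a e = const (2 ℕ.^ a) ⊗ (const 1 ⊕ const 2 ⊗ e)

-- This is the minimum of e and n - 1. Every read of a coordinate thus hits an input cell, so that
-- soundness of evaluation needs no side condition on indices.
clampⁱ : IntExp → IntExp
clampⁱ e = e ⊖ (e ⊖ (int[ const 0 ] ⊖ const 1))

mutual
  compileⁱ : IE → IntExp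
  compileⁱ (lit m)    = const m
  compileⁱ nᵉ         = int[ const 0 ]
  compileⁱ kᵉ         = int[ const 1 ]
  -- Cells 0 and 1 hold n and k, and `code` is positive, so the integer arrays start at cell 2.
  compileⁱ (a ‼ e)    = int[ const 1 ⊕ codeⁱ a (compileⁱ e) ]
  compileⁱ (d +ᵉ e)   = compileⁱ d ⊕ compileⁱ e
  compileⁱ (d -ᵉ e)   = compileⁱ d ⊖ compileⁱ e
  compileⁱ (d *ᵉ e)   = compileⁱ d ⊗ compileⁱ e
  compileⁱ (floorᵉ x) = floor (compileʳ x)

  compileʳ : RE → RealExp
  compileʳ (castᵉ e) = cast (compileⁱ e)
  compileʳ εᵉ        = real[ const 0 ]
  compileʳ (xᵉ e)    = real[ const 1 ⊕ const 2 ⊗ clampⁱ (compileⁱ e) ]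
  compileʳ (yᵉ e)    = real[ const 2 ⊕ const 2 ⊗ clampⁱ (compileⁱ e) ]
  -- Cell 0 holds ε and cells 1 to 2 n hold the coordinates; the real arrays lie above them.
  compileʳ (a ‼ʳ e)  = real[ const 2 ⊗ int[ const 0 ] ⊕ codeⁱ a (compileⁱ e) ]
  compileʳ (x +ʳ y)  = compileʳ x ⊕ compileʳ y
  compileʳ (x -ʳ y)  = compileʳ x ⊖ compileʳ y
  compileʳ (x *ʳ y)  = compileʳ x ⊗ compileʳ y
  compileʳ (x /ʳ y)  = compileʳ x ⊘ compileʳ y

compileᵇ : BE → BoolExp
compileᵇ (d ≤ᵉ e)   = compileⁱ d ≤ⁱ compileⁱ e
compileᵇ (x ≤ʳᵉ y)  = compileʳ x ≤ʳ compileʳ y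
compileᵇ (notᵉ b)   = not (compileᵇ b)
compileᵇ (b andᵉ c) = compileᵇ b and compileᵇ c

compile : Com → Cmd 1
compile (a [ e ]≔ v)  = int[ const 1 ⊕ codeⁱ a (compileⁱ e) ]≔ compileⁱ v
compile (a [ e ]≔ʳ v) = real[ const 2 ⊗ int[ const 0 ] ⊕ codeⁱ a (compileⁱ e) ]≔ compileʳ v
compile (c ⨟ d)       = compile c ⨾ compile d
compile (ifᵉ b c d)   = cond (compileᵇ b) (compile c) (compile d)
compile (whileᵉ b c)  = while (compileᵇ b) (compile c)
compile recurse       = call fzero

-- Bounds the cost of a single step of a command.
weight : Com → ℕ
weight (a [ e ]≔ v)  = suc (costⁱ (const 1 ⊕ codeⁱ a (compileⁱ e)) ℕ.+ costⁱ (compileⁱ v))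
weight (a [ e ]≔ʳ v) = suc (costⁱ (const 2 ⊗ int[ const 0 ] ⊕ codeⁱ a (compileⁱ e)) ℕ.+ costʳ (compileʳ v))
weight (c ⨟ d)       = weight c ℕ.+ weight d
weight (ifᵉ b c d)   = suc (costᵇ (compileᵇ b)) ℕ.+ (weight c ℕ.+ weight d)
weight (whileᵉ b c)  = suc (costᵇ (compileᵇ b)) ℕ.+ weight c
weight recurse       = 1

-- Whether a command assigns to array a, given whether the procedure does.
writesⁱ : Bool → ℕ → Com → Bool
writesⁱ r a (b [ _ ]≔ _)  = does (b ℕ.≟ a)
writesⁱ r a (b [ _ ]≔ʳ _) = false
writesⁱ r a (c ⨟ d)       = writesⁱ r a c ∨ writesⁱ r a d
writesⁱ r a (ifᵉ _ c d)   = writesⁱ r a c ∨ writesⁱ r a d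
writesⁱ r a (whileᵉ _ c)  = writesⁱ r a c
writesⁱ r a recurse       = r

writesʳ : Bool → ℕ → Com → Bool
writesʳ r a (b [ _ ]≔ _)  = false
writesʳ r a (b [ _ ]≔ʳ _) = does (b ℕ.≟ a)
writesʳ r a (c ⨟ d)       = writesʳ r a c ∨ writesʳ r a d
writesʳ r a (ifᵉ _ c d)   = writesʳ r a c ∨ writesʳ r a d
writesʳ r a (whileᵉ _ c)  = writesʳ r a c
writesʳ r a recurse       = r

∨-false : ∀ {b c} → b ∨ c ≡ false → b ≡ false × c ≡ false
∨-false {false} {false} _ = refl , refl

-- Semantics of the array language and its simulation by the machine

record Env (A : Set) : Set where
  field
    n k   : ℕ
    ε     : A
    X Y   : ℕ → A

clamp : ℕ → ℕ → ℕ
clamp n i = i ℕ.∸ (i ℕ.∸ (n ℕ.∸ 1))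

clamp-≤ : ∀ m i → i ℕ.∸ (i ℕ.∸ m) ℕ.≤ m
clamp-≤ m i with ℕ.≤-total i m
... | inj₁ i≤m = ℕ.≤-trans (ℕ.m∸n≤m i (i ℕ.∸ m)) i≤m
... | inj₂ m≤i = ℕ.≤-reflexive (ℕ.m∸[m∸n]≡n m≤i)

clamp-< : ∀ {n} i → 1 ℕ.≤ n → clamp n i ℕ.< n
clamp-< {suc n} i _ = s≤s (clamp-≤ n i)

clamp-id : ∀ {n i} → i ℕ.< n → clamp n i ≡ i
clamp-id {suc n} {i} (s≤s i≤n) = cong (i ℕ.∸_) (ℕ.m≤n⇒m∸n≡0 i≤n)

module Arrays (ℝ : CompleteOrderedField) (E : Env (CompleteOrderedField.Carrier ℝ)) (body : Com) where
  private module R = CompleteOrderedField ℝ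
  open import Data.Nat.Base using (_+_; _∸_; _*_; _≤_; _<_)
  open Machine ℝ
  open Env E

  record Store : Set where
    constructor store
    field
      I : ℕ → ℕ → ℕ
      R : ℕ → ℕ → R.Carrier

  open Store public

  mutual
    evalⁱ : IE → Store → ℕ
    evalⁱ (lit m) σ    = m
    evalⁱ nᵉ σ         = n
    evalⁱ kᵉ σ         = k
    evalⁱ (a ‼ e) σ    = I σ a (evalⁱ e σ)
    evalⁱ (d +ᵉ e) σ   = evalⁱ d σ + evalⁱ e σ
    evalⁱ (d -ᵉ e) σ   = evalⁱ d σ ∸ evalⁱ e σ
    evalⁱ (d *ᵉ e) σ   = evalⁱ d σ * evalⁱ e σ
    evalⁱ (floorᵉ x) σ = R.floor (evalʳ x σ)

    evalʳ : RE → Store → R.Carrier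
    evalʳ (castᵉ e) σ = R.fromℕ (evalⁱ e σ)
    evalʳ εᵉ σ        = ε
    evalʳ (xᵉ e) σ    = X (clamp n (evalⁱ e σ))
    evalʳ (yᵉ e) σ    = Y (clamp n (evalⁱ e σ))
    evalʳ (a ‼ʳ e) σ  = R σ a (evalⁱ e σ)
    evalʳ (x +ʳ y) σ  = evalʳ x σ R.+ evalʳ y σ
    evalʳ (x -ʳ y) σ  = evalʳ x σ R.- evalʳ y σ
    evalʳ (x *ʳ y) σ  = evalʳ x σ R.* evalʳ y σ
    evalʳ (x /ʳ y) σ  = evalʳ x σ R./ evalʳ y σ

  evalᵇ : BE → Store → Bool
  evalᵇ (d ≤ᵉ e) σ   = does (evalⁱ d σ ℕ.≤? evalⁱ e σ)
  evalᵇ (x ≤ʳᵉ y) σ  = does (evalʳ x σ R.≤? evalʳ y σ)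
  evalᵇ (notᵉ b) σ   = ¬ᵇ evalᵇ b σ
  evalᵇ (b andᵉ c) σ = evalᵇ b σ ∧ evalᵇ c σ

  setⁱ : Store → ℕ → ℕ → ℕ → Store
  setⁱ σ a i v = store (update (I σ) a (update (I σ a) i v)) (R σ)

  setʳ : Store → ℕ → ℕ → R.Carrier → Store
  setʳ σ a i v = store (I σ) (update (R σ) a (update (R σ a) i v))

  -- Expressions are free here: in a fixed program their costs are bounded by a constant, which
  -- `simulate` restores as a factor.
  data Exec : Com → Store → Store → ℕ → Set where
    int-step   : ∀ {σ a e v} → Exec (a [ e ]≔ v) σ (setⁱ σ a (evalⁱ e σ) (evalⁱ v σ)) 1
    real-step  : ∀ {σ a e v} → Exec (a [ e ]≔ʳ v) σ (setʳ σ a (evalⁱ e σ) (evalʳ v σ)) 1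
    seq        : ∀ {σ σ′ σ″ c d t u} → Exec c σ σ′ t → Exec d σ′ σ″ u → Exec (c ⨟ d) σ σ″ (t + u)
    if-true    : ∀ {σ σ′ b c d t} → evalᵇ b σ ≡ true → Exec c σ σ′ t → Exec (ifᵉ b c d) σ σ′ (suc t)
    if-false   : ∀ {σ σ′ b c d t} → evalᵇ b σ ≡ false → Exec d σ σ′ t → Exec (ifᵉ b c d) σ σ′ (suc t)
    while-done : ∀ {σ b c} → evalᵇ b σ ≡ false → Exec (whileᵉ b c) σ σ 1
    while-step : ∀ {σ σ′ σ″ b c t u} → evalᵇ b σ ≡ true → Exec c σ σ′ t → Exec (whileᵉ b c) σ′ σ″ u →
                 Exec (whileᵉ b c) σ σ″ (suc (t + u))
    recursive  : ∀ {σ σ′ t} → Exec body σ σ′ t → Exec recurse σ σ′ (suc t)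

  record Represents (s : State) (σ : Store) : Set where
    field
      n-rep : ints s 0 ≡ n
      k-rep : ints s 1 ≡ k
      ε-rep : reals s 0 ≡ ε
      x-rep : ∀ {i} → i < n → reals s (1 + 2 * i) ≡ X i
      y-rep : ∀ {i} → i < n → reals s (2 + 2 * i) ≡ Y i
      I-rep : ∀ a i → ints s (1 + code a i) ≡ I σ a i
      R-rep : ∀ a i → reals s (2 * n + code a i) ≡ R σ a i

  open Represents public

  module _ (1≤n : 1 ≤ n) where

    module _ {s σ} (rep : Represents s σ) where
      mutual
        sound-evalⁱ : ∀ e → ⟦ compileⁱ e ⟧ⁱ s ≡ evalⁱ e σ
        sound-evalⁱ (lit m) = refl
        sound-evalⁱ nᵉ = n-rep rep
        sound-evalⁱ kᵉ = k-rep rep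
        sound-evalⁱ (a ‼ e) = trans (cong (λ i → ints s (1 + code a i)) (sound-evalⁱ e)) (I-rep rep a _)
        sound-evalⁱ (d +ᵉ e) = cong₂ _+_ (sound-evalⁱ d) (sound-evalⁱ e)
        sound-evalⁱ (d -ᵉ e) = cong₂ _∸_ (sound-evalⁱ d) (sound-evalⁱ e)
        sound-evalⁱ (d *ᵉ e) = cong₂ _*_ (sound-evalⁱ d) (sound-evalⁱ e)
        sound-evalⁱ (floorᵉ x) = cong R.floor (sound-evalʳ x)

        sound-evalʳ : ∀ x → ⟦ compileʳ x ⟧ʳ s ≡ evalʳ x σ
        sound-evalʳ (castᵉ e) = cong R.fromℕ (sound-evalⁱ e)
        sound-evalʳ εᵉ = ε-rep rep
        sound-evalʳ (xᵉ e) = trans (cong₂ (λ m i → reals s (1 + 2 * clamp m i)) (n-rep rep) (sound-evalⁱ e))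
                                   (x-rep rep (clamp-< _ 1≤n))
        sound-evalʳ (yᵉ e) = trans (cong₂ (λ m i → reals s (2 + 2 * clamp m i)) (n-rep rep) (sound-evalⁱ e))
                                   (y-rep rep (clamp-< _ 1≤n))
        sound-evalʳ (a ‼ʳ e) = trans (cong₂ (λ m i → reals s (2 * m + code a i)) (n-rep rep) (sound-evalⁱ e))
                                     (R-rep rep a _)
        sound-evalʳ (x +ʳ y) = cong₂ R._+_ (sound-evalʳ x) (sound-evalʳ y)
        sound-evalʳ (x -ʳ y) = cong₂ R._-_ (sound-evalʳ x) (sound-evalʳ y)
        sound-evalʳ (x *ʳ y) = cong₂ R._*_ (sound-evalʳ x) (sound-evalʳ y)
        sound-evalʳ (x /ʳ y) = cong₂ R._/_ (sound-evalʳ x) (sound-evalʳ y)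

      sound-evalᵇ : ∀ b → ⟦ compileᵇ b ⟧ᵇ s ≡ evalᵇ b σ
      sound-evalᵇ (d ≤ᵉ e) = cong₂ (λ u v → does (u ℕ.≤? v)) (sound-evalⁱ d) (sound-evalⁱ e)
      sound-evalᵇ (x ≤ʳᵉ y) = cong₂ (λ u v → does (u R.≤? v)) (sound-evalʳ x) (sound-evalʳ y)
      sound-evalᵇ (notᵉ b) = cong ¬ᵇ_ (sound-evalᵇ b)
      sound-evalᵇ (b andᵉ c) = cong₂ _∧_ (sound-evalᵇ b) (sound-evalᵇ c)

    module _ {A : Set} (addr : ℕ → ℕ → ℕ)
             (addr-injective : ∀ a b {i j} → addr a i ≡ addr b j → a ≡ b × i ≡ j) where

      update-addr : ∀ (f : ℕ → A) (g : ℕ → ℕ → A) → (∀ a i → f (addr a i) ≡ g a i) →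
                    ∀ a i v b j → update f (addr a i) v (addr b j) ≡ update g a (update (g a) i v) b j
      update-addr f g h a i v b j with a ℕ.≟ b
      ... | no a≢b = trans (update-there f _ v (λ e → a≢b (proj₁ (addr-injective a b e))))
                           (trans (h b j) (sym (cong-app (update-there g a _ a≢b) j)))
      ... | yes refl with i ℕ.≟ j
      ...   | no i≢j = trans (update-there f _ v (λ e → i≢j (proj₂ (addr-injective a a e))))
                         (trans (h a j) (sym (trans (cong-app (update-here g a _) j) (update-there (g a) i v i≢j))))
      ...   | yes refl = trans (update-here f _ v) (sym (trans (cong-app (update-here g a _) j) (update-here (g a) i v)))

    set-int : ∀ {s σ} → Represents s σ → ∀ a i v →
              Represents ⟨ update (ints s) (1 + code a i) v , reals s ⟩ (setⁱ σ a i v)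
    set-int {s} {σ} rep a i v = record
      { n-rep = n-rep rep
      ; k-rep = trans (update-there (ints s) _ v (λ e → ℕ.<⇒≢ (code-pos a i) (sym (ℕ.suc-injective e)))) (k-rep rep)
      ; ε-rep = ε-rep rep
      ; x-rep = x-rep rep
      ; y-rep = y-rep rep
      ; I-rep = update-addr (λ b j → 1 + code b j) (λ b c e → code-injective b c (ℕ.suc-injective e))
                            (ints s) (I σ) (I-rep rep) a i v
      ; R-rep = R-rep rep
      }

    array-above : ∀ {j} a i → j ≤ 2 * n → ¬ (2 * n + code a i ≡ j)
    array-above {j} a i j≤ e = ℕ.<⇒≢ (begin-strict
        j  ≤⟨ j≤ ⟩
        2 * n  <⟨ ℕ.n<1+n _ ⟩
        1 + 2 * n  ≡⟨ ℕ.+-comm 1 (2 * n) ⟩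
        2 * n + 1  ≤⟨ ℕ.+-monoʳ-≤ (2 * n) (code-pos a i) ⟩
        2 * n + code a i     ∎) (sym e)
      where open ℕ.≤-Reasoning

    x-below : ∀ {i} → i < n → 2 + 2 * i ≤ 2 * n
    x-below {i} i<n = subst (_≤ 2 * n) (ℕ.*-suc 2 i) (ℕ.*-monoʳ-≤ 2 i<n)

    set-real : ∀ {s σ} → Represents s σ → ∀ a i v →
               Represents ⟨ ints s , update (reals s) (2 * n + code a i) v ⟩ (setʳ σ a i v)
    set-real {s} {σ} rep a i v = record
      { n-rep = n-rep rep
      ; k-rep = k-rep rep
      ; ε-rep = trans (update-there (reals s) _ v (array-above a i z≤n)) (ε-rep rep)
      ; x-rep = λ {j} j<n → trans (update-there (reals s) _ v (array-above a i
                  (ℕ.≤-trans (ℕ.n≤1+n _) (x-below j<n)))) (x-rep rep j<n)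
      ; y-rep = λ {j} j<n → trans (update-there (reals s) _ v (array-above a i (x-below j<n))) (y-rep rep j<n)
      ; I-rep = I-rep rep
      ; R-rep = update-addr (λ b j → 2 * n + code b j)
                  (λ b c e → code-injective b c (ℕ.+-cancelˡ-≡ (2 * n) _ _ e))
                  (reals s) (R σ) (R-rep rep) a i v
      }

    module _ (K : ℕ) (body≤K : weight body ≤ K) where

      Simulated : Com → State → Store → ℕ → Set
      Simulated c s σ′ t = ∃[ s′ ] ∃[ u ] ((compile body Vec.∷ Vec.[]) ⊢ compile c , s ⇓ s′ , u) ×
                           (u ≤ K * t) × Represents s′ σ′

      within : ∀ {u v w} → w ≡ v → u ≤ w → u ≤ v
      within refl h = h

      -- Whatever is executed is a subterm of the main command or of the procedure body, so its
      -- weight is at most K, and each array step is charged at most K time units.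
      simulate : ∀ {c s σ σ′ t} → weight c ≤ K → Exec c σ σ′ t → Represents s σ → Simulated c s σ′ t
      simulate {a [ e ]≔ v} {s} {σ} w int-step rep =
        _ , _ , ⇓-int , within (sym (ℕ.*-identityʳ K)) w ,
        subst₂ (λ i x → Represents ⟨ update (ints s) (1 + code a i) x , reals s ⟩ (setⁱ σ a (evalⁱ e σ) (evalⁱ v σ)))
          (sym (sound-evalⁱ rep e)) (sym (sound-evalⁱ rep v)) (set-int rep a (evalⁱ e σ) (evalⁱ v σ))
      simulate {a [ e ]≔ʳ v} {s} {σ} w real-step rep =
        _ , _ , ⇓-real , within (sym (ℕ.*-identityʳ K)) w ,
        subst₂ (λ i x → Represents ⟨ ints s , update (reals s) i x ⟩ (setʳ σ a (evalⁱ e σ) (evalʳ v σ)))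
          (cong₂ (λ m i → 2 * m + code a i) (sym (n-rep rep)) (sym (sound-evalⁱ rep e)))
          (sym (sound-evalʳ rep v)) (set-real rep a (evalⁱ e σ) (evalʳ v σ))
      simulate {c ⨟ d} w (seq p q) rep
        with simulate (ℕ.m+n≤o⇒m≤o _ w) p rep
      ... | _ , u , p′ , u≤ , rep′ with simulate (ℕ.m+n≤o⇒n≤o (weight c) w) q rep′
      ... | _ , u′ , q′ , u′≤ , rep″ =
        _ , _ , ⇓-seq p′ q′ , within (sym (ℕ.*-distribˡ-+ K _ _)) (u≤ +≤ u′≤) , rep″
      simulate {ifᵉ b c d} w (if-true h p) rep
        with simulate (ℕ.m+n≤o⇒m≤o _ (ℕ.m+n≤o⇒n≤o (suc (costᵇ (compileᵇ b))) w)) p rep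
      ... | _ , u , p′ , u≤ , rep′ =
        _ , _ , ⇓-then (trans (sound-evalᵇ rep b) h) p′ ,
        within (sym (ℕ.*-suc K _)) (ℕ.m+n≤o⇒m≤o (suc (costᵇ (compileᵇ b))) w +≤ u≤) , rep′
      simulate {ifᵉ b c d} w (if-false h p) rep
        with simulate (ℕ.m+n≤o⇒n≤o (weight c) (ℕ.m+n≤o⇒n≤o (suc (costᵇ (compileᵇ b))) w)) p rep
      ... | _ , u , p′ , u≤ , rep′ =
        _ , _ , ⇓-else (trans (sound-evalᵇ rep b) h) p′ ,
        within (sym (ℕ.*-suc K _)) (ℕ.m+n≤o⇒m≤o (suc (costᵇ (compileᵇ b))) w +≤ u≤) , rep′
      simulate {whileᵉ b c} w (while-done h) rep =
        _ , _ , ⇓-done (trans (sound-evalᵇ rep b) h) ,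
        within (sym (ℕ.*-identityʳ K)) (ℕ.m+n≤o⇒m≤o (suc (costᵇ (compileᵇ b))) w) , rep
      simulate {whileᵉ b c} w (while-step {t = t} h p q) rep
        with simulate (ℕ.m+n≤o⇒n≤o (suc (costᵇ (compileᵇ b))) w) p rep
      ... | _ , u , p′ , u≤ , rep′ with simulate w q rep′
      ... | _ , u′ , q′ , u′≤ , rep″ =
        _ , _ , ⇓-while (trans (sound-evalᵇ rep b) h) p′ q′ ,
        within (sym (trans (ℕ.*-suc K _) (cong (K +_) (ℕ.*-distribˡ-+ K t _))))
          (ℕ.m+n≤o⇒m≤o (suc (costᵇ (compileᵇ b))) w +≤ (u≤ +≤ u′≤)) , rep″
      simulate {recurse} w (recursive p) rep with simulate body≤K p rep
      ... | _ , u , p′ , u≤ , rep′ =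
        _ , _ , ⇓-call p′ , within (sym (ℕ.*-suc K _)) (w +≤ u≤) , rep′

  -- Framing and timed total correctness

  changesⁱ changesʳ : ℕ → Com → Bool
  -- A recursive call writes what the body writes. This least fixed point of a monotone Boolean map
  -- is reached after one iteration from `false`.
  changesⁱ a = writesⁱ (writesⁱ false a body) a
  changesʳ a = writesʳ (writesʳ false a body) a

  -- For concrete commands the side condition is a closed Boolean, so each use of a frame is
  -- justified by `refl`.
  record Frame (c : Com) (σ σ′ : Store) : Set where
    field
      intᶠ  : ∀ a → changesⁱ a c ≡ false → I σ′ a ≡ I σ a
      realᶠ : ∀ a → changesʳ a c ≡ false → R σ′ a ≡ R σ a

  open Frame public

  int₀ : ∀ {c σ σ′} → Frame c σ σ′ → ∀ a → changesⁱ a c ≡ false → I σ′ a 0 ≡ I σ a 0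
  int₀ f a w = cong-app (intᶠ f a w) 0

  real₀ : ∀ {c σ σ′} → Frame c σ σ′ → ∀ a → changesʳ a c ≡ false → R σ′ a 0 ≡ R σ a 0
  real₀ f a w = cong-app (realᶠ f a w) 0

  exec-int : ∀ {c σ σ′ t} a → changesⁱ a c ≡ false → Exec c σ σ′ t → I σ′ a ≡ I σ a
  exec-int {b [ e ]≔ v} {σ} a w int-step = update-there (I σ) b _ (does-false (b ℕ.≟ a) w)
  exec-int a w real-step = refl
  exec-int {c ⨟ d} a w (seq p q) with ∨-false {changesⁱ a c} w
  ... | w₁ , w₂ = trans (exec-int a w₂ q) (exec-int a w₁ p)
  exec-int {ifᵉ b c d} a w (if-true _ p) = exec-int a (proj₁ (∨-false {changesⁱ a c} w)) p
  exec-int {ifᵉ b c d} a w (if-false _ p) = exec-int a (proj₂ (∨-false {changesⁱ a c} w)) p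
  exec-int a w (while-done _) = refl
  exec-int a w (while-step _ p q) = trans (exec-int a w q) (exec-int a w p)
  -- For `recurse`, w says that `writesⁱ false a body` is `false`; substituting this value for the
  -- flag turns w into the condition for the body itself.
  exec-int a w (recursive p) = exec-int a (subst (λ r → writesⁱ r a body ≡ false) (sym w) w) p

  exec-real : ∀ {c σ σ′ t} a → changesʳ a c ≡ false → Exec c σ σ′ t → R σ′ a ≡ R σ a
  exec-real {b [ e ]≔ʳ v} {σ} a w real-step = update-there (R σ) b _ (does-false (b ℕ.≟ a) w)
  exec-real a w int-step = refl
  exec-real {c ⨟ d} a w (seq p q) with ∨-false {changesʳ a c} w
  ... | w₁ , w₂ = trans (exec-real a w₂ q) (exec-real a w₁ p)
  exec-real {ifᵉ b c d} a w (if-true _ p) = exec-real a (proj₁ (∨-false {changesʳ a c} w)) p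
  exec-real {ifᵉ b c d} a w (if-false _ p) = exec-real a (proj₂ (∨-false {changesʳ a c} w)) p
  exec-real a w (while-done _) = refl
  exec-real a w (while-step _ p q) = trans (exec-real a w q) (exec-real a w p)
  exec-real a w (recursive p) = exec-real a (subst (λ r → writesʳ r a body ≡ false) (sym w) w) p

  frame : ∀ {c σ σ′ t} → Exec c σ σ′ t → Frame c σ σ′
  frame p = record { intᶠ = λ a w → exec-int a w p ; realᶠ = λ a w → exec-real a w p }

  frame-refl : ∀ {c σ} → Frame c σ σ
  frame-refl = record { intᶠ = λ _ _ → refl ; realᶠ = λ _ _ → refl }

  frame-trans : ∀ {c σ σ′ σ″} → Frame c σ σ′ → Frame c σ′ σ″ → Frame c σ σ″
  frame-trans f g = record
    { intᶠ  = λ a w → trans (intᶠ g a w) (intᶠ f a w)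
    ; realᶠ = λ a w → trans (realᶠ g a w) (realᶠ f a w)
    }

  -- Total correctness from one given store: preconditions are ordinary hypotheses on σ, and Q may
  -- refer to σ.
  record Triple (c : Com) (σ : Store) (T : ℕ) (Q : Store → Set) : Set where
    constructor triple
    field
      {final} : Store
      {time}  : ℕ
      exec    : Exec c σ final time
      bounded : time ≤ T
      post    : Q final

  weaken : ∀ {c σ T T′ Q Q′} → T ≤ T′ → Triple c σ T Q → (∀ {σ′} → Frame c σ σ′ → Q σ′ → Q′ σ′) → Triple c σ T′ Q′
  weaken T≤ (triple p b q) f = triple p (ℕ.≤-trans b T≤) (f (frame p) q)

  infixr 1 _▹_
  _▹_ : ∀ {c d σ T U Q S} → Triple c σ T Q → (∀ {σ′} → Frame c σ σ′ → Q σ′ → Triple d σ′ U S) → Triple (c ⨟ d) σ (T + U) S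
  triple p b q ▹ f with f (frame p) q
  ... | triple p′ b′ q′ = triple (seq p p′) (b +≤ b′) q′

  infixr 1 intₜ_ realₜ_
  intₜ_ : ∀ {a e v d σ U S} → Triple d (setⁱ σ a (evalⁱ e σ) (evalⁱ v σ)) U S → Triple (a [ e ]≔ v ⨟ d) σ (suc U) S
  intₜ triple p b q = triple (seq int-step p) (s≤s b) q

  realₜ_ : ∀ {a e v d σ U S} → Triple d (setʳ σ a (evalⁱ e σ) (evalʳ v σ)) U S → Triple (a [ e ]≔ʳ v ⨟ d) σ (suc U) S
  realₜ triple p b q = triple (seq real-step p) (s≤s b) q

  int-last : ∀ {a e v σ S} → S (setⁱ σ a (evalⁱ e σ) (evalⁱ v σ)) → Triple (a [ e ]≔ v) σ 1 S
  int-last q = triple int-step ℕ.≤-refl q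

  real-last : ∀ {a e v σ S} → S (setʳ σ a (evalⁱ e σ) (evalʳ v σ)) → Triple (a [ e ]≔ʳ v) σ 1 S
  real-last q = triple real-step ℕ.≤-refl q

  callₜ : ∀ {σ T Q} → Triple body σ T Q → Triple recurse σ (suc T) Q
  callₜ (triple p b q) = triple (recursive p) (s≤s b) q

  branch : ∀ {b c d σ T Q} → (evalᵇ b σ ≡ true → Triple c σ T Q) → (evalᵇ b σ ≡ false → Triple d σ T Q) →
           Triple (ifᵉ b c d) σ (suc T) Q
  branch {b} {σ = σ} f g with evalᵇ b σ in eq
  ... | true  with f refl
  ...   | triple p b q = triple (if-true eq p) (s≤s b) q
  branch {b} {σ = σ} f g | false with g refl
  ...   | triple p b q = triple (if-false eq p) (s≤s b) q

  -- The iteration number j exists only in the proof and need not be a program variable. Each step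
  -- must show j < N, which yields both termination, by recursion on N - i, and the time bound.
  loop : ∀ {b c} (N B : ℕ) (Inv : ℕ → Store → Set) {i σ} → Inv i σ → i ≤ N →
         (∀ {j τ} → Frame c σ τ → Inv j τ → evalᵇ b τ ≡ true → j < N × Triple c τ B (Inv (suc j))) →
         Triple (whileᵉ b c) σ (suc (N * suc B)) (λ τ → ∃[ j ] Inv j τ × j ≤ N × evalᵇ b τ ≡ false)
  loop {b} {c} N B Inv {i} {σ} inv i≤N step = weaken (s≤s (ℕ.*-monoˡ-≤ (suc B) (ℕ.m∸n≤m N i))) (go (N ∸ i) refl frame-refl inv i≤N) (λ _ q → q)
    where
    go : ∀ f {i τ} → N ∸ i ≡ f → Frame c σ τ → Inv i τ → i ≤ N →
         Triple (whileᵉ b c) τ (suc (f * suc B)) (λ τ′ → ∃[ j ] Inv j τ′ × j ≤ N × evalᵇ b τ′ ≡ false)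
    go f {i} {τ} e fr inv i≤N with evalᵇ b τ in eq
    ... | false = triple (while-done eq) (s≤s z≤n) (i , inv , i≤N , eq)
    ... | true with step fr inv eq
    go zero e fr inv i≤N | true | i<N , _ = ⊥-elim (ℕ.<⇒≱ i<N (ℕ.m∸n≡0⇒m≤n e))
    go (suc f) {i} e fr inv i≤N | true | i<N , triple p b q
      with go f {suc i} (trans (sym (ℕ.pred[m∸n]≡m∸[1+n] N i)) (cong ℕ.pred e)) (frame-trans fr (frame p)) q i<N
    ... | triple p′ b′ q′ = triple (while-step eq p p′) (s≤s (ℕ.≤-trans (b +≤ b′) (ℕ.≤-reflexive (ℕ.+-suc B _)))) q′

  -- The body has to establish the invariant for the store in which the loop variable is already
  -- advanced. Reads of other arrays in that store reduce by computation.
  Next : ℕ → (ℕ → Store → Set) → ℕ → Store → Set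
  Next v Inv j τ = Inv (suc j) (setⁱ τ v 0 (suc (I τ v 0)))

  -- The limit `e` is evaluated anew before every iteration, hence the hypothesis that its value
  -- stays N.
  for : ∀ {v e c} N B (Inv : ℕ → Store → Set) {σ} → changesⁱ v c ≡ false →
        Inv 0 (setⁱ σ v 0 0) →
        (∀ {j τ} → Frame (c ⨟ v := lit 1 +ᵉ ivar v) σ τ → I τ v 0 ≡ j → j ≤ N → Inv j τ → evalⁱ e τ ≡ N) →
        (∀ {j τ} → Frame (c ⨟ v := lit 1 +ᵉ ivar v) σ τ → I τ v 0 ≡ j → j < N → Inv j τ →
           Triple c τ B (Next v Inv j)) →
        Triple (v := lit 0 ⨟ whileᵉ (lit 1 +ᵉ ivar v ≤ᵉ e) (c ⨟ v := lit 1 +ᵉ ivar v)) σ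
               (2 + N * (2 + B)) (Inv N)
  for {v} {e} {c} N B Inv {σ} w inv₀ len step =
      intₜ weaken ℕ.≤-refl (loop N (suc B) Inv′ (inv₀ , cong-app (update-here (I σ) v _) 0 , z≤n) z≤n next) finish
    where
    Inv′ : ℕ → Store → Set
    Inv′ j τ = Inv j τ × I τ v 0 ≡ j × j ≤ N

    frame₀ : Frame (c ⨟ v := lit 1 +ᵉ ivar v) σ (setⁱ σ v 0 0)
    frame₀ = record
      { intᶠ  = λ a h → update-there (I σ) v _ (does-false (v ℕ.≟ a) (proj₂ (∨-false {changesⁱ a c} h)))
      ; realᶠ = λ _ _ → refl
      }

    next : ∀ {j τ} → Frame (c ⨟ v := lit 1 +ᵉ ivar v) (setⁱ σ v 0 0) τ → Inv′ j τ →
           evalᵇ (lit 1 +ᵉ ivar v ≤ᵉ e) τ ≡ true →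
           j < N × Triple (c ⨟ v := lit 1 +ᵉ ivar v) τ (suc B) (Inv′ (suc j))
    next {j} {τ} fr (inv , vj , j≤N) b =
        j<N , weaken (ℕ.≤-reflexive (ℕ.+-comm B 1)) (step fr′ vj j<N inv ▹ λ {τ′} fr″ q →
          int-last {S = Inv′ (suc j)} (q , trans (cong-app (update-here (I τ′) v _) 0)
                                             (cong suc (trans (int₀ fr″ v w) vj)) , j<N)) (λ _ r → r)
      where
      fr′ : Frame (c ⨟ v := lit 1 +ᵉ ivar v) σ τ
      fr′ = frame-trans frame₀ fr

      j<N : j < N
      j<N = subst₂ (λ x y → suc x ≤ y) vj (len fr′ vj j≤N inv) (does-true (suc (I τ v 0) ℕ.≤? evalⁱ e τ) b)

    finish : ∀ {τ} → Frame (whileᵉ (lit 1 +ᵉ ivar v ≤ᵉ e) (c ⨟ v := lit 1 +ᵉ ivar v)) (setⁱ σ v 0 0) τ →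
             (∃[ j ] Inv′ j τ × j ≤ N × evalᵇ (lit 1 +ᵉ ivar v ≤ᵉ e) τ ≡ false) → Inv N τ
    finish {τ} fr (j , (inv , vj , j≤N) , _ , b) = subst (λ i → Inv i τ) (ℕ.≤-antisym j≤N N≤j) inv
      where
      N≤j : N ≤ j
      N≤j = ℕ.≮⇒≥ λ j<N → does-false (suc (I τ v 0) ℕ.≤? evalⁱ e τ) b
        (subst₂ (λ x y → suc x ≤ y) (sym vj)
          (sym (len (frame-trans frame₀ (record { intᶠ = intᶠ fr ; realᶠ = realᶠ fr })) vj j≤N inv)) j<N)

-- Linear-time selection: the program

#base #size #rank #sizes #ranks #off #len #target #i #j #lt #le #groups #half #out : ℕ
-- The prefix # marks integer arrays and % real ones. A subproblem is the segment of `%values` of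
-- length `#size` starting at `#base`.
#base = 0
#size = 1
#rank = 2
#sizes = 3
#ranks = 4
#off = 5
#len = 6
#target = 7
#i = 8
#j = 9
#lt = 10
#le = 11
#groups = 12
#half = 13
#out = 14

%values %result %item %pivot : ℕ
%values = 0
%result = 1
%item = 2
%pivot = 3

forᵉ : ℕ → IE → Com → Com
forᵉ v e c = v := lit 0 ⨟ whileᵉ (lit 1 +ᵉ ivar v ≤ᵉ e) (c ⨟ v := lit 1 +ᵉ ivar v)

-- A self-assignment stands in for the empty command.
keepⁱ keepʳ : ℕ → Com
keepⁱ a = a := ivar a
keepʳ a = a :=ʳ rvar a

tallyStep tally : Com
tallyStep =
  ifᵉ (%values ‼ʳ (ivar #off +ᵉ ivar #j) ≤ʳᵉ rvar %pivot)
    (#le := lit 1 +ᵉ ivar #le ⨟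
     ifᵉ (rvar %pivot ≤ʳᵉ %values ‼ʳ (ivar #off +ᵉ ivar #j)) (keepⁱ #lt) (#lt := lit 1 +ᵉ ivar #lt))
    (keepⁱ #lt)
tally = #lt := lit 0 ⨟ #le := lit 0 ⨟ forᵉ #j (ivar #len) tallyStep

bruteStep brute : Com
bruteStep =
  %pivot :=ʳ %values ‼ʳ (ivar #off +ᵉ ivar #i) ⨟
  tally ⨟
  ifᵉ (ivar #lt ≤ᵉ ivar #target andᵉ lit 1 +ᵉ ivar #target ≤ᵉ ivar #le) (%result :=ʳ rvar %pivot) (keepʳ %result)
brute = forᵉ #i (ivar #len) bruteStep

compressStep compress : BE → Com
compressStep t =
  %item :=ʳ %values ‼ʳ (ivar #base +ᵉ ivar #i) ⨟
  ifᵉ t (%values [ ivar #base +ᵉ ivar #out ]≔ʳ rvar %item ⨟ #out := lit 1 +ᵉ ivar #out) (keepⁱ #out)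
compress t = #out := lit 0 ⨟ forᵉ #i (ivar #size) (compressStep t)

groupStep medians descend narrow select : Com
groupStep =
  #off := ivar #base +ᵉ lit 5 *ᵉ ivar #groups ⨟
  #len := lit 5 ⨟
  #target := lit 2 ⨟
  brute ⨟
  %values [ ivar #base +ᵉ ivar #size +ᵉ ivar #groups ]≔ʳ rvar %result ⨟
  -- The recurrence r(h + 1) = h - r(h) with r(0) = 0 computes ⌊h / 2⌋ without a division.
  #half := ivar #groups -ᵉ ivar #half ⨟
  #groups := lit 1 +ᵉ ivar #groups
medians =
  #groups := lit 0 ⨟ #half := lit 0 ⨟
  whileᵉ (lit 5 *ᵉ (lit 1 +ᵉ ivar #groups) ≤ᵉ ivar #size) groupStep
descend =
  -- The medians were written directly behind the segment and become the segment of the recursive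
  -- call. Its start also serves as the stack index for the caller's size and rank; the saved size
  -- suffices to restore the start.
  #base := ivar #base +ᵉ ivar #size ⨟
  #sizes [ ivar #base ]≔ ivar #size ⨟
  #ranks [ ivar #base ]≔ ivar #rank ⨟
  #size := ivar #groups ⨟
  #rank := ivar #half ⨟
  recurse ⨟
  #size := #sizes ‼ ivar #base ⨟
  #rank := #ranks ‼ ivar #base ⨟
  #base := ivar #base -ᵉ ivar #size
narrow =
  -- The recursive calls below are tail calls, so nothing is saved and the segment may be compressed
  -- in place.
  %pivot :=ʳ rvar %result ⨟
  #off := ivar #base ⨟
  #len := ivar #size ⨟
  tally ⨟
  ifᵉ (ivar #lt ≤ᵉ ivar #rank)
    (ifᵉ (lit 1 +ᵉ ivar #rank ≤ᵉ ivar #le)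
      (%result :=ʳ rvar %pivot)
      (compress (notᵉ (rvar %item ≤ʳᵉ rvar %pivot)) ⨟
       #rank := ivar #rank -ᵉ ivar #le ⨟
       #size := ivar #out ⨟
       recurse))
    (compress (notᵉ (rvar %pivot ≤ʳᵉ rvar %item)) ⨟
     #size := ivar #out ⨟
     recurse)
select =
  ifᵉ (ivar #size ≤ᵉ lit 4)
    (#off := ivar #base ⨟ #len := ivar #size ⨟ #target := ivar #rank ⨟ brute)
    (medians ⨟ descend ⨟ narrow)

seg : ∀ {A : Set} → (ℕ → A) → ℕ → ℕ → A
seg f o j = f (o ℕ.+ j)

count-hit : ∀ P {n x} → P n ≡ true → x ≡ count P n → suc x ≡ count P (suc n)
count-hit P p refl rewrite p = refl

count-miss : ∀ P {n x} → P n ≡ false → x ≡ count P n → x ≡ count P (suc n)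
count-miss P p refl rewrite p = refl

-- Linear-time selection: correctness and running time

module Selection (ℝ : CompleteOrderedField) (E : Env (CompleteOrderedField.Carrier ℝ)) where
  open CompleteOrderedField ℝ using (Carrier)
  open import Data.Nat.Base using (_+_; _∸_; _*_; _≤_; _<_)
  open Ranks ℝ
  open Arrays ℝ E select

  tally-spec : ∀ {σ L} → I σ #len 0 ≡ L → Triple tally σ (4 + L * 6) (λ τ →
                 I τ #lt 0 ≡ countLt (seg (R σ %values) (I σ #off 0)) (R σ %pivot 0) L ×
                 I τ #le 0 ≡ countLe (seg (R σ %values) (I σ #off 0)) (R σ %pivot 0) L)
  tally-spec {σ} {L} len = intₜ intₜ for L 4 Inv refl (refl , refl) (λ fr _ _ _ → trans (int₀ fr #len refl) len) step
    where
    f : ℕ → Carrier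
    f = seg (R σ %values) (I σ #off 0)
    v : Carrier
    v = R σ %pivot 0
    Inv : ℕ → Store → Set
    Inv j τ = I τ #lt 0 ≡ countLt f v j × I τ #le 0 ≡ countLe f v j
    step : ∀ {j τ} → Frame (tallyStep ⨟ #j := lit 1 +ᵉ ivar #j) (setⁱ (setⁱ σ #lt 0 0) #le 0 0) τ → I τ #j 0 ≡ j → j < L → Inv j τ →
           Triple tallyStep τ 4 (Next #j Inv j)
    step {j} {τ} fr vj _ (lt≡ , le≡) = branch
        (λ h → intₜ branch
          (λ h′ → int-last (count-miss (λ i → lt (f i) v) (cong ¬ᵇ_ (trans (sym eq₂) h′)) lt≡ , count-hit (λ i → le (f i) v) (trans (sym eq₁) h) le≡))
          (λ h′ → int-last (count-hit (λ i → lt (f i) v) (cong ¬ᵇ_ (trans (sym eq₂) h′)) lt≡ , count-hit (λ i → le (f i) v) (trans (sym eq₁) h) le≡)))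
        (λ h → weaken (s≤s z≤n) (int-last {S = Next #j Inv j}
          ( count-miss (λ i → lt (f i) v) (cong ¬ᵇ_ (le-intro (≰⇒≥ (le-false (trans (sym eq₁) h))))) lt≡
          , count-miss (λ i → le (f i) v) (trans (sym eq₁) h) le≡)) (λ _ q → q))
      where
      item : R τ %values (I τ #off 0 + I τ #j 0) ≡ f j
      item = cong₂ (λ g i → g i) (realᶠ fr %values refl) (cong₂ _+_ (int₀ fr #off refl) vj)
      eq₁ : le (R τ %values (I τ #off 0 + I τ #j 0)) (R τ %pivot 0) ≡ le (f j) v
      eq₁ = cong₂ le item (real₀ fr %pivot refl)
      eq₂ : le (R τ %pivot 0) (R τ %values (I τ #off 0 + I τ #j 0)) ≡ le v (f j)
      eq₂ = cong₂ le (real₀ fr %pivot refl) item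

  seg-subst : ∀ (P : (ℕ → Carrier) → Carrier → Set) {g g′ o o′ i i′} → g ≡ g′ → o ≡ o′ → i ≡ i′ →
              P (seg g o) (g (o + i)) → P (seg g′ o′) (seg g′ o′ i′)
  seg-subst P refl refl refl p = p

  -- The invariant is conditional, because `%result` is meaningful only after a candidate of the
  -- right rank has been met. At the end `rank-exists` supplies such a candidate.
  brute-spec : ∀ {σ L r} → I σ #len 0 ≡ L → I σ #target 0 ≡ r → r < L →
               Triple brute σ (2 + L * (3 + (4 + L * 6 + 2)))
                 (λ τ → HasRank (seg (R σ %values) (I σ #off 0)) L r (R τ %result 0))
  brute-spec {σ} {L} {r} len target r<L = weaken ℕ.≤-refl
      (for L (1 + (4 + L * 6 + 2)) Inv refl (λ ()) (λ fr _ _ _ → trans (int₀ fr #len refl) len) step)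
      (λ _ inv → let (i , i< , rk) = rank-exists f L r r<L in inv i< rk)
    where
    f : ℕ → Carrier
    f = seg (R σ %values) (I σ #off 0)
    Inv : ℕ → Store → Set
    Inv i τ = ∀ {i′} → i′ < i → HasRank f L r (f i′) → HasRank f L r (R τ %result 0)
    step : ∀ {i τ} → Frame (bruteStep ⨟ #i := lit 1 +ᵉ ivar #i) σ τ → I τ #i 0 ≡ i → i < L → Inv i τ →
           Triple bruteStep τ (1 + (4 + L * 6 + 2)) (Next #i Inv i)
    step {i} {τ} fr vi _ inv = realₜ tally-spec (trans (int₀ fr #len refl) len) ▹ λ {τ′} fr′ (lt≡ , le≡) →
        let target′ = trans (int₀ fr′ #target refl) (trans (int₀ fr #target refl) target)
            item = seg-subst (λ g v → v ≡ f i) (sym (realᶠ fr %values refl)) (sym (int₀ fr #off refl)) (sym vi) refl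
            pivot = trans (real₀ fr′ %pivot refl) item
            lt′ = seg-subst (λ g v → I τ′ #lt 0 ≡ countLt g v L) (realᶠ fr %values refl) (int₀ fr #off refl) vi lt≡
            le′ = seg-subst (λ g v → I τ′ #le 0 ≡ countLe g v L) (realᶠ fr %values refl) (int₀ fr #off refl) vi le≡
        in branch
          (λ h → real-last λ _ _ → let (h₁ , h₂) = ∧-elim {does (I τ′ #lt 0 ℕ.≤? I τ′ #target 0)} h in
             subst (HasRank f L r) (sym pivot)
               (hasRank (subst₂ _≤_ lt′ target′ (does-true (I τ′ #lt 0 ℕ.≤? I τ′ #target 0) h₁))
                        (subst₂ (λ a b → suc a ≤ b) target′ le′ (does-true (suc (I τ′ #target 0) ℕ.≤? I τ′ #le 0) h₂))))
          (λ h → real-last λ { {i′} (s≤s i′≤i) rk → subst (HasRank f L r) (sym (real₀ fr′ %result refl))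
             (go h target′ lt′ le′ i′≤i rk) })
      where
      go : ∀ {a b c i′} → does (a ℕ.≤? b) ∧ does (suc b ℕ.≤? c) ≡ false → b ≡ r → a ≡ countLt f (f i) L → c ≡ countLe f (f i) L →
           i′ ≤ i → HasRank f L r (f i′) → HasRank f L r (R τ %result 0)
      go h refl refl refl i′≤i rk with ≤-split i′≤i
      ... | inj₁ i′<i = inv i′<i rk
      ... | inj₂ refl = ⊥-elim (true≢false (∧-intro (dec-true (_ ℕ.≤? _) (below rk)) (dec-true (_ ℕ.≤? _) (upto rk))) h)

  -- The write position never overtakes the read position, so the unread entries stay intact; the
  -- invariant records this beside the cells below the segment. The test is abstracted to `T` so
  -- that both sides of the partition share the proof.
  compress-spec : ∀ {σ m} (t : BE) (T : Carrier → Carrier → Bool) → (∀ τ → evalᵇ t τ ≡ T (R τ %item 0) (R τ %pivot 0)) →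
                  I σ #size 0 ≡ m → let f = seg (R σ %values) (I σ #base 0) ; keep = λ i → T (f i) (R σ %pivot 0) in
                  Triple (compress t) σ (3 + m * 6) (λ τ →
                    I τ #out 0 ≡ count keep m ×
                    (∀ (Q : Carrier → Bool) → count (λ i → Q (seg (R τ %values) (I σ #base 0) i)) (I τ #out 0) ≡ count (λ i → keep i ∧ Q (f i)) m) ×
                    (∀ a → a < I σ #base 0 → R τ %values a ≡ R σ %values a))
  compress-spec {σ} {m} t T t≡T size = weaken ℕ.≤-refl
      (intₜ for m 4 Inv refl (refl , (λ _ → refl) , λ _ _ → refl) (λ fr _ _ _ → trans (int₀ fr #size refl) size) step)
      (λ _ (out , kept , same) → out , kept , λ a a<b → same a (inj₁ a<b))
    where
    o : ℕ
    o = I σ #base 0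
    f : ℕ → Carrier
    f = seg (R σ %values) o
    keep : ℕ → Bool
    keep i = T (f i) (R σ %pivot 0)
    Inv : ℕ → Store → Set
    Inv i τ = I τ #out 0 ≡ count keep i ×
              (∀ (Q : Carrier → Bool) → count (λ i → Q (seg (R τ %values) o i)) (I τ #out 0) ≡ count (λ i → keep i ∧ Q (f i)) i) ×
              (∀ a → a < o ⊎ o + i ≤ a → R τ %values a ≡ R σ %values a)
    step : ∀ {i τ} → Frame (compressStep t ⨟ #i := lit 1 +ᵉ ivar #i) (setⁱ σ #out 0 0) τ → I τ #i 0 ≡ i → i < m → Inv i τ →
           Triple (compressStep t) τ 4 (Next #i Inv i)
    step {i} {τ} fr vi _ (out , kept , same) = realₜ branch
        (λ h → realₜ int-last
          ( count-hit keep (trans (sym test) h) out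
          , (λ Q → trans (cong₂ (λ b c → bit b + c)
                     (cong Q (trans (cong (λ x → update (R τ %values) x item (o + c)) at) (trans (update-here (R τ %values) _ item) item≡)))
                     (trans (count-cong c (λ {j} j<c → cong Q (trans (cong (λ x → update (R τ %values) x item (o + j)) at)
                              (update-there (R τ %values) _ item (λ e → ℕ.<⇒≢ j<c (sym (ℕ.+-cancelˡ-≡ o _ _ e)))))))
                            (kept Q)))
                   (cong (λ b → bit (b ∧ Q (f i)) + count (λ i → keep i ∧ Q (f i)) i) (sym (trans (sym test) h))))
          , λ a a∉ → trans (cong (λ x → update (R τ %values) x item a) at)
                     (trans (update-there (R τ %values) _ item (away a∉)) (same a (weaker a∉)))))
        (λ h → weaken (s≤s z≤n) (int-last {S = Next #i Inv i}
          ( count-miss keep (trans (sym test) h) out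
          , (λ Q → trans (kept Q) (cong (λ b → bit (b ∧ Q (f i)) + count (λ i → keep i ∧ Q (f i)) i) (sym (trans (sym test) h))))
          , λ a a∉ → same a (weaker a∉))) (λ _ q → q))
      where
      c : ℕ
      c = I τ #out 0
      c≤i : c ≤ i
      c≤i = subst (_≤ i) (sym out) (count-≤ keep i)
      base : I τ #base 0 ≡ o
      base = int₀ fr #base refl
      item : Carrier
      item = R τ %values (I τ #base 0 + I τ #i 0)
      item≡ : item ≡ f i
      item≡ = trans (cong (R τ %values) (cong₂ _+_ base vi)) (same (o + i) (inj₂ ℕ.≤-refl))
      at : I τ #base 0 + c ≡ o + c
      at = cong (_+ c) base
      test : evalᵇ t (setʳ τ %item 0 item) ≡ keep i
      test = trans (t≡T _) (cong₂ T item≡ (real₀ fr %pivot refl))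
      weaker : ∀ {a} → a < o ⊎ o + suc i ≤ a → a < o ⊎ o + i ≤ a
      weaker (inj₁ h) = inj₁ h
      weaker (inj₂ h) = inj₂ (ℕ.≤-trans (ℕ.+-monoʳ-≤ o (ℕ.n≤1+n i)) h)
      away : ∀ {a} → a < o ⊎ o + suc i ≤ a → ¬ (o + c ≡ a)
      away (inj₁ h) refl = ℕ.m+n≮m o c h
      away (inj₂ h) refl = ℕ.<⇒≱ (ℕ.+-monoʳ-< o (s≤s c≤i)) h

  -- Up to four entries at the end of the segment belong to no group. The segment stays `intact`
  -- because the pivot is still to be compared with its entries.
  record Medians (o M : ℕ) (V V′ : ℕ → Carrier) (h r : ℕ) : Set where
    constructor mkMedians
    field
      fits   : 5 * h ≤ M
      half≤  : 2 * r ≤ h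
      ≤half  : h ≤ 2 * r + 1
      groups : ∀ {g} → g < h → HasRank (λ j → seg V o (5 * g + j)) 5 2 (V′ (o + M + g))
      intact : ∀ {a} → a < o + M → V′ a ≡ V a

  -- The two inequalities characterise r = ⌊h / 2⌋. Passing from h to h + 1 and from r to h - r
  -- exchanges their roles.
  next-half≤ : ∀ {h r} → h ≤ 2 * r + 1 → 2 * (h ∸ r) ≤ suc h
  next-half≤ {h} {r} p with ℕ.≤-total r h
  ... | inj₂ h≤r = subst (λ x → 2 * x ≤ suc h) (sym (ℕ.m≤n⇒m∸n≡0 h≤r)) z≤n
  ... | inj₁ r≤h = go (h ∸ r) (ℕ.m∸n+n≡m r≤h) p
    where
    go : ∀ d {h} → d + r ≡ h → h ≤ 2 * r + 1 → 2 * d ≤ suc h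
    go d refl p = linear 0 p (solve (d ∷ r ∷ []))

  next-≤half : ∀ {h r} → 2 * r ≤ h → suc h ≤ 2 * (h ∸ r) + 1
  next-≤half {h} {r} p = go (h ∸ r) (ℕ.m∸n+n≡m (ℕ.≤-trans (ℕ.m≤n*m r 2) p)) p
    where
    go : ∀ d {h} → d + r ≡ h → 2 * r ≤ h → suc h ≤ 2 * d + 1
    go d refl p = linear 0 p (solve (d ∷ r ∷ []))

  medians-spec : ∀ {σ o M} → I σ #base 0 ≡ o → I σ #size 0 ≡ M →
                 Triple medians σ (3 + M * 204) (λ τ → M < 5 * suc (I τ #groups 0) ×
                   Medians o M (R σ %values) (R τ %values) (I τ #groups 0) (I τ #half 0))
  medians-spec {σ} {o} {M} base size = intₜ intₜ weaken ℕ.≤-refl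
      -- On five entries `brute` takes 197 steps, and there are six assignments. The number of
      -- groups is bounded crudely by M.
      (loop M 203 Inv (refl , mkMedians z≤n z≤n z≤n (λ ()) (λ _ → refl)) z≤n step)
      (λ {τ} fr (_ , (h≡ , med) , _ , stop) →
         ℕ.≰⇒> (λ h → does-false (5 * suc (I τ #groups 0) ℕ.≤? I τ #size 0) stop
                   (subst (5 * suc (I τ #groups 0) ≤_) (sym (trans (int₀ fr #size refl) size)) h)) ,
         subst (λ h → Medians o M (R σ %values) (R τ %values) h (I τ #half 0)) (sym h≡) med)
    where
    V : ℕ → Carrier
    V = R σ %values
    σ₀ : Store
    σ₀ = setⁱ (setⁱ σ #groups 0 0) #half 0 0
    Inv : ℕ → Store → Set
    Inv h τ = I τ #groups 0 ≡ h × Medians o M V (R τ %values) h (I τ #half 0)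
    more : ∀ {x y h} → x ≡ h → y ≡ M → does (5 * suc x ℕ.≤? y) ≡ true → 5 * suc h ≤ M
    more refl refl = does-true (_ ℕ.≤? _)
    step : ∀ {h τ} → Frame groupStep σ₀ τ → Inv h τ → evalᵇ (lit 5 *ᵉ (lit 1 +ᵉ ivar #groups) ≤ᵉ ivar #size) τ ≡ true →
           h < M × Triple groupStep τ 203 (Inv (suc h))
    step {h} {τ} fr (refl , mkMedians fits lo hi groups intact) go-on =
        ℕ.≤-trans (ℕ.m≤n*m (suc h) 5) fits′ ,
        (intₜ intₜ intₜ brute-spec refl refl (s≤s (s≤s (s≤s z≤n))) ▹ λ {τ′} fr′ rk →
          let V≡ = realᶠ fr′ %values refl
              h≡ = int₀ fr′ #groups refl
              r≡ = int₀ fr′ #half refl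
              at = cong₂ _+_ (cong₂ _+_ (trans (int₀ fr′ #base refl) base′) (trans (int₀ fr′ #size refl) size′)) h≡
          in realₜ intₜ int-last (cong suc h≡ ,
               finish h≡ r≡ at V≡ (HasRank-cong (λ j< → origin j<) rk)))
      where
      base′ : I τ #base 0 ≡ o
      base′ = trans (int₀ fr #base refl) base
      size′ : I τ #size 0 ≡ M
      size′ = trans (int₀ fr #size refl) size
      fits′ : 5 * suc h ≤ M
      fits′ = more refl size′ go-on
      origin : ∀ {j} → j < 5 → R τ %values (I τ #base 0 + 5 * h + j) ≡ V (o + (5 * h + j))
      origin {j} j<5 = trans (cong (R τ %values) (trans (cong (λ x → x + 5 * h + j) base′) (ℕ.+-assoc o _ j)))
        (intact (ℕ.+-monoʳ-< o (ℕ.<-≤-trans (ℕ.+-monoʳ-< (5 * h) j<5) (subst (_≤ M) (trans (ℕ.*-suc 5 h) (ℕ.+-comm 5 _)) fits′))))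
      finish : ∀ {x y a V′ v} → x ≡ h → y ≡ I τ #half 0 → a ≡ o + M + h → V′ ≡ R τ %values →
               HasRank (λ j → seg V o (5 * h + j)) 5 2 v → Medians o M V (update V′ a v) (suc h) (x ∸ y)
      finish {v = v} refl refl refl refl rk = mkMedians fits′ (next-half≤ {h} {I τ #half 0} hi) (next-≤half {h} {I τ #half 0} lo) groups′
          (λ a< → trans (update-there (R τ %values) _ v (λ e → ℕ.<⇒≢ (ℕ.<-≤-trans a< (ℕ.m≤m+n _ h)) (sym e))) (intact a<))
        where
        groups′ : ∀ {g} → g < suc h → HasRank (λ j → seg V o (5 * g + j)) 5 2 (update (R τ %values) (o + M + h) v (o + M + g))
        groups′ {g} (s≤s g≤h) with ≤-split g≤h
        ... | inj₁ g<h = subst (HasRank _ 5 2) (sym (update-there (R τ %values) _ v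
                           (λ e → ℕ.<⇒≢ g<h (sym (ℕ.+-cancelˡ-≡ (o + M) _ _ e))))) (groups g<h)
        ... | inj₂ refl = subst (HasRank _ 5 2) (sym (update-here (R τ %values) _ v)) rk

  -- The stack is preserved up to and including the own base, since that entry holds what the caller
  -- saved. Values are preserved only strictly below, since the segment itself may be compressed.
  -- Size and rank need not be restored.
  record Selected (σ τ : Store) : Set where
    field
      result : HasRank (seg (R σ %values) (I σ #base 0)) (I σ #size 0) (I σ #rank 0) (R τ %result 0)
      base=  : I τ #base 0 ≡ I σ #base 0
      values= : ∀ {a} → a < I σ #base 0 → R τ %values a ≡ R σ %values a
      sizes= : ∀ {a} → a ≤ I σ #base 0 → I τ #sizes a ≡ I σ #sizes a
      ranks= : ∀ {a} → a ≤ I σ #base 0 → I τ #ranks a ≡ I σ #ranks a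

  open Selected

  -- 5400 m solves T(m) = T(h) + T(m - 3 h / 2) + 300 m, where m ≤ 9 h.
  select-time : ℕ → ℕ
  select-time m = 5400 * m

  Selects : ℕ → Set
  Selects m = ∀ {σ} → I σ #size 0 ≡ m → I σ #rank 0 < m → Triple recurse σ (select-time m) (Selected σ)

  record Descended (σ τ : Store) : Set where
    field
      base=   : I τ #base 0 ≡ I σ #base 0
      size=   : I τ #size 0 ≡ I σ #size 0
      rank=   : I τ #rank 0 ≡ I σ #rank 0
      pivot   : HasRank (seg (R σ %values) (I σ #base 0 + I σ #size 0)) (I σ #groups 0) (I σ #half 0) (R τ %result 0)
      values= : ∀ {a} → a < I σ #base 0 + I σ #size 0 → R τ %values a ≡ R σ %values a
      sizes=  : ∀ {a} → a ≤ I σ #base 0 → I τ #sizes a ≡ I σ #sizes a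
      ranks=  : ∀ {a} → a ≤ I σ #base 0 → I τ #ranks a ≡ I σ #ranks a

  descend-spec : ∀ {σ} → Selects (I σ #groups 0) → I σ #half 0 < I σ #groups 0 → 1 ≤ I σ #size 0 →
                 Triple descend σ (8 + select-time (I σ #groups 0)) (Descended σ)
  descend-spec {σ} selects half< 1≤size = weaken
      (ℕ.≤-reflexive (cong (5 +_) (ℕ.+-comm (select-time (I σ #groups 0)) 3)))
      (intₜ intₜ intₜ intₜ intₜ selects refl half< ▹ λ {τ} _ sel →
        let o = I σ #base 0 ; M = I σ #size 0
            b≡ = base= sel
            size′ = trans (cong (I τ #sizes) b≡) (trans (sizes= sel ℕ.≤-refl) (update-here (I σ #sizes) (o + M) M))
            rank′ = trans (cong (I τ #ranks) b≡) (trans (ranks= sel ℕ.≤-refl) (update-here (I σ #ranks) (o + M) (I σ #rank 0)))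
            -- The segment is nonempty, so the new stack index lies above all entries that have to
            -- survive.
            fresh : ∀ {a} → a ≤ o → ¬ (o + M ≡ a)
            fresh a≤o e = ℕ.<⇒≢ (ℕ.≤-trans (s≤s a≤o) (subst (_≤ o + M) (ℕ.+-comm o 1) (ℕ.+-monoʳ-≤ o 1≤size))) (sym e)
        in intₜ intₜ int-last (record
          { base= = trans (cong₂ _∸_ b≡ size′) (ℕ.m+n∸n≡m o M)
          ; size= = size′
          ; rank= = rank′
          ; pivot = result sel
          ; values= = values= sel
          ; sizes= = λ {a} a≤o → trans (sizes= sel (ℕ.≤-trans a≤o (ℕ.m≤m+n o M))) (update-there (I σ #sizes) _ M (fresh a≤o))
          ; ranks= = λ {a} a≤o → trans (ranks= sel (ℕ.≤-trans a≤o (ℕ.m≤m+n o M))) (update-there (I σ #ranks) _ (I σ #rank 0) (fresh a≤o))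
          }))
      (λ _ q → q)

  shrink : ∀ a b {M} h → a + b ≡ M → 3 * h ≤ 2 * b → 2 * a + 3 * h ≤ 2 * M
  shrink a b h refl p = ℕ.≤-trans (ℕ.+-monoʳ-≤ (2 * a) p) (ℕ.≤-reflexive (sym (ℕ.*-distribˡ-+ 2 a b)))

  -- Either recursive call discards all entries on one side of the pivot, including those equal to
  -- it, which are at least 3 h / 2. W is a common time bound for both calls.
  narrow-spec : ∀ {σ} M h W → I σ #size 0 ≡ M →
                let f = seg (R σ %values) (I σ #base 0) ; π = R σ %result 0 in
                I σ #rank 0 < M →
                3 * h ≤ 2 * countLe f π M → 3 * h ≤ 2 * count (λ i → le π (f i)) M →
                (∀ {m} → 2 * m + 3 * h ≤ 2 * M → Selects m × select-time m ≤ W) →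
                Triple narrow σ (14 + M * 12 + W) (Selected σ)
  narrow-spec {σ} M h W size r<M above below IH = weaken (total M W)
      (realₜ intₜ intₜ tally-spec size ▹ λ {τ} fr (lt≡ , le≡) → branch
        (λ not-less → branch
          (λ found → weaken (s≤s z≤n) (real-last {S = Selected σ} (equal fr lt≡ le≡ not-less found)) (λ _ q → q))
          (λ not-equal → greater fr lt≡ le≡ not-less not-equal))
        (λ is-less → weaken (ℕ.m≤n⇒m≤1+n (ℕ.+-monoʳ-≤ (3 + M * 6) (ℕ.n≤1+n (1 + W)))) (less fr lt≡ le≡ is-less) (λ _ q → q)))
      (λ _ q → q)
    where
    f : ℕ → Carrier
    f = seg (R σ %values) (I σ #base 0)
    π : Carrier
    π = R σ %result 0
    total : ∀ M W → 3 + (4 + M * 6 + suc (suc (3 + M * 6 + (2 + W)))) ≤ 14 + M * 12 + W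
    total M W = ℕ.≤-reflexive (solve (M ∷ W ∷ []))
    o : ℕ
    o = I σ #base 0
    tallied : Store
    tallied = setⁱ (setⁱ (setʳ σ %pivot 0 π) #off 0 o) #len 0 (I σ #size 0)

    equal : ∀ {τ} → Frame tally tallied τ → I τ #lt 0 ≡ countLt f π M → I τ #le 0 ≡ countLe f π M →
            does (I τ #lt 0 ℕ.≤? I τ #rank 0) ≡ true → does (suc (I τ #rank 0) ℕ.≤? I τ #le 0) ≡ true →
            Selected σ (setʳ τ %result 0 (R τ %pivot 0))
    equal {τ} fr lt≡ le≡ h h′ = record
      { result = subst₂ (λ m v → HasRank f m (I σ #rank 0) v) (sym size) (sym (real₀ fr %pivot refl))
          (hasRank (subst₂ _≤_ lt≡ rank≡ (does-true (_ ℕ.≤? _) h)) (subst₂ (λ a b → suc a ≤ b) rank≡ le≡ (does-true (_ ℕ.≤? _) h′)))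
      ; base= = int₀ fr #base refl
      ; values= = λ {a} _ → cong-app (realᶠ fr %values refl) a
      ; sizes= = λ {a} _ → cong-app (intᶠ fr #sizes refl) a
      ; ranks= = λ {a} _ → cong-app (intᶠ fr #ranks refl) a
      }
      where
      rank≡ : I τ #rank 0 ≡ I σ #rank 0
      rank≡ = int₀ fr #rank refl

    lift : ∀ {υ υ′} → I υ #base 0 ≡ o → (∀ {a} → a < o → R υ %values a ≡ R σ %values a) →
           I υ #sizes ≡ I σ #sizes → I υ #ranks ≡ I σ #ranks →
           (HasRank (seg (R υ %values) o) (I υ #size 0) (I υ #rank 0) (R υ′ %result 0) → HasRank f M (I σ #rank 0) (R υ′ %result 0)) →
           Selected υ υ′ → Selected σ υ′
    lift {υ} {υ′} b≡ v≡ s≡ r≡ rk sel = record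
      { result = subst (λ m → HasRank f m (I σ #rank 0) (R υ′ %result 0)) (sym size)
          (rk (subst (λ b → HasRank (seg (R υ %values) b) (I υ #size 0) (I υ #rank 0) (R υ′ %result 0)) b≡ (result sel)))
      ; base= = trans (base= sel) b≡
      ; values= = λ a< → trans (values= sel (subst (_ <_) (sym b≡) a<)) (v≡ a<)
      ; sizes= = λ {a} a≤ → trans (sizes= sel (subst (a ≤_) (sym b≡) a≤)) (cong-app s≡ a)
      ; ranks= = λ {a} a≤ → trans (ranks= sel (subst (a ≤_) (sym b≡) a≤)) (cong-app r≡ a)
      }

    module _ {τ} (fr : Frame tally tallied τ) (lt≡ : I τ #lt 0 ≡ countLt f π M) (le≡ : I τ #le 0 ≡ countLe f π M) where
      base≡ : I τ #base 0 ≡ o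
      base≡ = int₀ fr #base refl
      rank≡ : I τ #rank 0 ≡ I σ #rank 0
      rank≡ = int₀ fr #rank refl

      compressed : ∀ (t : BE) (T : Carrier → Carrier → Bool) → (∀ τ → evalᵇ t τ ≡ T (R τ %item 0) (R τ %pivot 0)) →
                   Triple (compress t) τ (3 + M * 6) (λ τ′ →
                    I τ′ #out 0 ≡ count (λ i → T (f i) π) M ×
                    (∀ (Q : Carrier → Bool) → count (λ i → Q (seg (R τ′ %values) o i)) (I τ′ #out 0) ≡ count (λ i → T (f i) π ∧ Q (f i)) M) ×
                    (∀ {a} → a < o → R τ′ %values a ≡ R σ %values a))
      compressed t T t≡T = weaken ℕ.≤-refl (compress-spec t T t≡T (trans (int₀ fr #size refl) size))
        λ {τ′} _ → adapt τ′ base≡ (realᶠ fr %values refl) (real₀ fr %pivot refl)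
        where
        adapt : ∀ τ′ {o′ V p} → o′ ≡ o → V ≡ R σ %values → p ≡ π → let f′ = seg V o′ in
                I τ′ #out 0 ≡ count (λ i → T (f′ i) p) M ×
                (∀ (Q : Carrier → Bool) → count (λ i → Q (seg (R τ′ %values) o′ i)) (I τ′ #out 0) ≡ count (λ i → T (f′ i) p ∧ Q (f′ i)) M) ×
                (∀ a → a < o′ → R τ′ %values a ≡ V a) →
                I τ′ #out 0 ≡ count (λ i → T (f i) π) M ×
                (∀ (Q : Carrier → Bool) → count (λ i → Q (seg (R τ′ %values) o i)) (I τ′ #out 0) ≡ count (λ i → T (f i) π ∧ Q (f i)) M) ×
                (∀ {a} → a < o → R τ′ %values a ≡ R σ %values a)
        adapt τ′ refl refl refl (p , q , r) = p , q , λ {a} → r a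

      less : does (I τ #lt 0 ℕ.≤? I τ #rank 0) ≡ false →
             Triple (compress (notᵉ (rvar %pivot ≤ʳᵉ rvar %item)) ⨟ #size := ivar #out ⨟ recurse) τ (3 + M * 6 + (1 + W)) (Selected σ)
      less is-less = compressed _ lt (λ _ → refl) ▹ λ {τ′} fr′ (out , kept , same) →
        let rank′ = trans (int₀ fr′ #rank refl) rank≡
            r<out : I τ′ #rank 0 < I τ′ #out 0
            r<out = subst₂ _<_ (trans rank≡ (sym rank′)) (trans lt≡ (sym out)) (ℕ.≰⇒> (does-false (_ ℕ.≤? _) is-less))
            (selects , cost) = IH {I τ′ #out 0} (shrink (I τ′ #out 0) (count (λ i → le π (f i)) M) h (trans (cong (_+ count (λ i → le π (f i)) M) out)
              (trans (ℕ.+-comm (countLt f π M) _) (countLt+ f π M))) below)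
        in intₜ weaken cost (selects refl r<out) λ _ → lift (trans (int₀ fr′ #base refl) base≡) same
             (trans (intᶠ fr′ #sizes refl) (intᶠ fr #sizes refl)) (trans (intᶠ fr′ #ranks refl) (intᶠ fr #ranks refl))
             (λ rk → subst (λ r → HasRank f M r _) rank′ (rank-less out kept r<out rk))

      greater : does (I τ #lt 0 ℕ.≤? I τ #rank 0) ≡ true → does (suc (I τ #rank 0) ℕ.≤? I τ #le 0) ≡ false →
                Triple (compress (notᵉ (rvar %item ≤ʳᵉ rvar %pivot)) ⨟ #rank := ivar #rank -ᵉ ivar #le ⨟ #size := ivar #out ⨟ recurse) τ
                       (3 + M * 6 + (2 + W)) (Selected σ)
      greater not-less not-equal = compressed _ (λ x p → lt p x) (λ _ → refl) ▹ λ {τ′} fr′ (out , kept , same) →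
        let rank′ = trans (int₀ fr′ #rank refl) rank≡
            le′ = trans (int₀ fr′ #le refl) le≡
            e≤r : countLe f π M ≤ I σ #rank 0
            e≤r = subst₂ _≤_ le≡ rank≡ (ℕ.≮⇒≥ (does-false (_ ℕ.≤? _) not-equal))
            sum = trans (ℕ.+-comm (I τ′ #out 0) _) (trans (cong (countLe f π M +_) out) (count-complement (λ i → le (f i) π) M))
            r<out : I τ′ #rank 0 ∸ I τ′ #le 0 < I τ′ #out 0
            r<out = subst₂ (λ r e → r ∸ e < I τ′ #out 0) (sym rank′) (sym le′)
              (ℕ.+-cancelʳ-< (countLe f π M) _ _ (subst₂ _<_ (sym (ℕ.m∸n+n≡m e≤r)) (sym sum) r<M))
            (selects , cost) = IH {I τ′ #out 0} (shrink (I τ′ #out 0) (countLe f π M) h sum above)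
        in intₜ intₜ weaken cost (selects refl r<out) λ _ → lift (trans (int₀ fr′ #base refl) base≡) same
             (trans (intᶠ fr′ #sizes refl) (intᶠ fr #sizes refl)) (trans (intᶠ fr′ #ranks refl) (intᶠ fr #ranks refl))
             (λ rk → rank-greater out kept e≤r (subst₂ (λ r e → HasRank _ _ (r ∸ e) _) rank′ le′ rk))

  -- The second recursive call costs 2700 D = 5400 (M - 3 h / 2), so the two calls together save
  -- 2700 h compared with 5400 M. Multiplying M ≤ 9 h by 300 converts this saving into 300 M, which
  -- pays for the linear work.
  select-total : ∀ M h D → 1 ≤ M → M ≤ 9 * h → 3 * h + D ≡ 2 * M →
                 2 + (3 + M * 204 + (8 + 5400 * h + (14 + M * 12 + 2700 * D))) ≤ 5400 * M
  select-total M h D 1≤M M≤9h eq = linear {L = 27 + (300 * M + 2700 * (3 * h + D))} {27 * M + (300 * (9 * h) + 2700 * (2 * M))} (57 * M)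
    (ℕ.≤-trans (ℕ.≤-reflexive (sym (ℕ.*-identityʳ 27))) (ℕ.*-monoʳ-≤ 27 1≤M) +≤
      (ℕ.*-monoʳ-≤ 300 M≤9h +≤ ℕ.≤-reflexive (cong (2700 *_) eq)))
    (identity M h D)
    where
    identity : ∀ M h D → 2 + (3 + M * 204 + (8 + 5400 * h + (14 + M * 12 + 2700 * D))) + (27 * M + (300 * (9 * h) + 2700 * (2 * M))) + 57 * M
               ≡ 5400 * M + (27 + (300 * M + 2700 * (3 * h + D)))
    identity M h D = solve (M ∷ h ∷ D ∷ [])

  brute-total : ∀ M → 1 ≤ M → M ≤ 4 → 5 + (2 + M * (3 + (4 + M * 6 + 2))) ≤ 5400 * M
  brute-total 1 _ _ = ℕ.≤ᵇ⇒≤ _ _ _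
  brute-total 2 _ _ = ℕ.≤ᵇ⇒≤ _ _ _
  brute-total 3 _ _ = ℕ.≤ᵇ⇒≤ _ _ _
  brute-total 4 _ _ = ℕ.≤ᵇ⇒≤ _ _ _
  brute-total (suc (suc (suc (suc (suc _))))) _ (s≤s (s≤s (s≤s (s≤s ()))))

  -- For h ≥ 1 the bound M ≤ 5 h + 4 gives M ≤ 9 h. The cutoff at four entries ensures that there is
  -- a group.
  groups-bounds : ∀ {M h r} → 5 ≤ M → M < 5 * suc h → 5 * h ≤ M → 2 * r ≤ h →
                  r < h × h < M × M ≤ 9 * h × 3 * h ≤ 2 * M × 1 ≤ h
  groups-bounds {h = zero} 5≤M M< _ _ = ⊥-elim (ℕ.<⇒≱ M< 5≤M)
  groups-bounds {M} {h@(suc h′)} {r} 5≤M M< fits lo =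
      ℕ.≮⇒≥ (λ { (s≤s h′<r) → ℕ.1+n≰n (ℕ.≤-trans (ℕ.m≤m+n (suc h) h′) (linear 0 (ℕ.*-monoʳ-≤ 2 h′<r +≤ lo) (id₀ h′ r))) }) ,
      ℕ.≤-trans (linear (3 + 4 * h′) (z≤n {0}) (id₁ h′)) fits ,
      linear (4 * h′) M< (id₂ M h′) ,
      linear (2 + 2 * h′ + M) fits (id₃ M h′) ,
      s≤s z≤n
    where
    id₀ : ∀ h′ r → suc (suc h′) + h′ + (2 * r + suc h′) + 0 ≡ suc h′ + (2 * suc h′ + 2 * r)
    id₀ h′ r = solve (h′ ∷ r ∷ [])
    id₁ : ∀ h′ → suc (suc h′) + 0 + (3 + 4 * h′) ≡ 5 * suc h′ + 0
    id₁ h′ = solve (h′ ∷ [])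
    id₂ : ∀ M h′ → M + 5 * suc (suc h′) + 4 * h′ ≡ 9 * suc h′ + suc M
    id₂ M h′ = solve (M ∷ h′ ∷ [])
    id₃ : ∀ M h′ → 3 * suc h′ + M + (2 + 2 * h′ + M) ≡ 2 * M + 5 * suc h′
    id₃ M h′ = solve (M ∷ h′ ∷ [])

  select-spec : ∀ m → Selects m
  select-spec = <-rec Selects step
    where
    step : ∀ M → (∀ {m} → m < M → Selects m) → Selects M
    step M IH {σ} size r<M = weaken (ℕ.≤-reflexive T≡) (callₜ (branch small big)) (λ _ q → q)
      where
      1≤M : 1 ≤ M
      1≤M = ℕ.≤-trans (s≤s z≤n) r<M
      -- What remains of the budget after the call, the test and `medians`; both branches are fitted
      -- to the same total.
      U : ℕ
      U = 5400 * M ∸ (5 + M * 204)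
      T≡ : 2 + (3 + M * 204 + U) ≡ 5400 * M
      T≡ = ℕ.m+[n∸m]≡n (enough M 1≤M)
        where
        enough : ∀ M → 1 ≤ M → 5 + M * 204 ≤ 5400 * M
        enough (suc M) _ = linear (5191 + 5196 * M) (z≤n {0}) (solve (M ∷ []))
      small : evalᵇ (ivar #size ≤ᵉ lit 4) σ ≡ true →
              Triple (#off := ivar #base ⨟ #len := ivar #size ⨟ #target := ivar #rank ⨟ brute) σ (3 + M * 204 + U) (Selected σ)
      small h = weaken (ℕ.+-cancelˡ-≤ 2 _ _ (ℕ.≤-trans
          (brute-total M 1≤M (subst (_≤ 4) size (does-true (I σ #size 0 ℕ.≤? 4) h))) (ℕ.≤-reflexive (sym T≡))))
        (intₜ intₜ intₜ weaken ℕ.≤-refl (brute-spec size refl r<M) λ {τ} fr rk → record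
          { result = subst (λ m → HasRank (seg (R σ %values) (I σ #base 0)) m (I σ #rank 0) (R τ %result 0)) (sym size) rk
          ; base= = int₀ fr #base refl
          ; values= = λ {a} _ → cong-app (realᶠ fr %values refl) a
          ; sizes= = λ {a} _ → cong-app (intᶠ fr #sizes refl) a
          ; ranks= = λ {a} _ → cong-app (intᶠ fr #ranks refl) a
          }) (λ _ q → q)
      big : evalᵇ (ivar #size ≤ᵉ lit 4) σ ≡ false → Triple (medians ⨟ descend ⨟ narrow) σ (3 + M * 204 + U) (Selected σ)
      big not-small = medians-spec refl size ▹ rest
        where
        o : ℕ
        o = I σ #base 0
        V : ℕ → Carrier
        V = R σ %values
        rest : ∀ {τ} → Frame medians σ τ → M < 5 * suc (I τ #groups 0) × Medians o M V (R τ %values) (I τ #groups 0) (I τ #half 0) →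
               Triple (descend ⨟ narrow) τ U (Selected σ)
        rest {τ} fr (M< , mkMedians fits lo hi groups intact) =
            let (r<h , h<M , M≤9h , 3h≤2M , 1≤h) = bounds in
            weaken (in-time M≤9h 3h≤2M)
              (descend-spec (IH h<M) r<h (subst (1 ≤_) (sym size₁) 1≤M) ▹ λ {υ} _ d → finish d 1≤h 3h≤2M)
              (λ _ q → q)
          where
          h r D W : ℕ
          h = I τ #groups 0
          r = I τ #half 0
          D = 2 * M ∸ 3 * h
          W = 2700 * D
          5≤M : 5 ≤ M
          5≤M = subst (5 ≤_) size (ℕ.≰⇒> (does-false (I σ #size 0 ℕ.≤? 4) not-small))
          bounds : r < h × h < M × M ≤ 9 * h × 3 * h ≤ 2 * M × 1 ≤ h
          bounds = groups-bounds 5≤M M< fits lo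
          base₁ : I τ #base 0 ≡ o
          base₁ = int₀ fr #base refl
          size₁ : I τ #size 0 ≡ M
          size₁ = trans (int₀ fr #size refl) size
          rank₁ : I τ #rank 0 ≡ I σ #rank 0
          rank₁ = int₀ fr #rank refl
          in-time : M ≤ 9 * h → 3 * h ≤ 2 * M → 8 + 5400 * h + (14 + M * 12 + W) ≤ U
          in-time M≤9h 3h≤2M = ℕ.≤-trans (ℕ.≤-reflexive (sym (ℕ.m+n∸m≡n (5 + M * 204) _)))
            (ℕ.∸-monoˡ-≤ (5 + M * 204) (select-total M h D 1≤M M≤9h (ℕ.m+[n∸m]≡n 3h≤2M)))
          finish : ∀ {υ} → Descended τ υ → 1 ≤ h → 3 * h ≤ 2 * M → Triple narrow υ (14 + M * 12 + W) (Selected σ)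
          finish {υ} d 1≤h 3h≤2M = weaken ℕ.≤-refl
              (narrow-spec M h W (trans d.size= size₁) (subst (_< M) (sym rank₂) r<M)
                (pivot-above f₂ μ M h r π fits groups₂ lo hi middle) (pivot-below f₂ μ M h r π fits groups₂ lo hi middle)
                λ {m} small-enough → IH (ℕ.*-cancelˡ-< 2 m M (ℕ.<-≤-trans (ℕ.m<m+n (2 * m) (ℕ.≤-trans 1≤h (ℕ.m≤n*m h 3))) small-enough)) ,
                  ℕ.≤-trans (ℕ.≤-reflexive (ℕ.*-assoc 2700 2 m)) (ℕ.*-monoʳ-≤ 2700
                    (ℕ.≤-trans (ℕ.≤-reflexive (sym (ℕ.m+n∸n≡m (2 * m) (3 * h)))) (ℕ.∸-monoˡ-≤ (3 * h) small-enough))))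
              λ {ω} _ sel → record
                { result = subst (λ m → HasRank (seg V o) m (I σ #rank 0) (R ω %result 0)) (sym size)
                    (HasRank-cong f₂≡ (subst₂ (λ m r → HasRank f₂ m r (R ω %result 0)) (trans d.size= size₁) rank₂ (result sel)))
                ; base= = trans (base= sel) base₂
                ; values= = λ a< → trans (values= sel (subst (_ <_) (sym base₂) a<))
                    (trans (d.values= (ℕ.<-≤-trans (subst (_ <_) (sym base₁) a<) (ℕ.m≤m+n _ _))) (intact (ℕ.<-≤-trans a< (ℕ.m≤m+n o M))))
                ; sizes= = λ {a} a≤ → trans (sizes= sel (subst (a ≤_) (sym base₂) a≤))
                    (trans (d.sizes= (subst (a ≤_) (sym base₁) a≤)) (cong-app (intᶠ fr #sizes refl) a))
                ; ranks= = λ {a} a≤ → trans (ranks= sel (subst (a ≤_) (sym base₂) a≤))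
                    (trans (d.ranks= (subst (a ≤_) (sym base₁) a≤)) (cong-app (intᶠ fr #ranks refl) a))
                }
            where
            module d = Descended d
            π : Carrier
            π = R υ %result 0
            f₂ μ : ℕ → Carrier
            f₂ = seg (R υ %values) (I υ #base 0)
            μ = seg (R τ %values) (o + M)
            base₂ : I υ #base 0 ≡ o
            base₂ = trans d.base= base₁
            rank₂ : I υ #rank 0 ≡ I σ #rank 0
            rank₂ = trans d.rank= rank₁
            f₂≡ : ∀ {i} → i < M → f₂ i ≡ seg V o i
            f₂≡ {i} i<M = trans (cong (λ b → R υ %values (b + i)) base₂)
              (trans (d.values= (subst₂ (λ b m → o + i < b + m) (sym base₁) (sym size₁) (ℕ.+-monoʳ-< o i<M)))
                     (intact (ℕ.+-monoʳ-< o i<M)))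
            middle : HasRank μ h r π
            middle = subst₂ (λ b m → HasRank (seg (R τ %values) (b + m)) h r π) base₁ size₁ d.pivot
            groups₂ : ∀ {g} → g < h → HasRank (λ j → f₂ (5 * g + j)) 5 2 (μ g)
            groups₂ {g} g<h = HasRank-cong (λ {j} j<5 → sym (f₂≡ (ℕ.<-≤-trans
              (subst (5 * g + j <_) (trans (ℕ.+-comm (5 * g) 5) (sym (ℕ.*-suc 5 g))) (ℕ.+-monoʳ-< (5 * g) j<5))
              (ℕ.≤-trans (ℕ.*-monoʳ-≤ 5 g<h) fits)))) (groups g<h)

-- Ordered-field arithmetic, floors and grid cells

module Field (ℝ : CompleteOrderedField) where
  open CompleteOrderedField ℝ renaming (floor to floorᴿ)
  open Ranks ℝ public using (≤-refl; ≤-trans; ≤-total; ≤-antisym; ≤-reflexive; ≰⇒≥)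
  open CommutativeRing commutativeRing public using (commutativeSemiring; +-cong; *-cong; +-congˡ; +-congʳ; *-congʳ; *-congˡ; +-comm; +-assoc;
    -‿inverseˡ; +-identityˡ; +-identityʳ; *-identityˡ; *-identityʳ; zeroˡ; zeroʳ; *-assoc; *-comm)
    renaming (refl to ≈-refl; sym to ≈-sym; trans to ≈-trans)
  open NaturalCoefficients commutativeSemiring public using (_:+_; _:*_; con) renaming (solve to solveʳ; _:=_ to _:≈_)
  private module R = CommutativeRing commutativeRing
  open RingProperties R.ring using (-‿distribˡ-*; -‿involutive)

  -- Positivity as a negation is exactly what a failed comparison with 0 in the program provides.
  Positive : Carrier → Set
  Positive x = ¬ (x ≤ 0#)

  ≤-resp : ∀ {x x′ y y′} → x ≈ x′ → y ≈ y′ → x ≤ y → x′ ≤ y′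
  ≤-resp p q h = ≤-trans (≤-reflexive (≈-sym p)) (≤-trans h (≤-reflexive q))

  +-mono : ∀ {x y u v} → x ≤ y → u ≤ v → x + u ≤ y + v
  +-mono {x} {y} {u} {v} p q = ≤-trans (+-monoˡ-≤ u p) (≤-resp (+-comm u y) (+-comm v y) (+-monoˡ-≤ y q))

  +-cancel : ∀ {x y} z → x + z ≤ y + z → x ≤ y
  +-cancel {x} {y} z h = ≤-resp (undo x) (undo y) (+-monoˡ-≤ (- z) h)
    where
    undo : ∀ u → u + z + - z ≈ u
    undo u = ≈-trans (+-assoc u z (- z)) (≈-trans (+-congˡ (R.-‿inverseʳ z)) (+-identityʳ u))

  linearʳ : ∀ {l r L R} → L ≤ R → l + R ≈ r + L → l ≤ r
  linearʳ {l} {r} {L} {R} h e = +-cancel R (≤-trans (≤-reflexive e) (+-mono (≤-refl {r}) h))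

  sub-add : ∀ x y → x - y + y ≈ x
  sub-add x y = ≈-trans (+-assoc x (- y) y) (≈-trans (+-congˡ (-‿inverseˡ y)) (+-identityʳ x))

  sub-≤ : ∀ {x y z} → x ≤ z + y → x - y ≤ z
  sub-≤ {x} {y} h = +-cancel y (≤-trans (≤-reflexive (sub-add x y)) h)

  sub-≤⁻ : ∀ {x y z} → x - y ≤ z → x ≤ z + y
  sub-≤⁻ {x} {y} h = ≤-trans (≤-reflexive (≈-sym (sub-add x y))) (+-monoˡ-≤ y h)

  ≤-sub : ∀ {x y z} → z + y ≤ x → z ≤ x - y
  ≤-sub {x} {y} h = +-cancel y (≤-trans h (≤-reflexive (≈-sym (sub-add x y))))

  ≤-sub⁻ : ∀ {x y z} → z ≤ x - y → z + y ≤ x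
  ≤-sub⁻ {x} {y} h = ≤-trans (+-monoˡ-≤ y h) (≤-reflexive (sub-add x y))

  sum-choice : ∀ {u v p q} → u + v ≤ p + q → u ≤ p ⊎ v ≤ q
  sum-choice {u} {v} {p} {q} h with ≤-total u p
  ... | inj₁ u≤p = inj₁ u≤p
  ... | inj₂ p≤u = inj₂ (linearʳ {v} {q} (+-mono h p≤u) (solveʳ 4 (λ u v p q → v :+ (p :+ q :+ u) :≈ q :+ (u :+ v :+ p)) ≈-refl u v p q))

  0≤1 : 0# ≤ 1#
  0≤1 with ≤-total 0# 1#
  ... | inj₁ p = p
  ... | inj₂ 1≤0 = ≤-trans (*-nonNeg 0≤-1 0≤-1) (≤-reflexive square)
    where
    0≤-1 : 0# ≤ - 1#
    0≤-1 = +-cancel 1# (≤-resp (≈-sym (+-identityˡ 1#)) (≈-sym (-‿inverseˡ 1#)) 1≤0)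
    square : - 1# * - 1# ≈ 1#
    square = ≈-trans (≈-sym (-‿distribˡ-* 1# (- 1#))) (≈-trans (R.-‿cong (*-identityˡ (- 1#))) (-‿involutive 1#))

  1≰0 : Positive 1#
  1≰0 h = 0≉1 (≤-antisym 0≤1 h)

  fromℕ-nonneg : ∀ n → 0# ≤ fromℕ n
  fromℕ-nonneg zero = ≤-refl
  fromℕ-nonneg (suc n) = ≤-resp (+-identityˡ 0#) ≈-refl (+-mono 0≤1 (fromℕ-nonneg n))

  fromℕ-+ : ∀ m n → fromℕ (m ℕ.+ n) ≈ fromℕ m + fromℕ n
  fromℕ-+ m n = MonoidMult.×-homo-+ R.+-monoid 1# m n

  fromℕ-* : ∀ m n → fromℕ (m ℕ.* n) ≈ fromℕ m * fromℕ n
  fromℕ-* m n = SemiringMult.×1-homo-* R.semiring m n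

  fromℕ-mono : ∀ {m n} → m ℕ.≤ n → fromℕ m ≤ fromℕ n
  fromℕ-mono {n = n} z≤n = fromℕ-nonneg n
  fromℕ-mono (s≤s h) = +-mono ≤-refl (fromℕ-mono h)

  fromℕ-reflects : ∀ {m n} → fromℕ m ≤ fromℕ n → m ℕ.≤ n
  fromℕ-reflects {m} {n} h with m ℕ.≤? n
  ... | yes p = p
  ... | no m≰n = ⊥-elim (1≰0 (+-cancel (fromℕ n) (≤-trans (fromℕ-mono (ℕ.≰⇒> m≰n)) (≤-trans h (≤-reflexive (≈-sym (+-identityˡ _)))))))

  *-monoʳ : ∀ {x y} z → 0# ≤ z → x ≤ y → x * z ≤ y * z
  *-monoʳ {x} {y} z 0≤z x≤y = ≤-resp (+-identityˡ (x * z)) (≈-trans (≈-sym (R.distribʳ z (y - x) x)) (*-congʳ (sub-add y x)))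
    (+-monoˡ-≤ (x * z) (*-nonNeg (≤-sub (≤-trans (≤-reflexive (+-identityˡ x)) x≤y)) 0≤z))

  *-monoˡ : ∀ {x y} z → 0# ≤ z → x ≤ y → z * x ≤ z * y
  *-monoˡ {x} {y} z 0≤z x≤y = ≤-resp (*-comm x z) (*-comm y z) (*-monoʳ z 0≤z x≤y)

  inverse : ∀ {x} → Positive x → x * x ⁻¹ ≈ 1#
  inverse {x} x>0 = *-inverseʳ x (λ e → x>0 (≤-reflexive e))

  inverse-nonneg : ∀ {x} → Positive x → 0# ≤ x ⁻¹
  inverse-nonneg {x} x>0 with ≤-total 0# (x ⁻¹)
  ... | inj₁ p = p
  ... | inj₂ p = ⊥-elim (1≰0 (≤-resp (inverse x>0) (zeroʳ x) (*-monoˡ x (≰⇒≥ x>0) p)))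

  div-mul : ∀ {x} y → Positive x → y / x * x ≈ y
  div-mul {x} y x>0 = ≈-trans (*-assoc y (x ⁻¹) x) (≈-trans (*-congˡ (≈-trans (*-comm (x ⁻¹) x) (inverse x>0))) (*-identityʳ y))

  *-cancelʳ : ∀ {x y} z → Positive z → x * z ≤ y * z → x ≤ y
  *-cancelʳ {x} {y} z z>0 h = ≤-resp (undo x) (undo y) (*-monoʳ (z ⁻¹) (inverse-nonneg z>0) h)
    where
    undo : ∀ u → u * z * z ⁻¹ ≈ u
    undo u = ≈-trans (*-assoc u z (z ⁻¹)) (≈-trans (*-congˡ (inverse z>0)) (*-identityʳ u))

  floorFrom-≥ : ∀ {x m} N → m ℕ.≤ N → fromℕ m ≤ x → m ℕ.≤ floorFrom x N
  floorFrom-≥ zero m≤ _ = m≤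
  floorFrom-≥ {x} (suc N) m≤ h with fromℕ (suc N) ≤? x
  ... | yes _ = m≤
  ... | no N≰x with ≤-split m≤
  ...   | inj₁ (s≤s m≤N) = floorFrom-≥ N m≤N h
  ...   | inj₂ refl = ⊥-elim (N≰x h)

  floorFrom-≤ : ∀ {x} N → 0# ≤ x → fromℕ (floorFrom x N) ≤ x
  floorFrom-≤ zero h = h
  floorFrom-≤ {x} (suc N) h with fromℕ (suc N) ≤? x
  ... | yes p = p
  ... | no _ = floorFrom-≤ N h

  floor-≥ : ∀ {x m} → fromℕ m ≤ x → m ℕ.≤ floorᴿ x
  floor-≥ {x} h = floorFrom-≥ (proj₁ (archimedean x)) (fromℕ-reflects {n = proj₁ (archimedean x)} (≤-trans h (proj₂ (archimedean x)))) h

  floor-≤ : ∀ {x} → 0# ≤ x → fromℕ (floorᴿ x) ≤ x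
  floor-≤ {x} = floorFrom-≤ (proj₁ (archimedean x))

  -- This makes the logarithm in the time bound at least 1 as soon as 1 / ε exceeds 1.
  ceilingFrom-≥2 : ∀ {x} N → ¬ (x ≤ fromℕ 1) → x ≤ fromℕ N → 2 ℕ.≤ ceilingFrom x N
  ceilingFrom-≥2 zero x>1 h = ⊥-elim (x>1 (≤-trans h (fromℕ-nonneg 1)))
  ceilingFrom-≥2 {x} (suc N) x>1 h with x ≤? fromℕ N
  ... | yes p = ceilingFrom-≥2 N x>1 p
  ceilingFrom-≥2 {x} (suc zero) x>1 h | no _ = ⊥-elim (x>1 h)
  ceilingFrom-≥2 {x} (suc (suc N)) x>1 h | no _ = s≤s (s≤s z≤n)

  -- Cells of width w are half open: z ≥ 0 lies in cell a when a * w ≤ z < (a + 1) * w.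
  module Cells (w : Carrier) (w>0 : Positive w) where
    cell : Carrier → ℕ
    cell z = floorᴿ (z / w)

    cell-≥ : ∀ {z} a → fromℕ a * w ≤ z → a ℕ.≤ cell z
    cell-≥ {z} a h = floor-≥ (*-cancelʳ w w>0 (≤-trans h (≤-reflexive (≈-sym (div-mul z w>0)))))

    cell-≤ : ∀ {z} a → 0# ≤ z → a ℕ.≤ cell z → fromℕ a * w ≤ z
    cell-≤ {z} a 0≤z h = ≤-trans (*-monoʳ w (≰⇒≥ w>0) (≤-trans (fromℕ-mono h)
      (floor-≤ (*-cancelʳ w w>0 (≤-resp (≈-sym (zeroˡ w)) (≈-sym (div-mul z w>0)) 0≤z))))) (≤-reflexive (div-mul z w>0))

    cell-upper : ∀ {z} a → cell z ℕ.< a → z ≤ fromℕ a * w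
    cell-upper {z} a h = ≰⇒≥ (λ p → ℕ.<⇒≱ h (cell-≥ a p))

    cell-mono : ∀ {u z} → 0# ≤ u → u ≤ z → cell u ℕ.≤ cell z
    cell-mono {u} 0≤u u≤z = cell-≥ _ (≤-trans (cell-≤ _ 0≤u ℕ.≤-refl) u≤z)

    -- Otherwise (cell u + 1) w + (cell s + 1) w ≤ z ≤ u + s, so one of the summands would be at
    -- most u or s respectively, against the choice of the floors. The two extra cells are the
    -- origin of the 2 in 2 / ε.
    cell-span : ∀ {u s z} → 0# ≤ u → 0# ≤ s → u ≤ z → z ≤ u + s → cell z ℕ.< cell u ℕ.+ (2 ℕ.+ cell s)
    cell-span {u} {s} {z} 0≤u 0≤s u≤z z≤ = ℕ.≰⇒> λ h → split (sum-choice (≤-trans (≤-reflexive expand)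
        (≤-trans (cell-≤ (cell u ℕ.+ (2 ℕ.+ cell s)) (≤-trans 0≤u u≤z) h) z≤)))
      where
      split : fromℕ (suc (cell u)) * w ≤ u ⊎ fromℕ (suc (cell s)) * w ≤ s → ⊥
      split (inj₁ p) = ℕ.1+n≰n (cell-≥ _ p)
      split (inj₂ p) = ℕ.1+n≰n (cell-≥ _ p)
      expand : fromℕ (suc (cell u)) * w + fromℕ (suc (cell s)) * w ≈ fromℕ (cell u ℕ.+ (2 ℕ.+ cell s)) * w
      expand = ≈-trans (solveʳ 4 (λ e a b w → (e :+ a) :* w :+ (e :+ b) :* w :≈ (a :+ (e :+ (e :+ b))) :* w) ≈-refl 1# _ _ w)
        (*-congʳ (≈-sym (fromℕ-+ (cell u) (2 ℕ.+ cell s))))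

-- Geometry of centres and grids

suc-pred-* : ∀ j {k} → 1 ℕ.≤ k → suc (suc j ℕ.* k ℕ.∸ 1) ≡ suc j ℕ.* k
suc-pred-* j {suc k} _ = refl

count-identity : ∀ P Q R S T → (∀ i → bit (P i) ℕ.+ bit (Q i) ℕ.+ bit (R i) ≡ bit (S i) ℕ.+ bit (T i)) →
                 ∀ n → count P n ℕ.+ count Q n ℕ.+ count R n ≡ count S n ℕ.+ count T n
count-identity P Q R S T h zero = refl
count-identity P Q R S T h (suc n) = add (bit (P n)) (bit (Q n)) (bit (R n)) (bit (S n)) (bit (T n))
    (count P n) (count Q n) (count R n) (count S n) (count T n) (h n) (count-identity P Q R S T h n)
  where
  add : ∀ a b c d e a′ b′ c′ d′ e′ → a ℕ.+ b ℕ.+ c ≡ d ℕ.+ e → a′ ℕ.+ b′ ℕ.+ c′ ≡ d′ ℕ.+ e′ →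
        a ℕ.+ a′ ℕ.+ (b ℕ.+ b′) ℕ.+ (c ℕ.+ c′) ≡ d ℕ.+ d′ ℕ.+ (e ℕ.+ e′)
  add a b c d e a′ b′ c′ d′ e′ p q = trans (lhs a b c a′ b′ c′) (trans (cong₂ ℕ._+_ p q) (rhs d e d′ e′))
    where
    lhs : ∀ a b c a′ b′ c′ → a ℕ.+ a′ ℕ.+ (b ℕ.+ b′) ℕ.+ (c ℕ.+ c′) ≡ a ℕ.+ b ℕ.+ c ℕ.+ (a′ ℕ.+ b′ ℕ.+ c′)
    lhs a b c a′ b′ c′ = solve (a ∷ b ∷ c ∷ a′ ∷ b′ ∷ c′ ∷ [])
    rhs : ∀ d e d′ e′ → d ℕ.+ e ℕ.+ (d′ ℕ.+ e′) ≡ d ℕ.+ d′ ℕ.+ (e ℕ.+ e′)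
    rhs d e d′ e′ = solve (d ∷ e ∷ d′ ∷ e′ ∷ [])

module Geometric (ℝ : CompleteOrderedField) (n k : ℕ) (1≤k : 1 ℕ.≤ k)
                 (X Y : ℕ → CompleteOrderedField.Carrier ℝ) where
  open CompleteOrderedField ℝ renaming (floor to floorᴿ)
  open Ranks ℝ using (le; lt; le-intro; le-elim; le-false; lt-intro; lt-elim; countLe; countLt; HasRank; hasRank; below; upto)
  open Field ℝ

  between : Carrier → Carrier → Carrier → Bool
  between lo hi x = le lo x ∧ le x hi

  -- Let a values be below lo. The first multiple (j + 1) k beyond a is at most a + k, and at least
  -- a + k values are at most hi; so the value of rank (j + 1) k - 1 is neither below lo nor above
  -- hi.
  rank-in-interval : ∀ f lo hi → k ℕ.≤ count (λ i → between lo hi (f i)) n →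
                     ∃[ j ] suc j ℕ.* k ℕ.≤ n × (∀ {v} → HasRank f n (suc j ℕ.* k ℕ.∸ 1) v → lo ≤ v × v ≤ hi)
  rank-in-interval f lo hi many = j , fits , λ rk → lower rk , upper rk
    where
    instance
      k≢0 : ℕ.NonZero k
      k≢0 = ℕ.>-nonZero 1≤k
    a j ρ : ℕ
    a = countLt f lo n
    j = a ℕ./ k
    ρ = suc j ℕ.* k ℕ.∸ 1
    ρ+1 : suc ρ ≡ suc j ℕ.* k
    ρ+1 = suc-pred-* j 1≤k
    a≤ρ : a ℕ.≤ ρ
    a≤ρ = ℕ.s≤s⁻¹ (subst (a ℕ.<_) (sym ρ+1) (begin-strict
        a  ≡⟨ m≡m%n+[m/n]*n a k ⟩
        a ℕ.% k ℕ.+ j ℕ.* k  <⟨ ℕ.+-monoˡ-< (j ℕ.* k) (m%n<n a k) ⟩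
        k ℕ.+ j ℕ.* k  ∎))
      where open ℕ.≤-Reasoning
    fit : suc ρ ℕ.≤ countLe f hi n
    fit = subst (ℕ._≤ countLe f hi n) (sym ρ+1) (begin
        k ℕ.+ j ℕ.* k  ≤⟨ many +≤ m/n*n≤m a k ⟩
        count (λ i → between lo hi (f i)) n ℕ.+ a  ≤⟨ ℕ.+-monoˡ-≤ a (count-mono n (λ {i} _ h →
                                                                      let (p , q) = ∧-elim {le lo (f i)} h in ∧-intro q (trans (not-involutive _) p))) ⟩
        count (λ i → le (f i) hi ∧ ¬ᵇ lt (f i) lo) n ℕ.+ a       ≤⟨ split ⟩
        countLe f hi n  ∎)
      where
      open ℕ.≤-Reasoning
      lo≤hi : lo ≤ hi
      lo≤hi with count-witness _ n (ℕ.≤-trans 1≤k many)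
      ... | i , _ , h = let (p , q) = ∧-elim {le lo (f i)} h in ≤-trans (le-elim p) (le-elim q)
      split : count (λ i → le (f i) hi ∧ ¬ᵇ lt (f i) lo) n ℕ.+ a ℕ.≤ countLe f hi n
      split = ℕ.≤-trans (ℕ.+-monoʳ-≤ _ (count-mono n (λ h q → ∧-intro (le-intro (≤-trans (≰⇒≥ (lt-elim q)) lo≤hi)) q)))
        (ℕ.≤-reflexive (trans (ℕ.+-comm _ (count (λ i → le (f i) hi ∧ lt (f i) lo) n)) (sym (count-split (λ i → le (f i) hi) (λ i → lt (f i) lo) n))))
    fits : suc j ℕ.* k ℕ.≤ n
    fits = subst (ℕ._≤ n) ρ+1 (ℕ.≤-trans fit (count-≤ _ n))
    lower : ∀ {v} → HasRank f n ρ v → lo ≤ v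
    lower {v} rk with lo ≤? v
    ... | yes p = p
    ... | no lo≰v = ⊥-elim (ℕ.<⇒≱ (upto rk) (ℕ.≤-trans (count-mono n (λ _ h → lt-intro (λ lo≤fi → lo≰v (≤-trans lo≤fi (le-elim h))))) a≤ρ))
    upper : ∀ {v} → HasRank f n ρ v → v ≤ hi
    upper {v} rk with v ≤? hi
    ... | yes p = p
    ... | no v≰hi = ⊥-elim (ℕ.<⇒≱ (ℕ.≤-trans fit (count-mono n (λ _ h → lt-intro (λ v≤fi → v≰hi (≤-trans v≤fi (le-elim h)))))) (below rk))

  inside : Carrier → Carrier → Carrier → ℕ → Bool
  inside l b s i = between l (l + s) (X i) ∧ between b (b + s) (Y i)

  covers : Carrier → Carrier → Carrier → ℕ
  covers l b s = count (inside l b s) n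

  record Feasible (l b s : Carrier) : Set where
    constructor feasible
    field
      nonneg : 0# ≤ s
      enough : k ℕ.≤ covers l b s

  Minimal : Carrier → Set
  Minimal s = ∀ {l b s′} → Feasible l b s′ → s ≤ s′

  _⊔_ : Carrier → Carrier → Carrier
  x ⊔ y = if le x y then y else x

  ⊔-≤ : ∀ {x y z} → x ≤ z → y ≤ z → x ⊔ y ≤ z
  ⊔-≤ {x} {y} p q with le x y
  ... | true = q
  ... | false = p

  ≤-⊔ : ∀ {x y z} → x ⊔ y ≤ z → x ≤ z × y ≤ z
  ≤-⊔ {x} {y} h with x ≤? y
  ... | yes p = ≤-trans p h , h
  ... | no p = h , ≤-trans (≰⇒≥ p) h

  -- The maximum norm, each absolute value being a maximum of two differences. The nesting follows
  -- the order in which `load-distance` raises its accumulator.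
  distance : Carrier → Carrier → ℕ → Carrier
  distance vx vy i = (((X i - vx) ⊔ (vx - X i)) ⊔ (Y i - vy)) ⊔ (vy - Y i)

  distance-≤ : ∀ {vx vy r i} → X i ≤ vx + r → vx ≤ X i + r → Y i ≤ vy + r → vy ≤ Y i + r → distance vx vy i ≤ r
  distance-≤ p q r s = ⊔-≤ (⊔-≤ (⊔-≤ (flip p) (flip q)) (flip r)) (flip s)
    where
    flip : ∀ {x y z} → x ≤ y + z → x - y ≤ z
    flip h = sub-≤ (≤-trans h (≤-reflexive (+-comm _ _)))

  ≤-distance : ∀ {vx vy r i} → distance vx vy i ≤ r → (X i ≤ vx + r × vx ≤ X i + r) × (Y i ≤ vy + r × vy ≤ Y i + r)
  ≤-distance {vx} {vy} {r} {i} h =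
    let (h₁ , s) = ≤-⊔ {((X i - vx) ⊔ (vx - X i)) ⊔ (Y i - vy)} h ; (h₂ , q) = ≤-⊔ {(X i - vx) ⊔ (vx - X i)} h₁ ; (p , p′) = ≤-⊔ {X i - vx} h₂
    in (flip p , flip p′) , (flip q , flip s)
    where
    flip : ∀ {x y z} → x - y ≤ z → x ≤ y + z
    flip h = ≤-trans (sub-≤⁻ h) (≤-reflexive (+-comm _ _))

  module Centre (vx vy : Carrier) where
    D : ℕ → Carrier
    D = distance vx vy

    ball-feasible : ∀ {d} → 0# ≤ d → k ℕ.≤ countLe D d n → Feasible (vx - d) (vy - d) (d + d)
    ball-feasible {d} 0≤d many = feasible (≤-resp (+-identityˡ 0#) ≈-refl (+-mono 0≤d 0≤d))
      (ℕ.≤-trans many (count-mono n λ {i} _ h → let ((p , q) , (r , s)) = ≤-distance (le-elim h) in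
        ∧-intro (∧-intro (le-intro (sub-≤ q)) (le-intro (right p))) (∧-intro (le-intro (sub-≤ s)) (le-intro (right r)))))
      where
      right : ∀ {x v} → x ≤ v + d → x ≤ v - d + (d + d)
      right {x} {v} h = ≤-trans h (≤-reflexive (≈-trans (+-congʳ (≈-sym (sub-add v d))) (+-assoc (v - d) d d)))

    point-feasible : ∀ {d} → d ≤ 0# → k ℕ.≤ countLe D d n → Feasible vx vy 0#
    point-feasible {d} d≤0 many = feasible ≤-refl (ℕ.≤-trans many (count-mono n λ {i} _ h →
      let ((p , q) , (r , s)) = ≤-distance (≤-trans (le-elim h) d≤0) in
      ∧-intro (∧-intro (le-intro (≤-trans q (≤-reflexive (+-identityʳ _)))) (le-intro p))
              (∧-intro (le-intro (≤-trans s (≤-reflexive (+-identityʳ _)))) (le-intro r))))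

    -- All points of a square of side s that contains the centre have distance at most s.
    radius-≤-side : ∀ {d l b s} → HasRank D n (k ℕ.∸ 1) d → Feasible l b s →
                    l ≤ vx × vx ≤ l + s → b ≤ vy × vy ≤ b + s → d ≤ s
    radius-≤-side {d} {l} {b} {s} rk (feasible _ many) (l≤ , ≤r) (b≤ , ≤t) with d ≤? s
    ... | yes p = p
    ... | no d≰s = ⊥-elim (ℕ.<⇒≱ (ℕ.≤-trans (ℕ.≤-reflexive (ℕ.m+[n∸m]≡n 1≤k)) (ℕ.≤-trans many
          (count-mono n λ {i} _ h → let (hx , hy) = ∧-elim {between l (l + s) (X i)} h
                                        (p , q) = ∧-elim {le l (X i)} hx ; (r , t) = ∧-elim {le b (Y i)} hy in
            lt-intro (λ d≤D → d≰s (≤-trans d≤D (distance-≤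
              (≤-trans (le-elim q) (+-monoˡ-≤ s l≤)) (≤-trans ≤r (+-monoˡ-≤ s (le-elim p)))
              (≤-trans (le-elim t) (+-monoˡ-≤ s b≤)) (≤-trans ≤t (+-monoˡ-≤ s (le-elim r))))))))) (below rk))

    module Grid (d w : Carrier) (M : ℕ) (d>0 : Positive d) (Mw≈d : fromℕ M * w ≈ d) (w>0 : Positive w) where
      open Cells w w>0

      corner : Carrier → Carrier
      corner v = v - (d + d)

      column row : ℕ → ℕ
      column i = cell (X i - corner vx)
      row i = cell (Y i - corner vy)

      visible : ℕ → Bool
      visible i = le (corner vx) (X i) ∧ le (corner vy) (Y i) ∧ does (column i ℕ.≤? 4 ℕ.* M) ∧ does (row i ℕ.≤? 4 ℕ.* M)

      before : ℕ → ℕ → Bool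
      before c a = does (c ℕ.<? a)

      range : ℕ → ℕ → ℕ → Bool
      range a m c = ¬ᵇ before c a ∧ before c (a ℕ.+ m)

      prefix : ℕ → ℕ → ℕ
      prefix u v = count (λ i → visible i ∧ before (column i) u ∧ before (row i) v) n

      rect : ℕ → ℕ → ℕ → ℕ
      rect a b m = count (λ i → visible i ∧ range a m (column i) ∧ range b m (row i)) n

      range-intro : ∀ a m {c} → a ℕ.≤ c → c ℕ.< a ℕ.+ m → range a m c ≡ true
      range-intro a m {c} p q = ∧-intro (cong ¬ᵇ_ (dec-false (c ℕ.<? a) (ℕ.≤⇒≯ p))) (dec-true (c ℕ.<? a ℕ.+ m) q)

      range-elim : ∀ a m {c} → range a m c ≡ true → a ℕ.≤ c × c ℕ.< a ℕ.+ m
      range-elim a m {c} h = let (p , q) = ∧-elim {¬ᵇ before c a} h in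
        ℕ.≮⇒≥ (does-false (c ℕ.<? a) (not-true p)) , does-true (c ℕ.<? a ℕ.+ m) q

      range-mono : ∀ a {m m′ c} → m ℕ.≤ m′ → range a m c ≡ true → range a m′ c ≡ true
      range-mono a {m} {m′} h r = let (p , q) = range-elim a m r in range-intro a m′ p (ℕ.<-≤-trans q (ℕ.+-monoʳ-≤ a h))

      rect-mono : ∀ {a b m m′} → m ℕ.≤ m′ → rect a b m ℕ.≤ rect a b m′
      rect-mono {a} {b} {m} h = count-mono n λ {i} _ r → let (p , q) = ∧-elim {visible i} r ; (q₁ , q₂) = ∧-elim {range a m (column i)} q in
        ∧-intro p (∧-intro (range-mono a h q₁) (range-mono b h q₂))

      rect-zero : ∀ a b → rect a b 0 ℕ.< 1
      rect-zero a b = ℕ.≰⇒> λ h → let (i , _ , r) = count-witness _ n h ; (q₁ , _) = ∧-elim {range a 0 (column i)} (proj₂ (∧-elim {visible i} r)) ; (p , q) = range-elim a 0 q₁ in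
        ℕ.<⇒≱ q (subst (ℕ._≤ column i) (sym (ℕ.+-identityʳ a)) p)

      -- Inclusion-exclusion, arranged without subtraction.
      rect-prefix : ∀ a b m → rect a b m ℕ.+ prefix a (b ℕ.+ m) ℕ.+ prefix (a ℕ.+ m) b ≡ prefix (a ℕ.+ m) (b ℕ.+ m) ℕ.+ prefix a b
      rect-prefix a b m = count-identity
          (λ i → visible i ∧ range a m (column i) ∧ range b m (row i))
          (λ i → visible i ∧ before (column i) a ∧ before (row i) (b ℕ.+ m))
          (λ i → visible i ∧ before (column i) (a ℕ.+ m) ∧ before (row i) b)
          (λ i → visible i ∧ before (column i) (a ℕ.+ m) ∧ before (row i) (b ℕ.+ m))
          (λ i → visible i ∧ before (column i) a ∧ before (row i) b)
          (λ i → box (visible i) (before (column i) a) (before (column i) (a ℕ.+ m)) (before (row i) b) (before (row i) (b ℕ.+ m))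
                     (later (column i) a) (later (row i) b)) n
        where
        later : ∀ c a → before c a ≡ true → before c (a ℕ.+ m) ≡ true
        later c a h = dec-true (c ℕ.<? a ℕ.+ m) (ℕ.<-≤-trans (does-true (c ℕ.<? a) h) (ℕ.m≤m+n a m))
        box : ∀ g p q p′ q′ → (p ≡ true → q ≡ true) → (p′ ≡ true → q′ ≡ true) →
              bit (g ∧ (¬ᵇ p ∧ q) ∧ (¬ᵇ p′ ∧ q′)) ℕ.+ bit (g ∧ p ∧ q′) ℕ.+ bit (g ∧ q ∧ p′) ≡ bit (g ∧ q ∧ q′) ℕ.+ bit (g ∧ p ∧ p′)
        box false p q p′ q′ h h′ = refl
        box true true false p′ q′ h h′ with h refl
        ... | ()
        box true p q true false h h′ with h′ refl
        ... | ()
        box true true true true true h h′ = refl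
        box true true true false true h h′ = refl
        box true true true false false h h′ = refl
        box true false true true true h h′ = refl
        box true false true false true h h′ = refl
        box true false true false false h h′ = refl
        box true false false true true h h′ = refl
        box true false false false true h h′ = refl
        box true false false false false h h′ = refl

      -- Half-open cells lie in the closed square they span. Visibility matters at cell 0, where the
      -- truncated floor alone gives no lower bound.
      rect-feasible : ∀ {a b m} → k ℕ.≤ rect a b m → Feasible (corner vx + fromℕ a * w) (corner vy + fromℕ b * w) (fromℕ m * w)
      rect-feasible {a} {b} {m} many = feasible (*-nonNeg (fromℕ-nonneg m) (≰⇒≥ w>0))
          (ℕ.≤-trans many (count-mono n λ {i} _ h →
            let (vis , h′) = ∧-elim {visible i} h ; (h₁ , h₂) = ∧-elim {range a m (column i)} h′
                (v₁ , vis′) = ∧-elim {le (corner vx) (X i)} vis ; (v₂ , _) = ∧-elim {le (corner vy) (Y i)} vis′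
            in ∧-intro (inside-range a (le-elim v₁) (range-elim a m h₁)) (inside-range b (le-elim v₂) (range-elim b m h₂))))
        where
        inside-range : ∀ {o x} a → o ≤ x → a ℕ.≤ cell (x - o) × cell (x - o) ℕ.< a ℕ.+ m →
                       between (o + fromℕ a * w) (o + fromℕ a * w + fromℕ m * w) x ≡ true
        inside-range {o} {x} a o≤x (p , q) = ∧-intro
          (le-intro (≤-trans (≤-reflexive (+-comm o _)) (≤-sub⁻ (cell-≤ a 0≤ p))))
          (le-intro (≤-trans (sub-≤⁻ (cell-upper (a ℕ.+ m) q)) (≤-reflexive (≈-trans (+-congʳ (*-congʳ (fromℕ-+ a m)))
            (solveʳ 4 (λ a m w o → (a :+ m) :* w :+ o :≈ o :+ a :* w :+ m :* w) ≈-refl _ _ w o)))))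
          where
          0≤ : 0# ≤ x - o
          0≤ = ≤-sub (≤-trans (≤-reflexive (+-identityˡ o)) o≤x)

      4M·w : fromℕ (4 ℕ.* M) * w ≈ (d + d) + (d + d)
      4M·w = ≈-trans (*-congʳ (fromℕ-* 4 M)) (≈-trans (solveʳ 3 (λ e m w → (e :+ (e :+ (e :+ (e :+ con 0)))) :* m :* w :≈
          (e :* (m :* w) :+ e :* (m :* w)) :+ (e :* (m :* w) :+ e :* (m :* w))) ≈-refl 1# _ w)
          (+-cong (+-cong one one) (+-cong one one)))
        where
        one : 1# * (fromℕ M * w) ≈ d
        one = ≈-trans (*-identityˡ _) Mw≈d

      cell-bound : ∀ {v x} → v - (d + d) ≤ x → x ≤ v + (d + d) → cell (x - corner v) ℕ.≤ 4 ℕ.* M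
      cell-bound {v} {x} h h′ = fromℕ-reflects (*-cancelʳ w w>0 (≤-trans (cell-≤ _ (≤-sub (≤-trans (≤-reflexive (+-identityˡ _)) h)) ℕ.≤-refl)
        (≤-trans (sub-≤ {y = corner v} (≤-trans h′ (≤-reflexive split))) (≤-reflexive (≈-sym 4M·w)))))
        where
        split : v + (d + d) ≈ (d + d) + (d + d) + corner v
        split = ≈-trans (+-congʳ (≈-sym (sub-add v (d + d)))) (solveʳ 2 (λ c e → c :+ e :+ e :≈ e :+ e :+ c) ≈-refl (corner v) (d + d))

      module _ {v l s : Carrier} (0≤s : 0# ≤ s) (s≤2d : s ≤ d + d) (l≤v : l ≤ v) (v≤r : v ≤ l + s) where
        window : corner v ≤ l
        window = sub-≤ (≤-trans v≤r (+-mono ≤-refl s≤2d))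

        start-bound : cell (l - corner v) ℕ.≤ 4 ℕ.* M
        start-bound = cell-bound window (≤-trans l≤v (≤-trans (≤-reflexive (≈-sym (+-identityʳ v))) (+-mono ≤-refl (≤-trans 0≤s s≤2d))))

        point-visible : ∀ {x} → between l (l + s) x ≡ true →
                        corner v ≤ x × cell (x - corner v) ℕ.≤ 4 ℕ.* M × range (cell (l - corner v)) (2 ℕ.+ cell s) (cell (x - corner v)) ≡ true
        point-visible {x} h = let (p , q) = ∧-elim {le l x} h ; l≤x = le-elim p ; x≤r = le-elim q ; o≤x = ≤-trans window l≤x ;
                                   0≤u = ≤-sub (≤-trans (≤-reflexive (+-identityˡ _)) window) ; u≤z = +-monoˡ-≤ (- corner v) l≤x in
          o≤x , cell-bound o≤x (≤-trans x≤r (+-mono l≤v s≤2d)) ,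
          range-intro (cell (l - corner v)) (2 ℕ.+ cell s) (cell-mono 0≤u u≤z) (cell-span 0≤u 0≤s u≤z (≤-trans (+-monoˡ-≤ (- corner v) x≤r)
            (≤-reflexive (solveʳ 3 (λ l s o → l :+ s :+ o :≈ l :+ o :+ s) ≈-refl l s (- corner v)))))

      -- A square of side at most 2 d containing the centre stays inside the window, so all its
      -- points are visible, and by `cell-span` they occupy at most `2 + cell s` columns and rows.
      approximate : ∀ {l b s} → 0# ≤ s → s ≤ d + d → k ℕ.≤ covers l b s → l ≤ vx × vx ≤ l + s → b ≤ vy × vy ≤ b + s →
                    ∃[ a ] ∃[ c ] a ℕ.≤ 4 ℕ.* M × c ℕ.≤ 4 ℕ.* M × k ℕ.≤ rect a c (2 ℕ.+ cell s)
      approximate {l} {b} {s} 0≤s s≤2d many (p , q) (p′ , q′) =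
        cell (l - corner vx) , cell (b - corner vy) , start-bound 0≤s s≤2d p q , start-bound 0≤s s≤2d p′ q′ ,
        ℕ.≤-trans many (count-mono n λ {i} _ h →
          let (hx , hy) = ∧-elim {between l (l + s) (X i)} h
              (o , c , r) = point-visible 0≤s s≤2d p q hx ; (o′ , c′ , r′) = point-visible 0≤s s≤2d p′ q′ hy
          in ∧-intro (∧-intro (le-intro o) (∧-intro (le-intro o′) (∧-intro (dec-true (_ ℕ.≤? _) c) (dec-true (_ ℕ.≤? _) c′)))) (∧-intro r r′))

      -- The starting point of the search: the k points within distance d of the centre all lie in
      -- the window.
      full : k ℕ.≤ countLe D d n → k ℕ.≤ rect 0 0 (1 ℕ.+ 4 ℕ.* M)
      full many = ℕ.≤-trans many (count-mono n λ {i} _ h → let ((p , q) , (r , s)) = ≤-distance (le-elim h) ; (o , c) = near p q ; (o′ , c′) = near r s in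
          ∧-intro (∧-intro (le-intro o) (∧-intro (le-intro o′) (∧-intro (dec-true (_ ℕ.≤? _) c) (dec-true (_ ℕ.≤? _) c′))))
                  (∧-intro (range-intro 0 _ z≤n (s≤s c)) (range-intro 0 _ z≤n (s≤s c′))))
        where
        d≤2d : d ≤ d + d
        d≤2d = ≤-trans (≤-reflexive (≈-sym (+-identityˡ d))) (+-monoˡ-≤ d (≰⇒≥ d>0))
        near : ∀ {x v} → x ≤ v + d → v ≤ x + d → corner v ≤ x × cell (x - corner v) ℕ.≤ 4 ℕ.* M
        near {x} {v} p q = o , cell-bound o (≤-trans p (+-mono ≤-refl d≤2d))
          where
          o : corner v ≤ x
          o = sub-≤ (≤-trans q (+-mono ≤-refl d≤2d))

      -- m w ≤ cell(s) w + 2 w ≤ s + ε M w = s + ε d ≤ (1 + ε) s.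
      side-bound : ∀ {ε s m} → 0# ≤ s → fromℕ 2 ≤ ε * fromℕ M → 0# ≤ ε → d ≤ s → m ℕ.≤ 2 ℕ.+ cell s → fromℕ m * w ≤ (1# + ε) * s
      side-bound {ε} {s} {m} 0≤s 2≤εM 0≤ε d≤s m≤ = ≤-trans (*-monoʳ w (≰⇒≥ w>0) (fromℕ-mono m≤)) (≤-trans (≤-reflexive expand)
          (≤-trans (+-mono (cell-≤ _ 0≤s ℕ.≤-refl) (≤-trans (*-monoʳ w (≰⇒≥ w>0) 2≤εM) (≤-trans (≤-reflexive (≈-trans (*-assoc ε _ w) (*-congˡ Mw≈d))) (*-monoˡ ε 0≤ε d≤s))))
                   (≤-reflexive (≈-trans (+-congʳ (≈-sym (*-identityˡ s))) (solveʳ 3 (λ e x s → e :* s :+ x :* s :≈ (e :+ x) :* s) ≈-refl 1# ε s)))))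
        where
        expand : fromℕ (2 ℕ.+ cell s) * w ≈ fromℕ (cell s) * w + fromℕ 2 * w
        expand = solveʳ 3 (λ e c w → (e :+ (e :+ c)) :* w :≈ c :* w :+ (e :+ (e :+ con 0)) :* w) ≈-refl 1# _ w

-- Existence of a smallest enclosing square

module Smallest (ℝ : CompleteOrderedField) (n k : ℕ) (1≤k : 1 ℕ.≤ k)
                (X Y : ℕ → CompleteOrderedField.Carrier ℝ) where
  open CompleteOrderedField ℝ
  open Ranks ℝ using (le; le-intro; le-elim)
  open Field ℝ
  open Geometric ℝ n k 1≤k X Y

  -- Emptiness is an explicit alternative, which makes the notion closed under finite unions;
  -- finitely many decidable candidates are combined from singletons.
  Least : (Carrier → Set) → Set
  Least F = (∃[ s ] F s × (∀ {s′} → F s′ → s ≤ s′)) ⊎ (∀ {s} → ¬ F s)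

  least-single : ∀ {P : Set} → Dec P → ∀ v → Least (λ s → s ≡ v × P)
  least-single (yes p) v = inj₁ (v , (refl , p) , λ { (refl , _) → ≤-refl })
  least-single (no ¬p) v = inj₂ (λ { (_ , p) → ¬p p })

  least-⊎ : ∀ {F G} → Least F → Least G → Least (λ s → F s ⊎ G s)
  least-⊎ (inj₂ none) (inj₂ none′) = inj₂ λ { (inj₁ f) → none f ; (inj₂ g) → none′ g }
  least-⊎ (inj₁ (s , f , low)) (inj₂ none) = inj₁ (s , inj₁ f , λ { (inj₁ f′) → low f′ ; (inj₂ g) → ⊥-elim (none g) })
  least-⊎ (inj₂ none) (inj₁ (s , g , low)) = inj₁ (s , inj₂ g , λ { (inj₁ f) → ⊥-elim (none f) ; (inj₂ g′) → low g′ })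
  least-⊎ (inj₁ (s , f , low)) (inj₁ (s₁ , g , low₁)) with ≤-total s s₁
  ... | inj₁ s≤s₁ = inj₁ (s , inj₁ f , λ { (inj₁ f′) → low f′ ; (inj₂ g′) → ≤-trans s≤s₁ (low₁ g′) })
  ... | inj₂ s₁≤s = inj₁ (s₁ , inj₂ g , λ { (inj₁ f′) → ≤-trans s₁≤s (low f′) ; (inj₂ g′) → low₁ g′ })

  least-map : ∀ {F G} → (∀ {s} → F s → G s) → (∀ {s} → G s → F s) → Least F → Least G
  least-map to from (inj₁ (s , f , low)) = inj₁ (s , to f , λ g → low (from g))
  least-map to from (inj₂ none) = inj₂ λ g → none (from g)

  least-exists : ∀ {F : ℕ → Carrier → Set} → (∀ i → Least (F i)) → ∀ m → Least (λ s → ∃[ i ] i ℕ.< m × F i s)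
  least-exists least zero = inj₂ (λ { (_ , () , _) })
  least-exists {F} least (suc m) = least-map
      (λ { (inj₁ f) → m , ℕ.≤-refl , f ; (inj₂ (i , i<m , f)) → i , ℕ.m<n⇒m<1+n i<m , f })
      (λ { (i , s≤s i≤m , f) → split i≤m f })
      (least-⊎ (least m) (least-exists {F} least m))
    where
    split : ∀ {i s} → i ℕ.≤ m → F i s → F m s ⊎ (∃[ j ] j ℕ.< m × F j s)
    split {i} i≤m f with ≤-split i≤m
    ... | inj₁ i<m = inj₂ (i , i<m , f)
    ... | inj₂ refl = inj₁ f

  feasible? : ∀ l b s → Dec (Feasible l b s)
  feasible? l b s with 0# ≤? s | k ℕ.≤? covers l b s
  ... | yes p | yes q = yes (feasible p q)
  ... | no ¬p | _     = no (λ { (feasible p _) → ¬p p })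
  ... | yes _ | no ¬q = no (λ { (feasible _ q) → ¬q q })

  extent : ℕ → ℕ → ℕ → Carrier
  extent i j a = (X a - X i) ⊔ (Y a - Y j)

  -- A smallest square can be chosen with a point on its left side, a point on
  -- its bottom side and a point on one of the opposite sides.
  Candidate : Carrier → Set
  Candidate s = ∃[ i ] i ℕ.< n × ∃[ j ] j ℕ.< n × ∃[ a ] a ℕ.< n × (s ≡ extent i j a × Feasible (X i) (Y j) (extent i j a))

  -- Move the left and bottom sides to the extreme points i and j of I, and let a be the point that
  -- requires the largest side. Any square containing i, j and a has at least this side.
  tighten : ∀ I → k ℕ.≤ count I n → ∃[ s ] Candidate s ×
            (∀ {l b s′} → (∀ {p} → p ℕ.< n → I p ≡ true → inside l b s′ p ≡ true) → s ≤ s′)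
  tighten I many
    with extremum _≤_ ≤-total ≤-trans X I n (ℕ.≤-trans 1≤k many) | extremum _≤_ ≤-total ≤-trans Y I n (ℕ.≤-trans 1≤k many)
  ... | i , i<n , Ii , leftmost | j , j<n , Ij , lowest
    with extremum (λ x y → y ≤ x) (λ x y → ≤-total y x) (λ p q → ≤-trans q p) (extent i j) I n (ℕ.≤-trans 1≤k many)
  ... | a , a<n , Ia , largest = extent i j a , (i , i<n , j , j<n , a , a<n , refl , feasible nonneg enough) , small
    where
    bounds : ∀ {p} → p ℕ.< n → I p ≡ true → X p - X i ≤ extent i j a × Y p - Y j ≤ extent i j a
    bounds {p} p<n Ip = ≤-⊔ {X p - X i} (largest p<n Ip)
    nonneg : 0# ≤ extent i j a
    nonneg = ≤-trans (≤-sub (≤-reflexive (+-identityˡ (X i)))) (proj₁ (bounds i<n Ii))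
    enough : k ℕ.≤ covers (X i) (Y j) (extent i j a)
    enough = ℕ.≤-trans many (count-mono n λ p<n Ip → let (bx , by) = bounds p<n Ip in
      ∧-intro (∧-intro (le-intro (leftmost p<n Ip)) (le-intro (≤-trans (sub-≤⁻ bx) (≤-reflexive (+-comm _ (X i))))))
              (∧-intro (le-intro (lowest p<n Ip)) (le-intro (≤-trans (sub-≤⁻ by) (≤-reflexive (+-comm _ (Y j)))))))
    small : ∀ {l b s′} → (∀ {p} → p ℕ.< n → I p ≡ true → inside l b s′ p ≡ true) → extent i j a ≤ s′
    small {l} {b} {s′} h = ⊔-≤
        (sub-≤ (side (le-elim (proj₂ (∧-elim {le l (X a)} (proj₁ (split a<n Ia))))) (le-elim (proj₁ (∧-elim {le l (X i)} (proj₁ (split i<n Ii)))))))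
        (sub-≤ (side (le-elim (proj₂ (∧-elim {le b (Y a)} (proj₂ (split a<n Ia))))) (le-elim (proj₁ (∧-elim {le b (Y j)} (proj₂ (split j<n Ij)))))))
      where
      split : ∀ {p} → p ℕ.< n → I p ≡ true → between l (l + s′) (X p) ≡ true × between b (b + s′) (Y p) ≡ true
      split {p} p<n Ip = ∧-elim {between l (l + s′) (X p)} (h p<n Ip)
      side : ∀ {o x y} → y ≤ o + s′ → o ≤ x → y ≤ s′ + x
      side {o} {x} p q = ≤-trans p (≤-trans (+-monoˡ-≤ s′ q) (≤-reflexive (+-comm x s′)))

  minimal-exists : k ℕ.≤ n → ∃[ l ] ∃[ b ] ∃[ s ] Feasible l b s × Minimal s
  minimal-exists k≤n with least-exists (λ i → least-exists (λ j → least-exists (λ a → least-single (feasible? (X i) (Y j) (extent i j a)) (extent i j a)) n) n) n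
  ... | inj₂ none = ⊥-elim (none (proj₁ (proj₂ (tighten always (ℕ.≤-trans k≤n (ℕ.≤-reflexive (sym (count-true n))))))))
  ... | inj₁ (s , (i , _ , j , _ , a , _ , refl , fs) , low) = X i , Y j , s , fs , λ { {l} {b} {s′} (feasible _ many) →
          let (s₁ , cand , small) = tighten (inside l b s′) many in ≤-trans (low cand) (small (λ _ h → h)) }

-- The approximation program

#jx #jy #p #M #cx #cy #a #b #side #A #B #have #acc #u #v #cells #prefix : ℕ
-- The numbering starts beyond the arrays of selection, so that the frame conditions for `recurse`
-- compute to `false`.
#jx = 20
#jy = 21
#p = 22
#M = 23
#cx = 24
#cy = 25
#a = 26
#b = 27
#side = 28
#A = 29
#B = 30
#have = 31
#acc = 32
#u = 33
#v = 34
#cells = 35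
#prefix = 36

%vx %vy %d %w %ox %oy %left %bottom %side %best-left %best-bottom %best-side %t %s : ℕ
%vx = 20
%vy = 21
%d = 22
%w = 23
%ox = 24
%oy = 25
%left = 26
%bottom = 27
%side = 28
%best-left = 29
%best-bottom = 30
%best-side = 31
%t = 32
%s = 33

fillStep : Com → Com
fillStep load = load ⨟ %values [ ivar #p ]≔ʳ rvar %t

pick : Com → IE → Com
pick load r = forᵉ #p nᵉ (fillStep load) ⨟ #base := lit 0 ⨟ #size := nᵉ ⨟ #rank := r ⨟ recurse

raise : RE → Com
raise e = %s :=ʳ e ⨟ ifᵉ (rvar %t ≤ʳᵉ rvar %s) (%t :=ʳ rvar %s) (keepʳ %t)

load-x load-y load-distance : Com
load-x = %t :=ʳ xᵉ (ivar #p)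
load-y = %t :=ʳ yᵉ (ivar #p)
load-distance =
  %t :=ʳ xᵉ (ivar #p) -ʳ rvar %vx ⨟
  raise (rvar %vx -ʳ xᵉ (ivar #p)) ⨟
  raise (yᵉ (ivar #p) -ʳ rvar %vy) ⨟
  raise (rvar %vy -ʳ yᵉ (ivar #p))

pairᵉ : IE → IE → IE
pairᵉ i j = (i +ᵉ j) *ᵉ (i +ᵉ j) +ᵉ i

width last : IE
-- Grid squares may stick out of the window: a corner index and the tested side are each at most 4
-- M, so prefix sums are read up to index 8 M.
width = lit 2 +ᵉ lit 8 *ᵉ ivar #M
last = lit 4 *ᵉ ivar #M

clearStep clearCells bucketStep bucket : Com
-- The memory holds arbitrary values initially, and the counters of the previous pair of ranks
-- afterwards.
clearStep = #cells [ pairᵉ (ivar #u) (ivar #v) ]≔ lit 0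
clearCells = forᵉ #u width (forᵉ #v width clearStep)
bucketStep =
  #cx := floorᵉ ((xᵉ (ivar #p) -ʳ rvar %ox) /ʳ rvar %w) ⨟
  #cy := floorᵉ ((yᵉ (ivar #p) -ʳ rvar %oy) /ʳ rvar %w) ⨟
  ifᵉ (rvar %ox ≤ʳᵉ xᵉ (ivar #p) andᵉ rvar %oy ≤ʳᵉ yᵉ (ivar #p) andᵉ ivar #cx ≤ᵉ last andᵉ ivar #cy ≤ᵉ last)
    (#cells [ pairᵉ (ivar #cx) (ivar #cy) ]≔ lit 1 +ᵉ #cells ‼ pairᵉ (ivar #cx) (ivar #cy))
    (keepⁱ #cx)
bucket = forᵉ #p nᵉ bucketStep

clearPrefix prefixStep prefixRow prefixSums : Com
clearPrefix = #prefix [ pairᵉ (lit 0) (ivar #v) ]≔ lit 0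
prefixStep =
  -- Here `#acc` is the number of visible points in the cells (u, 0) to (u, v - 1), the part by
  -- which consecutive prefix sums differ.
  #prefix [ pairᵉ (lit 1 +ᵉ ivar #u) (ivar #v) ]≔ #prefix ‼ pairᵉ (ivar #u) (ivar #v) +ᵉ ivar #acc ⨟
  #acc := ivar #acc +ᵉ #cells ‼ pairᵉ (ivar #u) (ivar #v)
prefixRow = #acc := lit 0 ⨟ forᵉ #v width prefixStep
prefixSums = forᵉ #v width clearPrefix ⨟ forᵉ #u width prefixRow

smaller : IE
smaller = ivar #side -ᵉ lit 1

searchStep search : Com
searchStep =
  -- Inclusion-exclusion with all terms moved to the side where they are added. On success the same
  -- corner is tried again; a failure is final for the corner, because counts only drop as the side
  -- decreases.
  ifᵉ (kᵉ +ᵉ #prefix ‼ pairᵉ (ivar #a) (ivar #b +ᵉ smaller) +ᵉ #prefix ‼ pairᵉ (ivar #a +ᵉ smaller) (ivar #b)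
        ≤ᵉ #prefix ‼ pairᵉ (ivar #a +ᵉ smaller) (ivar #b +ᵉ smaller) +ᵉ #prefix ‼ pairᵉ (ivar #a) (ivar #b))
    (#side := smaller ⨟ #A := ivar #a ⨟ #B := ivar #b)
    (ifᵉ (lit 1 +ᵉ ivar #b ≤ᵉ last)
      (#b := lit 1 +ᵉ ivar #b)
      (#a := lit 1 +ᵉ ivar #a ⨟ #b := lit 0))
search =
  #a := lit 0 ⨟ #b := lit 0 ⨟ #A := lit 0 ⨟ #B := lit 0 ⨟ #side := lit 1 +ᵉ last ⨟
  whileᵉ (ivar #a ≤ᵉ last) searchStep

grid : Com
grid =
  %w :=ʳ rvar %d /ʳ castᵉ (ivar #M) ⨟
  %ox :=ʳ rvar %vx -ʳ (rvar %d +ʳ rvar %d) ⨟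
  %oy :=ʳ rvar %vy -ʳ (rvar %d +ʳ rvar %d) ⨟
  clearCells ⨟ bucket ⨟ prefixSums ⨟ search ⨟
  %left :=ʳ rvar %ox +ʳ castᵉ (ivar #A) *ʳ rvar %w ⨟
  %bottom :=ʳ rvar %oy +ʳ castᵉ (ivar #B) *ʳ rvar %w ⨟
  %side :=ʳ castᵉ (ivar #side) *ʳ rvar %w

residue : ℕ → IE
residue j = (lit 1 +ᵉ ivar j) *ᵉ kᵉ -ᵉ lit 1

improve candidate pairStep innerStep outerStep approximation : Com
improve =
  ifᵉ (lit 1 ≤ᵉ ivar #have andᵉ rvar %best-side ≤ʳᵉ rvar %side)
    (keepⁱ #have)
    (#have := lit 1 ⨟
     %best-left :=ʳ rvar %left ⨟
     %best-bottom :=ʳ rvar %bottom ⨟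
     %best-side :=ʳ rvar %side)
candidate =
  -- In this case at least k points coincide with the centre, and the grid would have width 0.
  ifᵉ (rvar %d ≤ʳᵉ castᵉ (lit 0))
    (%left :=ʳ rvar %vx ⨟ %bottom :=ʳ rvar %vy ⨟ %side :=ʳ castᵉ (lit 0))
    grid
pairStep =
  -- Selection overwrites `%values`, so each pick reloads it from the input. Repeating the first
  -- pick for every pair costs only a factor depending on c.
  pick load-x (residue #jx) ⨟ %vx :=ʳ rvar %result ⨟
  pick load-y (residue #jy) ⨟ %vy :=ʳ rvar %result ⨟
  pick load-distance (kᵉ -ᵉ lit 1) ⨟ %d :=ʳ rvar %result ⨟
  candidate ⨟ improve
innerStep = pairStep ⨟ #jy := lit 1 +ᵉ ivar #jy
outerStep =
  #jy := lit 0 ⨟ whileᵉ ((lit 1 +ᵉ ivar #jy) *ᵉ kᵉ ≤ᵉ nᵉ) innerStep ⨟ #jx := lit 1 +ᵉ ivar #jx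
approximation =
  #have := lit 0 ⨟
  -- The added 1 gives both M ≥ 2 / ε and M ≥ 1, so that division by M is safe.
  #M := lit 1 +ᵉ floorᵉ (castᵉ (lit 2) /ʳ εᵉ) ⨟
  #jx := lit 0 ⨟
  whileᵉ ((lit 1 +ᵉ ivar #jx) *ᵉ kᵉ ≤ᵉ nᵉ) outerStep

-- Prefix-sum bookkeeping and time totals

count-none : ∀ P n → (∀ i → P i ≡ false) → count P n ≡ 0
count-none P zero h = refl
count-none P (suc n) h rewrite h n = count-none P n h

before-suc : ∀ c u → (does (c ℕ.<? suc u) ≡ does (c ℕ.<? u) × does (c ℕ.≟ u) ≡ false)
                   ⊎ (does (c ℕ.<? suc u) ≡ true × does (c ℕ.<? u) ≡ false × does (c ℕ.≟ u) ≡ true)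
before-suc c u with ℕ.<-cmp c u
... | tri< p q _ = inj₁ (trans (dec-true (c ℕ.<? suc u) (ℕ.m<n⇒m<1+n p)) (sym (dec-true (c ℕ.<? u) p)) , dec-false (c ℕ.≟ u) q)
... | tri≈ p q _ = inj₂ (dec-true (c ℕ.<? suc u) (s≤s (ℕ.≤-reflexive q)) , dec-false (c ℕ.<? u) p , dec-true (c ℕ.≟ u) q)
... | tri> p q r = inj₁ (trans (dec-false (c ℕ.<? suc u) (λ { (s≤s h) → ℕ.<⇒≱ r h })) (sym (dec-false (c ℕ.<? u) p)) , dec-false (c ℕ.≟ u) q)

bit-before : ∀ g x c u → bit (g ∧ does (c ℕ.<? suc u) ∧ x) ≡ bit (g ∧ does (c ℕ.<? u) ∧ x) ℕ.+ bit (g ∧ does (c ℕ.≟ u) ∧ x)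
bit-before false x c u = refl
bit-before true x c u with before-suc c u
... | inj₁ (p , q) rewrite p | q = sym (ℕ.+-identityʳ _)
... | inj₂ (p , q , r) rewrite p | q | r = refl

read-same : ∀ (f : ℕ → ℕ) {x y u v} c → x ≡ u → y ≡ v → update f (pair x y) c (pair u v) ≡ c
read-same f c refl refl = update-here f _ c

read-other : ∀ (f : ℕ → ℕ) {x y u v} c u′ v′ → x ≡ u → y ≡ v → ¬ (u ≡ u′ × v ≡ v′) → update f (pair x y) c (pair u′ v′) ≡ f (pair u′ v′)
read-other f {u = u} {v} c u′ v′ refl refl away = update-there f _ c (λ e → away (pair-injective u v u′ v′ e))

grid-time : ℕ → ℕ → ℕ
grid-time n M = 3 ℕ.+ (2 ℕ.+ L ℕ.* (2 ℕ.+ (2 ℕ.+ L ℕ.* 3)) ℕ.+ (2 ℕ.+ n ℕ.* 6 ℕ.+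
                (2 ℕ.+ L ℕ.* 3 ℕ.+ (2 ℕ.+ L ℕ.* (2 ℕ.+ (3 ℕ.+ L ℕ.* 4))) ℕ.+
                (6 ℕ.+ (suc (4 ℕ.* M) ℕ.* suc (4 ℕ.* M) ℕ.+ suc (4 ℕ.* M)) ℕ.* 5 ℕ.+ 3))))
  where
  L : ℕ
  L = 2 ℕ.+ 8 ℕ.* M

pick-time : ℕ → ℕ → ℕ
pick-time n B = 2 ℕ.+ n ℕ.* (2 ℕ.+ (B ℕ.+ 1)) ℕ.+ (3 ℕ.+ 5400 ℕ.* n)

pair-time : ℕ → ℕ → ℕ
pair-time n M = pick-time n 1 ℕ.+ suc (pick-time n 1 ℕ.+ suc (pick-time n 10 ℕ.+ suc (suc (grid-time n M) ℕ.+ 5)))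

total-time : ℕ → ℕ → ℕ → ℕ
total-time c n M = 3 ℕ.+ suc (c ℕ.* suc (1 ℕ.+ (suc (c ℕ.* suc (pair-time n M ℕ.+ 1)) ℕ.+ 1)))

-- The three selections alone contribute 16200 n; 20000 is a round number that covers all remaining
-- coefficients. Writing M as `suc f` lets M² absorb the constant term by a plain polynomial
-- identity.
pair-time-≤ : ∀ n f → pair-time n (suc f) ℕ.≤ 20000 ℕ.* (n ℕ.+ suc f ℕ.* suc f)
pair-time-≤ n f = linear (3773 ℕ.* n ℕ.+ (19472 ℕ.* (f ℕ.* f) ℕ.+ (38564 ℕ.* f ℕ.+ 18986))) (z≤n {0}) (expand n f)
  where
  expand : ∀ n f →
    2 ℕ.+ n ℕ.* 4 ℕ.+ (3 ℕ.+ 5400 ℕ.* n) ℕ.+ suc (2 ℕ.+ n ℕ.* 4 ℕ.+ (3 ℕ.+ 5400 ℕ.* n) ℕ.+ suc (2 ℕ.+ n ℕ.* 13 ℕ.+ (3 ℕ.+ 5400 ℕ.* n) ℕ.+ suc (suc (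
      3 ℕ.+ (2 ℕ.+ (2 ℕ.+ 8 ℕ.* suc f) ℕ.* (2 ℕ.+ (2 ℕ.+ (2 ℕ.+ 8 ℕ.* suc f) ℕ.* 3)) ℕ.+ (2 ℕ.+ n ℕ.* 6 ℕ.+
        (2 ℕ.+ (2 ℕ.+ 8 ℕ.* suc f) ℕ.* 3 ℕ.+ (2 ℕ.+ (2 ℕ.+ 8 ℕ.* suc f) ℕ.* (2 ℕ.+ (3 ℕ.+ (2 ℕ.+ 8 ℕ.* suc f) ℕ.* 4))) ℕ.+
        (6 ℕ.+ (suc (4 ℕ.* suc f) ℕ.* suc (4 ℕ.* suc f) ℕ.+ suc (4 ℕ.* suc f)) ℕ.* 5 ℕ.+ 3))))) ℕ.+ 5)))
      ℕ.+ 0 ℕ.+ (3773 ℕ.* n ℕ.+ (19472 ℕ.* (f ℕ.* f) ℕ.+ (38564 ℕ.* f ℕ.+ 18986)))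
    ≡ 20000 ℕ.* (n ℕ.+ suc f ℕ.* suc f) ℕ.+ 0
  expand n f = solve (n ∷ f ∷ [])

total-factor : ℕ → ℕ
total-factor c = 4 ℕ.+ 4 ℕ.* c ℕ.+ 2 ℕ.* (c ℕ.* c) ℕ.+ 20000 ℕ.* (c ℕ.* c)

total-time-≤ : ∀ c n f → 1 ℕ.≤ n → total-time c n (suc f) ℕ.≤ total-factor c ℕ.* (n ℕ.+ suc f ℕ.* suc f)
total-time-≤ c n f 1≤n = go (pair-time n (suc f)) (n ℕ.+ suc f ℕ.* suc f) (pair-time-≤ n f) (ℕ.≤-trans 1≤n (ℕ.m≤m+n n _))
  where
  expand : ∀ p q → 3 ℕ.+ suc (c ℕ.* suc (1 ℕ.+ (suc (c ℕ.* suc (p ℕ.+ 1)) ℕ.+ 1)))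
      ℕ.+ ((4 ℕ.+ 4 ℕ.* c ℕ.+ 2 ℕ.* (c ℕ.* c)) ℕ.* q ℕ.+ c ℕ.* c ℕ.* (20000 ℕ.* q)) ℕ.+ 0
    ≡ (4 ℕ.+ 4 ℕ.* c ℕ.+ 2 ℕ.* (c ℕ.* c) ℕ.+ 20000 ℕ.* (c ℕ.* c)) ℕ.* q
      ℕ.+ ((4 ℕ.+ 4 ℕ.* c ℕ.+ 2 ℕ.* (c ℕ.* c)) ℕ.* 1 ℕ.+ c ℕ.* c ℕ.* p)
  expand p q = solve (c ∷ p ∷ q ∷ [])
  go : ∀ p q → p ℕ.≤ 20000 ℕ.* q → 1 ℕ.≤ q →
       3 ℕ.+ suc (c ℕ.* suc (1 ℕ.+ (suc (c ℕ.* suc (p ℕ.+ 1)) ℕ.+ 1))) ℕ.≤ total-factor c ℕ.* q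
  go p q p≤ 1≤q = linear 0 (ℕ.*-monoʳ-≤ (4 ℕ.+ 4 ℕ.* c ℕ.+ 2 ℕ.* (c ℕ.* c)) 1≤q +≤ ℕ.*-monoʳ-≤ (c ℕ.* c) p≤) (expand p q)

-- Correctness of the approximation program

module Approximation (ℝ : CompleteOrderedField) (E : Env (CompleteOrderedField.Carrier ℝ)) (1≤k : 1 ℕ.≤ Env.k E) where
  open CompleteOrderedField ℝ renaming (floor to floorᴿ)
  open Ranks ℝ using (le; lt; le-intro; le-elim; le-false; lt-intro; lt-elim; countLe; countLt; HasRank; hasRank; below; upto; HasRank-cong)
  open Arrays ℝ E select
  open Selection ℝ E using (select-spec; module Selected)
  open Env E
  open Geometric ℝ n k 1≤k X Y

  pick-spec : ∀ {load r σ} B f ρ → changesⁱ #p load ≡ false → changesʳ %values load ≡ false → ρ ℕ.< n →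
              (∀ {τ} → Frame (fillStep load ⨟ #p := lit 1 +ᵉ ivar #p) σ τ → ∀ {j} → I τ #p 0 ≡ j → j ℕ.< n → Triple load τ B (λ υ → R υ %t 0 ≡ f j)) →
              (∀ {τ} → Frame (forᵉ #p nᵉ (fillStep load)) σ τ → evalⁱ r (setⁱ (setⁱ τ #base 0 0) #size 0 n) ≡ ρ) →
              Triple (pick load r) σ (2 ℕ.+ n ℕ.* (2 ℕ.+ (B ℕ.+ 1)) ℕ.+ (3 ℕ.+ 5400 ℕ.* n)) (λ τ → HasRank f n ρ (R τ %result 0))
  pick-spec {load} {r} {σ} B f ρ free kept ρ<n loads ranked =
      for n (B ℕ.+ 1) Inv free′ (λ ()) (λ _ _ _ _ → refl) step ▹ λ {τ} fr filled →
      intₜ intₜ intₜ weaken ℕ.≤-refl (select-spec n refl (subst (ℕ._< n) (sym (ranked fr)) ρ<n)) λ {υ} _ sel →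
        HasRank-cong (λ i<n → filled i<n) (subst (λ m → HasRank (R τ %values) n m (R υ %result 0)) (ranked fr) (Selected.result sel))
    where
    free′ : changesⁱ #p (fillStep load) ≡ false
    free′ rewrite free = refl
    Inv : ℕ → Store → Set
    Inv j τ = ∀ {i} → i ℕ.< j → R τ %values i ≡ f i
    step : ∀ {j τ} → Frame (fillStep load ⨟ #p := lit 1 +ᵉ ivar #p) σ τ → I τ #p 0 ≡ j → j ℕ.< n → Inv j τ →
           Triple (fillStep load) τ (B ℕ.+ 1) (Next #p Inv j)
    step {j} {τ} fr pj j<n inv = loads fr pj j<n ▹ λ {τ′} fr′ t≡ → real-last (λ {i} → filled fr′ t≡ {i})
      where
      filled : ∀ {τ′} → Frame load τ τ′ → R τ′ %t 0 ≡ f j → ∀ {i} → i ℕ.< suc j →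
               update (R τ′ %values) (I τ′ #p 0) (R τ′ %t 0) i ≡ f i
      filled {τ′} fr′ t≡ {i} (s≤s i≤j) with ≤-split i≤j
      ... | inj₁ i<j = trans (update-there (R τ′ %values) _ _ (λ e → ℕ.<⇒≢ i<j (trans (sym e) p≡)))
                             (trans (cong-app (realᶠ fr′ %values kept) i) (inv i<j))
        where
        p≡ : I τ′ #p 0 ≡ j
        p≡ = trans (int₀ fr′ #p free) pj
      ... | inj₂ refl = trans (cong (λ x → update (R τ′ %values) x (R τ′ %t 0) i) (trans (int₀ fr′ #p free) pj))
                              (trans (update-here (R τ′ %values) i _) t≡)

  load-x-spec : ∀ {τ j} → I τ #p 0 ≡ j → j ℕ.< n → Triple load-x τ 1 (λ υ → R υ %t 0 ≡ X j)
  load-x-spec refl j<n = real-last (cong X (clamp-id j<n))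

  load-y-spec : ∀ {τ j} → I τ #p 0 ≡ j → j ℕ.< n → Triple load-y τ 1 (λ υ → R υ %t 0 ≡ Y j)
  load-y-spec refl j<n = real-last (cong Y (clamp-id j<n))

  raise-spec : ∀ {e τ x y} → R τ %t 0 ≡ x → evalʳ e τ ≡ y → Triple (raise e) τ 3 (λ υ → R υ %t 0 ≡ x ⊔ y)
  raise-spec {e} {τ} refl refl = realₜ branch
    (λ h → real-last (sym (cong (λ b → if b then evalʳ e τ else R τ %t 0) h)))
    (λ h → real-last (sym (cong (λ b → if b then evalʳ e τ else R τ %t 0) h)))

  load-distance-spec : ∀ {τ j vx vy} → R τ %vx 0 ≡ vx → R τ %vy 0 ≡ vy → I τ #p 0 ≡ j → j ℕ.< n →
                       Triple load-distance τ 10 (λ υ → R υ %t 0 ≡ distance vx vy j)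
  load-distance-spec {τ} {j} refl refl pj j<n =
      realₜ raise-spec (cong (λ z → z - R τ %vx 0) x≡) (cong (λ z → R τ %vx 0 - z) x≡) ▹ λ fr t≡ →
      raise-spec t≡ (cong₂ _-_ (trans (cong Y (cong (clamp n) (int₀ fr #p refl))) y≡) (real₀ fr %vy refl)) ▹ λ fr′ t≡ →
      raise-spec t≡ (cong₂ _-_ (trans (real₀ fr′ %vy refl) (real₀ fr %vy refl))
                               (trans (cong Y (cong (clamp n) (trans (int₀ fr′ #p refl) (int₀ fr #p refl)))) y≡))
    where
    x≡ : X (clamp n (I τ #p 0)) ≡ X j
    x≡ = cong X (trans (cong (clamp n) pj) (clamp-id j<n))
    y≡ : Y (clamp n (I τ #p 0)) ≡ Y j
    y≡ = cong Y (trans (cong (clamp n) pj) (clamp-id j<n))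

  module GridSpec (vx vy d w : Carrier) (M : ℕ) (d>0 : Field.Positive ℝ d)
                  (Mw≈d : fromℕ M * w ≈ d) (w>0 : Field.Positive ℝ w) where
    open Centre vx vy
    open Grid d w M d>0 Mw≈d w>0

    L : ℕ
    L = 2 ℕ.+ 8 ℕ.* M

    width≡ : ∀ {m} → m ≡ M → 2 ℕ.+ 8 ℕ.* m ≡ L
    width≡ refl = refl

    clear-spec : ∀ {σ} → I σ #M 0 ≡ M →
                 Triple clearCells σ (2 ℕ.+ L ℕ.* (2 ℕ.+ (2 ℕ.+ L ℕ.* 3))) (λ τ → ∀ {u v} → u ℕ.< L → v ℕ.< L → I τ #cells (pair u v) ≡ 0)
    clear-spec {σ} M≡ = for L (2 ℕ.+ L ℕ.* 3) Outer refl (λ ())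
        (λ fr _ _ _ → width≡ (trans (int₀ fr #M refl) M≡)) outer
      where
      Outer : ℕ → Store → Set
      Outer x τ = ∀ {u v} → u ℕ.< x → v ℕ.< L → I τ #cells (pair u v) ≡ 0
      outer : ∀ {x τ} → Frame (forᵉ #v width clearStep ⨟ #u := lit 1 +ᵉ ivar #u) σ τ → I τ #u 0 ≡ x → x ℕ.< L → Outer x τ →
              Triple (forᵉ #v width clearStep) τ (2 ℕ.+ L ℕ.* 3) (Next #u Outer x)
      outer {x} {τ} fr x≡ _ done = weaken ℕ.≤-refl (for L 1 Inner refl (done , λ ())
          (λ fr′ _ _ _ → width≡ (trans (int₀ fr′ #M refl) (trans (int₀ fr #M refl) M≡))) inner) finish
        where
        Inner : ℕ → Store → Set
        Inner y υ = (∀ {u v} → u ℕ.< x → v ℕ.< L → I υ #cells (pair u v) ≡ 0) × (∀ {v} → v ℕ.< y → I υ #cells (pair x v) ≡ 0)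
        finish : ∀ {υ} → Frame (forᵉ #v width clearStep) τ υ → Inner L υ → Next #u Outer x υ
        finish _ (old , new) {u} (s≤s u≤x) v<L with ≤-split u≤x
        ... | inj₁ u<x = old u<x v<L
        ... | inj₂ refl = new v<L
        inner : ∀ {y υ} → Frame (clearStep ⨟ #v := lit 1 +ᵉ ivar #v) τ υ → I υ #v 0 ≡ y → y ℕ.< L → Inner y υ →
                Triple clearStep υ 1 (Next #v Inner y)
        inner {y} {υ} fr′ y≡ _ (old , new) = int-last
          ( (λ {u} {v} u<x v<L → trans (read-other (I υ #cells) 0 u v ux y≡ (λ { (refl , _) → ℕ.<-irrefl refl u<x })) (old u<x v<L))
          , λ {v} v≤y → fill v≤y)
          where
          ux : I υ #u 0 ≡ x
          ux = trans (int₀ fr′ #u refl) x≡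
          fill : ∀ {v} → v ℕ.< suc y → update (I υ #cells) (pair (I υ #u 0) (I υ #v 0)) 0 (pair x v) ≡ 0
          fill {v} (s≤s v≤y) with ≤-split v≤y
          ... | inj₁ v<y = trans (read-other (I υ #cells) 0 x v ux y≡ (λ { (_ , refl) → ℕ.<-irrefl refl v<y })) (new v<y)
          ... | inj₂ refl = read-same (I υ #cells) 0 ux y≡

    hit : ℕ → ℕ → ℕ → Bool
    hit u v i = visible i ∧ does (column i ℕ.≟ u) ∧ does (row i ℕ.≟ v)

    record Ready (σ : Store) : Set where
      field
        M≡  : I σ #M 0 ≡ M
        w≡  : R σ %w 0 ≡ w
        ox≡ : R σ %ox 0 ≡ corner vx
        oy≡ : R σ %oy 0 ≡ corner vy

    bucket-spec : ∀ {σ} → Ready σ → (∀ {u v} → u ℕ.< L → v ℕ.< L → I σ #cells (pair u v) ≡ 0) →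
                  Triple bucket σ (2 ℕ.+ n ℕ.* 6) (λ τ → ∀ {u v} → u ℕ.< L → v ℕ.< L → I τ #cells (pair u v) ≡ count (hit u v) n)
    bucket-spec {σ} ready zeros = for n 4 Inv refl zeros (λ _ _ _ _ → refl) step
      where
      open Ready ready
      Inv : ℕ → Store → Set
      Inv j τ = ∀ {u v} → u ℕ.< L → v ℕ.< L → I τ #cells (pair u v) ≡ count (hit u v) j
      step : ∀ {j τ} → Frame (bucketStep ⨟ #p := lit 1 +ᵉ ivar #p) σ τ → I τ #p 0 ≡ j → j ℕ.< n → Inv j τ →
             Triple bucketStep τ 4 (Next #p Inv j)
      step {j} {τ} fr p≡ j<n inv = intₜ intₜ branch
          (λ h → int-last (λ {u} {v} u<L v<L → present (trans (sym seen) h) u<L v<L))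
          (λ h → int-last (λ {u} {v} u<L v<L → count-miss (hit u v) (cong (λ b → b ∧ does (column j ℕ.≟ u) ∧ does (row j ℕ.≟ v)) (trans (sym seen) h)) (inv u<L v<L)))
        where
        x≡ : X (clamp n (I τ #p 0)) ≡ X j
        x≡ = cong X (trans (cong (clamp n) p≡) (clamp-id j<n))
        y≡ : Y (clamp n (I τ #p 0)) ≡ Y j
        y≡ = cong Y (trans (cong (clamp n) p≡) (clamp-id j<n))
        w′ : R τ %w 0 ≡ w
        w′ = trans (real₀ fr %w refl) w≡
        ox′ : R τ %ox 0 ≡ corner vx
        ox′ = trans (real₀ fr %ox refl) ox≡
        oy′ : R τ %oy 0 ≡ corner vy
        oy′ = trans (real₀ fr %oy refl) oy≡
        cx cy : ℕ
        cx = floorᴿ ((X (clamp n (I τ #p 0)) - R τ %ox 0) / R τ %w 0)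
        cy = floorᴿ ((Y (clamp n (I τ #p 0)) - R τ %oy 0) / R τ %w 0)
        cx≡ : cx ≡ column j
        cx≡ = cong floorᴿ (cong₂ _/_ (cong₂ _-_ x≡ ox′) w′)
        cy≡ : cy ≡ row j
        cy≡ = cong floorᴿ (cong₂ _/_ (cong₂ _-_ y≡ oy′) w′)
        seen : le (R τ %ox 0) (X (clamp n (I τ #p 0))) ∧ le (R τ %oy 0) (Y (clamp n (I τ #p 0))) ∧
               does (cx ℕ.≤? 4 ℕ.* I τ #M 0) ∧ does (cy ℕ.≤? 4 ℕ.* I τ #M 0) ≡ visible j
        seen = trans
          (cong₂ _∧_ (cong₂ le ox′ x≡) (cong₂ _∧_ (cong₂ le oy′ y≡)
            (cong₂ (λ c r → does (c ℕ.≤? 4 ℕ.* I τ #M 0) ∧ does (r ℕ.≤? 4 ℕ.* I τ #M 0)) cx≡ cy≡)))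
          (cong (λ m → le (corner vx) (X j) ∧ le (corner vy) (Y j) ∧ does (column j ℕ.≤? 4 ℕ.* m) ∧ does (row j ℕ.≤? 4 ℕ.* m))
                (trans (int₀ fr #M refl) M≡))
        present : visible j ≡ true → ∀ {u v} → u ℕ.< L → v ℕ.< L →
                  update (I τ #cells) (pair cx cy) (suc (I τ #cells (pair cx cy))) (pair u v) ≡ count (hit u v) (suc j)
        present vis {u} {v} u<L v<L with column j ℕ.≟ u | row j ℕ.≟ v
        ... | yes refl | yes refl = trans (read-same (I τ #cells) _ cx≡ cy≡)
              (count-hit (hit (column j) (row j)) (∧-intro vis (∧-intro (dec-true (column j ℕ.≟ column j) refl) (dec-true (row j ℕ.≟ row j) refl)))
                (trans (cong₂ (λ x y → I τ #cells (pair x y)) cx≡ cy≡) (inv u<L v<L)))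
        ... | no c≢u | _ = trans (read-other (I τ #cells) _ u v cx≡ cy≡ (λ { (e , _) → c≢u e }))
              (count-miss (hit u v) (trans (cong (λ b → visible j ∧ b ∧ does (row j ℕ.≟ v)) (dec-false (column j ℕ.≟ u) c≢u)) (∧-zeroʳ (visible j))) (inv u<L v<L))
        ... | yes c≡u | no r≢v = trans (read-other (I τ #cells) _ u v cx≡ cy≡ (λ { (_ , e) → r≢v e }))
              (count-miss (hit u v) (trans (cong₂ (λ b c → visible j ∧ b ∧ c) (dec-true (column j ℕ.≟ u) c≡u) (dec-false (row j ℕ.≟ v) r≢v)) (∧-zeroʳ (visible j))) (inv u<L v<L))

    rowCount : ℕ → ℕ → ℕ
    rowCount u v = count (λ i → visible i ∧ does (column i ℕ.≟ u) ∧ before (row i) v) n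

    prefix-zero : ∀ v → prefix 0 v ≡ 0
    prefix-zero v = count-none _ n (λ i → ∧-zeroʳ (visible i))

    prefix-suc : ∀ u v → prefix (suc u) v ≡ prefix u v ℕ.+ rowCount u v
    prefix-suc u v = count-sum _ _ _ (λ i → bit-before (visible i) (before (row i) v) (column i) u) n

    rowCount-zero : ∀ u → rowCount u 0 ≡ 0
    rowCount-zero u = count-none _ n (λ i → trans (cong (visible i ∧_) (∧-zeroʳ (does (column i ℕ.≟ u)))) (∧-zeroʳ (visible i)))

    rowCount-suc : ∀ u v → rowCount u (suc v) ≡ rowCount u v ℕ.+ count (hit u v) n
    rowCount-suc u v = count-sum _ _ _ (λ i → shuffle (visible i) (does (column i ℕ.≟ u)) (row i)) n
      where
      shuffle : ∀ g e c → bit (g ∧ e ∧ before c (suc v)) ≡ bit (g ∧ e ∧ before c v) ℕ.+ bit (g ∧ e ∧ does (c ℕ.≟ v))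
      shuffle false e c = refl
      shuffle true false c = refl
      shuffle true true c with before-suc c v
      ... | inj₁ (p , q) rewrite p | q = sym (ℕ.+-identityʳ _)
      ... | inj₂ (p , q , r) rewrite p | q | r = refl

    prefix-spec : ∀ {σ} → I σ #M 0 ≡ M → (∀ {u v} → u ℕ.< L → v ℕ.< L → I σ #cells (pair u v) ≡ count (hit u v) n) →
                  Triple prefixSums σ (2 ℕ.+ L ℕ.* 3 ℕ.+ (2 ℕ.+ L ℕ.* (2 ℕ.+ (3 ℕ.+ L ℕ.* 4))))
                    (λ τ → ∀ {u v} → u ℕ.≤ L → v ℕ.< L → I τ #prefix (pair u v) ≡ prefix u v)
    prefix-spec {σ} M≡ counted =
        for L 1 First refl (λ ()) (λ fr _ _ _ → width≡ (trans (int₀ fr #M refl) M≡)) first ▹ λ {τ} fr zeros →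
        let M′ = trans (int₀ fr #M refl) M≡ in
        for L (3 ℕ.+ L ℕ.* 4) Outer refl (λ { {v = v} z≤n v<L → trans (zeros v<L) (sym (prefix-zero v)) })
          (λ fr′ _ _ _ → width≡ (trans (int₀ fr′ #M refl) M′))
          (λ fr′ → outer (trans (int₀ fr′ #M refl) M′)
                         (λ u<L v<L → trans (cong-app (trans (intᶠ fr′ #cells refl) (intᶠ fr #cells refl)) _) (counted u<L v<L)))
      where
      First : ℕ → Store → Set
      First y τ = ∀ {v} → v ℕ.< y → I τ #prefix (pair 0 v) ≡ 0
      first : ∀ {y τ} → Frame (clearPrefix ⨟ #v := lit 1 +ᵉ ivar #v) σ τ → I τ #v 0 ≡ y → y ℕ.< L → First y τ →
              Triple clearPrefix τ 1 (Next #v First y)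
      first {y} {τ} fr y≡ _ done = int-last (λ {v} v≤y → fill v≤y)
        where
        fill : ∀ {v} → v ℕ.< suc y → update (I τ #prefix) (pair 0 (I τ #v 0)) 0 (pair 0 v) ≡ 0
        fill {v} (s≤s v≤y) with ≤-split v≤y
        ... | inj₁ v<y = trans (read-other (I τ #prefix) {x = 0} 0 0 v refl y≡ (λ { (_ , refl) → ℕ.<-irrefl refl v<y })) (done v<y)
        ... | inj₂ refl = read-same (I τ #prefix) {x = 0} 0 refl y≡

      Outer : ℕ → Store → Set
      Outer x τ = ∀ {u v} → u ℕ.≤ x → v ℕ.< L → I τ #prefix (pair u v) ≡ prefix u v
      outer : ∀ {x τ} → I τ #M 0 ≡ M → (∀ {u v} → u ℕ.< L → v ℕ.< L → I τ #cells (pair u v) ≡ count (hit u v) n) →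
              I τ #u 0 ≡ x → x ℕ.< L → Outer x τ →
              Triple prefixRow τ (3 ℕ.+ L ℕ.* 4) (Next #u Outer x)
      outer {x} {τ} M′ cells x≡ x<L done = intₜ weaken ℕ.≤-refl
          (for L 2 Inner refl (done , (λ ()) , sym (rowCount-zero x)) (λ fr _ _ _ → width≡ (trans (int₀ fr #M refl) M′)) inner)
          finish
        where
        Inner : ℕ → Store → Set
        Inner y υ = (∀ {u v} → u ℕ.≤ x → v ℕ.< L → I υ #prefix (pair u v) ≡ prefix u v) ×
                    (∀ {v} → v ℕ.< y → I υ #prefix (pair (suc x) v) ≡ prefix (suc x) v) ×
                    I υ #acc 0 ≡ rowCount x y
        finish : ∀ {υ} → Frame (forᵉ #v width prefixStep) (setⁱ τ #acc 0 0) υ → Inner L υ → Next #u Outer x υ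
        finish _ (old , new , _) {u} u≤ v<L with ≤-split u≤
        ... | inj₁ (s≤s u≤x) = old u≤x v<L
        ... | inj₂ refl = new v<L
        inner : ∀ {y υ} → Frame (prefixStep ⨟ #v := lit 1 +ᵉ ivar #v) (setⁱ τ #acc 0 0) υ → I υ #v 0 ≡ y → y ℕ.< L → Inner y υ →
                Triple prefixStep υ 2 (Next #v Inner y)
        inner {y} {υ} fr y≡ y<L (old , new , acc≡) = intₜ int-last
          ( (λ {u} {v} u≤x v<L → trans (read-other (I υ #prefix) _ u v sux y≡ (λ { (refl , _) → ℕ.<-irrefl refl u≤x })) (old u≤x v<L))
          , (λ {v} v≤y → fill v≤y)
          , trans (cong₂ ℕ._+_ acc≡ (trans (cong₂ (λ a b → I υ #cells (pair a b)) ux y≡)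
                    (trans (cong-app (intᶠ fr #cells refl) _) (cells x<L y<L)))) (sym (rowCount-suc x y)))
          where
          ux : I υ #u 0 ≡ x
          ux = trans (int₀ fr #u refl) x≡
          sux : suc (I υ #u 0) ≡ suc x
          sux = cong suc ux
          value : ℕ
          value = I υ #prefix (pair (I υ #u 0) (I υ #v 0)) ℕ.+ I υ #acc 0
          value≡ : value ≡ prefix (suc x) y
          value≡ = trans (cong₂ ℕ._+_ (trans (cong₂ (λ a b → I υ #prefix (pair a b)) ux y≡) (old ℕ.≤-refl y<L)) acc≡) (sym (prefix-suc x y))
          fill : ∀ {v} → v ℕ.< suc y → update (I υ #prefix) (pair (suc (I υ #u 0)) (I υ #v 0)) value (pair (suc x) v) ≡ prefix (suc x) v
          fill {v} (s≤s v≤y) with ≤-split v≤y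
          ... | inj₁ v<y = trans (read-other (I υ #prefix) value (suc x) v sux y≡ (λ { (_ , refl) → ℕ.<-irrefl refl v<y })) (new v<y)
          ... | inj₂ refl = trans (read-same (I υ #prefix) value sux y≡) value≡

    -- A square of no cells contains no points, whereas k ≥ 1; so the truncated subtraction in
    -- `smaller` is exact.
    side≢0 : ∀ {a b m} → k ℕ.≤ rect a b m → suc (m ℕ.∸ 1) ≡ m
    side≢0 {a} {b} {zero} h = ⊥-elim (ℕ.<⇒≱ (rect-zero a b) (ℕ.≤-trans 1≤k h))
    side≢0 {m = suc m} h = refl

    -- Every corner already left behind fails for the next smaller side, and continues to fail by
    -- `rect-mono` when the side decreases. Each iteration either advances the corner or decreases
    -- the side by one, so `measure` expresses the iteration number i by the progress made, and i
    -- stays below `search-bound`.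
    record Searching (i : ℕ) (τ : Store) : Set where
      field
        a≤      : I τ #a 0 ℕ.≤ suc (4 ℕ.* M)
        b≤      : I τ #b 0 ℕ.≤ 4 ℕ.* M
        side≤   : I τ #side 0 ℕ.≤ suc (4 ℕ.* M)
        found   : k ℕ.≤ rect (I τ #A 0) (I τ #B 0) (I τ #side 0)
        visited : ∀ {a b} → a ℕ.< I τ #a 0 ⊎ (a ≡ I τ #a 0 × b ℕ.< I τ #b 0) → b ℕ.≤ 4 ℕ.* M → rect a b (I τ #side 0 ℕ.∸ 1) ℕ.< k
        measure : I τ #a 0 ℕ.* suc (4 ℕ.* M) ℕ.+ I τ #b 0 ℕ.+ suc (4 ℕ.* M) ≡ i ℕ.+ I τ #side 0

    search-bound : ℕ
    search-bound = suc (4 ℕ.* M) ℕ.* suc (4 ℕ.* M) ℕ.+ suc (4 ℕ.* M)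

    search-spec : ∀ {σ} → I σ #M 0 ≡ M → (∀ {u v} → u ℕ.≤ L → v ℕ.< L → I σ #prefix (pair u v) ≡ prefix u v) →
                  k ℕ.≤ rect 0 0 (suc (4 ℕ.* M)) →
                  Triple search σ (6 ℕ.+ search-bound ℕ.* 5) (λ τ → k ℕ.≤ rect (I τ #A 0) (I τ #B 0) (I τ #side 0) ×
                    (∀ {a b} → a ℕ.≤ 4 ℕ.* M → b ℕ.≤ 4 ℕ.* M → rect a b (I τ #side 0 ℕ.∸ 1) ℕ.< k))
    search-spec {σ} M≡ sums whole = intₜ intₜ intₜ intₜ intₜ weaken ℕ.≤-refl
        (loop search-bound 4 Searching start z≤n step)
        (λ {τ} fr → λ { (i , inv , _ , stop) → let open Searching inv in found , λ {a} {b} a≤4M b≤ → visited (inj₁ (ℕ.≤-<-trans a≤4M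
          (subst (λ m → 4 ℕ.* m ℕ.< I τ #a 0) (trans (int₀ fr #M refl) M≡) (ℕ.≰⇒> (does-false (_ ℕ.≤? _) stop))))) b≤ })
      where
      start : Searching 0 (setⁱ (setⁱ (setⁱ (setⁱ (setⁱ σ #a 0 0) #b 0 0) #A 0 0) #B 0 0) #side 0 (suc (4 ℕ.* I σ #M 0)))
      start rewrite M≡ = record { a≤ = z≤n ; b≤ = z≤n ; side≤ = ℕ.≤-refl ; found = whole ; visited = λ { (inj₁ ()) ; (inj₂ (_ , ())) } ; measure = refl }
      step : ∀ {i τ} → Frame searchStep (setⁱ (setⁱ (setⁱ (setⁱ (setⁱ σ #a 0 0) #b 0 0) #A 0 0) #B 0 0) #side 0 (suc (4 ℕ.* I σ #M 0))) τ →
             Searching i τ → evalᵇ (ivar #a ≤ᵉ last) τ ≡ true → i ℕ.< search-bound × Triple searchStep τ 4 (Searching (suc i))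
      step {i} {τ} fr inv go-on = in-bound , branch
          (λ h → intₜ intₜ int-last (record
            { a≤ = a≤ ; b≤ = b≤ ; side≤ = ℕ.≤-trans (ℕ.m∸n≤m m 1) side≤
            ; found = enough h
            ; visited = λ {a₁} {b₁} old b≤ → ℕ.≤-<-trans (rect-mono {a₁} {b₁} (ℕ.m∸n≤m (m ℕ.∸ 1) 1)) (visited old b≤)
            ; measure = trans measure (trans (cong (i ℕ.+_) (sym m≡)) (ℕ.+-suc i (m ℕ.∸ 1))) }))
          (λ h → branch
            (λ h′ → weaken (s≤s z≤n) (int-last {S = Searching (suc i)} (record
              { a≤ = a≤ ; b≤ = subst (λ x → suc b ℕ.≤ 4 ℕ.* x) M′ (does-true (suc b ℕ.≤? 4 ℕ.* I τ #M 0) h′) ; side≤ = side≤ ; found = found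
              ; visited = λ { (inj₁ p) b≤ → visited (inj₁ p) b≤ ; (inj₂ (refl , p)) b≤ → extend h p b≤ }
              ; measure = trans (cong (ℕ._+ suc (4 ℕ.* M)) (ℕ.+-suc _ b)) (cong suc measure) })) (λ _ q → q))
            (λ h′ → intₜ int-last (record
              { a≤ = s≤s a≤4M ; b≤ = z≤n ; side≤ = side≤ ; found = found
              ; visited = λ { (inj₁ (s≤s p)) b≤ → next-column h h′ p b≤ ; (inj₂ (_ , ())) _ }
              ; measure = trans (next-measure a (b≡ h′)) (cong suc measure) })))
        where
        open Searching inv
        a b m : ℕ
        a = I τ #a 0
        b = I τ #b 0
        m = I τ #side 0
        M′ : I τ #M 0 ≡ M
        M′ = trans (int₀ fr #M refl) M≡
        m≡ : suc (m ℕ.∸ 1) ≡ m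
        m≡ = side≢0 {I τ #A 0} {I τ #B 0} found
        m-1≤ : m ℕ.∸ 1 ℕ.≤ 4 ℕ.* M
        m-1≤ = ℕ.s≤s⁻¹ (subst (ℕ._≤ suc (4 ℕ.* M)) (sym m≡) side≤)
        a≤4M : a ℕ.≤ 4 ℕ.* M
        a≤4M = subst (λ x → a ℕ.≤ 4 ℕ.* x) M′ (does-true (a ℕ.≤? 4 ℕ.* I τ #M 0) go-on)
        in-bound : i ℕ.< search-bound
        in-bound = ℕ.≤-<-trans (ℕ.≤-trans (ℕ.m≤m+n i m) (ℕ.≤-reflexive (sym measure)))
          (ℕ.+-monoˡ-< (suc (4 ℕ.* M)) (subst (λ x → a ℕ.* suc (4 ℕ.* M) ℕ.+ b ℕ.< x) (ℕ.+-comm _ (suc (4 ℕ.* M)))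
            (ℕ.+-mono-≤-< (ℕ.*-monoˡ-≤ (suc (4 ℕ.* M)) a≤4M) (s≤s b≤))))
        small : ∀ {x} → x ℕ.≤ 4 ℕ.* M → x ℕ.+ (m ℕ.∸ 1) ℕ.< L
        small x≤ = ℕ.≤-<-trans (x≤ +≤ m-1≤) (linear 1 (z≤n {0}) (size M))
          where
          size : ∀ M → suc (4 ℕ.* M ℕ.+ 4 ℕ.* M) ℕ.+ 0 ℕ.+ 1 ≡ 2 ℕ.+ 8 ℕ.* M ℕ.+ 0
          size M = solve (M ∷ [])
        small′ : ∀ {x} → x ℕ.≤ 4 ℕ.* M → x ℕ.< L
        small′ {x} x≤ = ℕ.≤-<-trans (ℕ.m≤m+n x _) (small x≤)
        sum : ∀ {u v} → u ℕ.≤ L → v ℕ.< L → I τ #prefix (pair u v) ≡ prefix u v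
        sum u≤ v< = trans (cong-app (intᶠ fr #prefix refl) _) (sums u≤ v<)
        -- By `rect-prefix` the right-hand side is the count for the smaller square plus the same
        -- two prefix sums as on the left, which then cancel.
        test≡ : (k ℕ.+ I τ #prefix (pair a (b ℕ.+ (m ℕ.∸ 1))) ℕ.+ I τ #prefix (pair (a ℕ.+ (m ℕ.∸ 1)) b) ℕ.≤
                 I τ #prefix (pair (a ℕ.+ (m ℕ.∸ 1)) (b ℕ.+ (m ℕ.∸ 1))) ℕ.+ I τ #prefix (pair a b))
              ≡ (k ℕ.+ prefix a (b ℕ.+ (m ℕ.∸ 1)) ℕ.+ prefix (a ℕ.+ (m ℕ.∸ 1)) b ℕ.≤
                 rect a b (m ℕ.∸ 1) ℕ.+ prefix a (b ℕ.+ (m ℕ.∸ 1)) ℕ.+ prefix (a ℕ.+ (m ℕ.∸ 1)) b)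
        test≡ = cong₂ ℕ._≤_ (cong₂ (λ x y → k ℕ.+ x ℕ.+ y) (sum (ℕ.<⇒≤ (small′ a≤4M)) (small b≤)) (sum (ℕ.<⇒≤ (small a≤4M)) (small′ b≤)))
          (trans (cong₂ ℕ._+_ (sum (ℕ.<⇒≤ (small a≤4M)) (small b≤)) (sum (ℕ.<⇒≤ (small′ a≤4M)) (small′ b≤))) (sym (rect-prefix a b (m ℕ.∸ 1))))
        Test : Bool
        Test = does (k ℕ.+ I τ #prefix (pair a (b ℕ.+ (m ℕ.∸ 1))) ℕ.+ I τ #prefix (pair (a ℕ.+ (m ℕ.∸ 1)) b) ℕ.≤?
                     I τ #prefix (pair (a ℕ.+ (m ℕ.∸ 1)) (b ℕ.+ (m ℕ.∸ 1))) ℕ.+ I τ #prefix (pair a b))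
        enough : Test ≡ true → k ℕ.≤ rect a b (m ℕ.∸ 1)
        enough h = ℕ.+-cancelʳ-≤ _ k _ (ℕ.+-cancelʳ-≤ _ (k ℕ.+ prefix a (b ℕ.+ (m ℕ.∸ 1))) _ (subst (λ T → T) test≡ (does-true (_ ℕ.≤? _) h)))
        scarce : Test ≡ false → rect a b (m ℕ.∸ 1) ℕ.< k
        scarce h = ℕ.≰⇒> λ p → does-false (_ ℕ.≤? _) h (subst (λ T → T) (sym test≡) (ℕ.+-monoˡ-≤ _ (ℕ.+-monoˡ-≤ _ p)))
        extend : Test ≡ false → ∀ {b′} → b′ ℕ.< suc b → b′ ℕ.≤ 4 ℕ.* M → rect a b′ (m ℕ.∸ 1) ℕ.< k
        extend h (s≤s p) b≤ with ≤-split p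
        ... | inj₁ q = visited (inj₂ (refl , q)) b≤
        ... | inj₂ refl = scarce h
        b≡ : does (suc b ℕ.≤? 4 ℕ.* I τ #M 0) ≡ false → b ≡ 4 ℕ.* M
        b≡ h = ℕ.≤-antisym b≤ (subst (λ x → 4 ℕ.* x ℕ.≤ b) M′ (ℕ.≮⇒≥ (does-false (suc b ℕ.≤? 4 ℕ.* I τ #M 0) h)))
        next-column : Test ≡ false → does (suc b ℕ.≤? 4 ℕ.* I τ #M 0) ≡ false → ∀ {a′ b′} → a′ ℕ.≤ a → b′ ℕ.≤ 4 ℕ.* M → rect a′ b′ (m ℕ.∸ 1) ℕ.< k
        next-column h h′ {a′} {b′} p b′≤ with ≤-split p
        ... | inj₁ q = visited (inj₁ q) b′≤
        ... | inj₂ refl = extend h (s≤s (subst (b′ ℕ.≤_) (sym (b≡ h′)) b′≤)) b′≤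
        next-measure : ∀ a {b} → b ≡ 4 ℕ.* M → suc a ℕ.* suc (4 ℕ.* M) ℕ.+ 0 ℕ.+ suc (4 ℕ.* M) ≡ suc (a ℕ.* suc (4 ℕ.* M) ℕ.+ b ℕ.+ suc (4 ℕ.* M))
        next-measure a refl = identity a M
          where
          identity : ∀ a M → suc a ℕ.* suc (4 ℕ.* M) ℕ.+ 0 ℕ.+ suc (4 ℕ.* M) ≡ suc (a ℕ.* suc (4 ℕ.* M) ℕ.+ 4 ℕ.* M ℕ.+ suc (4 ℕ.* M))
          identity a M = solve (a ∷ M ∷ [])

  open Field ℝ

  record Result (vx vy : Carrier) (τ : Store) : Set where
    field
      valid  : Feasible (R τ %left 0) (R τ %bottom 0) (R τ %side 0)
      approx : ∀ {l b s} → Feasible l b s → Minimal s → l ≤ vx × vx ≤ l + s → b ≤ vy × vy ≤ b + s → R τ %side 0 ≤ (1# + ε) * s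

  module _ (0≤ε : 0# ≤ ε) (M : ℕ) (1≤M : 1 ℕ.≤ M) (2≤εM : fromℕ 2 ≤ ε * fromℕ M) where

    M>0 : Positive (fromℕ M)
    M>0 h = 1≰0 (≤-trans (≤-reflexive (≈-sym (+-identityʳ 1#))) (≤-trans (fromℕ-mono 1≤M) h))

    module _ {vx vy d : Carrier} (rk : HasRank (distance vx vy) n (k ℕ.∸ 1) d) where
      open Centre vx vy

      many : k ℕ.≤ countLe D d n
      many = ℕ.≤-trans (ℕ.≤-reflexive (sym (ℕ.m+[n∸m]≡n 1≤k))) (upto rk)

      grid-spec : ∀ {σ} → R σ %vx 0 ≡ vx → R σ %vy 0 ≡ vy → R σ %d 0 ≡ d → I σ #M 0 ≡ M → Positive d →
                  Triple grid σ (grid-time n M) (Result vx vy)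
      grid-spec {σ} refl refl refl refl d>0 =
          realₜ realₜ realₜ clear-spec refl ▹ λ fr zeros →
          bucket-spec (record
            { M≡ = int₀ fr #M refl ; w≡ = real₀ fr %w refl
            ; ox≡ = real₀ fr %ox refl ; oy≡ = real₀ fr %oy refl }) zeros ▹ λ fr′ counted →
          prefix-spec (cong-app (trans (intᶠ fr′ #M refl) (intᶠ fr #M refl)) 0) counted ▹ λ fr″ sums →
          search-spec (cong-app (trans (intᶠ fr″ #M refl) (trans (intᶠ fr′ #M refl) (intᶠ fr #M refl))) 0) sums (full many) ▹ λ {τ} fr‴ (found , smallest) →
          realₜ realₜ real-last (finish {τ}
            (cong-app (trans (realᶠ fr‴ %w refl) (trans (realᶠ fr″ %w refl) (trans (realᶠ fr′ %w refl) (realᶠ fr %w refl)))) 0)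
            (cong-app (trans (realᶠ fr‴ %ox refl) (trans (realᶠ fr″ %ox refl) (trans (realᶠ fr′ %ox refl) (realᶠ fr %ox refl)))) 0)
            (cong-app (trans (realᶠ fr‴ %oy refl) (trans (realᶠ fr″ %oy refl) (trans (realᶠ fr′ %oy refl) (realᶠ fr %oy refl)))) 0)
            found smallest)
        where
        w : Carrier
        w = d / fromℕ M
        Mw≈d : fromℕ M * w ≈ d
        Mw≈d = ≈-trans (*-comm _ w) (div-mul d M>0)
        w>0 : Positive w
        w>0 h = d>0 (≤-trans (≤-reflexive (≈-sym Mw≈d)) (≤-resp ≈-refl (zeroʳ _) (*-monoˡ (fromℕ M) (fromℕ-nonneg M) h)))
        open GridSpec vx vy d w M d>0 Mw≈d w>0
        open Grid d w M d>0 Mw≈d w>0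
        finish : ∀ {τ w′ ox oy} → w′ ≡ w → ox ≡ corner vx → oy ≡ corner vy → k ℕ.≤ rect (I τ #A 0) (I τ #B 0) (I τ #side 0) →
                 (∀ {a b} → a ℕ.≤ 4 ℕ.* M → b ℕ.≤ 4 ℕ.* M → rect a b (I τ #side 0 ℕ.∸ 1) ℕ.< k) →
                 Result vx vy (setʳ (setʳ (setʳ τ %left 0 (ox + fromℕ (I τ #A 0) * w′)) %bottom 0 (oy + fromℕ (I τ #B 0) * w′)) %side 0 (fromℕ (I τ #side 0) * w′))
        finish {τ} refl refl refl found smallest = record
          { valid = rect-feasible {I τ #A 0} {I τ #B 0} {I τ #side 0} found
          ; approx = λ { fs@(feasible 0≤s enough) minimal px py →
              let d≤s = radius-≤-side rk fs px py
                  -- The square of side 2 d around the centre is feasible, so minimality gives s ≤ 2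
                  -- d.
                  (a , b , a≤ , b≤ , h) = approximate 0≤s (minimal (ball-feasible (≰⇒≥ d>0) many)) enough px py
              -- Had the search stopped above `2 + cell s` cells, the side one smaller would by
              -- monotonicity still capture k points at the corner (a, b), which the search has
              -- excluded.
              in side-bound {m = I τ #side 0} 0≤s 2≤εM 0≤ε d≤s (ℕ.≮⇒≥ λ big → ℕ.<⇒≱ (smallest a≤ b≤)
                   (ℕ.≤-trans h (rect-mono {a} {b} (ℕ.∸-monoˡ-≤ 1 big)))) }
          }

      candidate-spec : ∀ {σ} → R σ %vx 0 ≡ vx → R σ %vy 0 ≡ vy → R σ %d 0 ≡ d → I σ #M 0 ≡ M →
                       Triple candidate σ (suc (grid-time n M)) (Result vx vy)
      candidate-spec {σ} refl refl refl M≡ = branch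
        (λ h → weaken (s≤s (s≤s (s≤s z≤n))) (realₜ realₜ real-last {S = Result vx vy} (record
          { valid = point-feasible (le-elim h) many
          ; approx = λ { (feasible 0≤s _) _ _ _ → *-nonNeg (≤-trans 0≤1 (≤-trans (≤-reflexive (≈-sym (+-identityʳ 1#))) (+-mono ≤-refl 0≤ε))) 0≤s } }))
          (λ _ q → q))
        (λ h → grid-spec refl refl refl M≡ (le-false h))

    Hits : (ℕ → Carrier) → ℕ → Carrier → Carrier → Set
    Hits f j lo hi = ∀ {v} → HasRank f n (suc j ℕ.* k ℕ.∸ 1) v → lo ≤ v × v ≤ hi

    Within : Store → Carrier → Set
    Within τ s = 1 ℕ.≤ I τ #have 0 × R τ %best-side 0 ≤ s

    -- Until the flag is set, the cells of the best square hold arbitrary memory contents.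
    Valid : Store → Set
    Valid τ = 1 ℕ.≤ I τ #have 0 → Feasible (R τ %best-left 0) (R τ %best-bottom 0) (R τ %best-side 0)

    -- Quantifying over all optimal squares replaces knowledge of one: the claim concerns those that
    -- the values of the two ranks hit. It survives later pairs because the best side only
    -- decreases.
    ApproximatesPair : ℕ → ℕ → Store → Set
    ApproximatesPair i j τ = ∀ {l b s} → Feasible l b s → Minimal s → Hits X i l (l + s) → Hits Y j b (b + s) → Within τ ((1# + ε) * s)

    Better : Store → Store → Set
    Better σ τ = ∀ {s} → Within σ s → Within τ s

    better-pair : ∀ i j {σ τ} → Better σ τ → ApproximatesPair i j σ → ApproximatesPair i j τ
    better-pair i j better h fs minimal hx hy = better (h fs minimal hx hy)

    improve-spec : ∀ {σ vx vy} → Result vx vy σ → Valid σ →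
                   Triple improve σ 5 (λ τ → Valid τ × Better σ τ × Within τ (R σ %side 0))
    improve-spec {σ} res val = branch
      (λ h → let (h₁ , h₂) = ∧-elim {does (1 ℕ.≤? I σ #have 0)} h in
        weaken (s≤s z≤n) (int-last {S = λ τ → Valid τ × Better σ τ × Within τ (R σ %side 0)}
          (val , (λ w → w) , does-true (1 ℕ.≤? I σ #have 0) h₁ , le-elim h₂)) (λ _ q → q))
      (λ h → intₜ realₜ realₜ real-last ((λ _ → Result.valid res) , (λ { (p , q) → s≤s z≤n , ≤-trans (≰⇒≥ (λ better →
          true≢false (∧-intro (dec-true (1 ℕ.≤? I σ #have 0) p) (le-intro better)) h)) q }) , s≤s z≤n , ≤-refl))

    pair-spec : ∀ {σ} i j → I σ #M 0 ≡ M → I σ #jx 0 ≡ i → I σ #jy 0 ≡ j → suc i ℕ.* k ℕ.≤ n → suc j ℕ.* k ℕ.≤ n → Valid σ →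
                Triple pairStep σ (pair-time n M) (λ τ → Valid τ × Better σ τ × ApproximatesPair i j τ)
    pair-spec {σ} i j M≡ refl refl fits-i fits-j val =
        pick-spec 1 X (suc i ℕ.* k ℕ.∸ 1) refl refl (ℕ.≤-trans (ℕ.≤-reflexive (suc-pred-* i 1≤k)) fits-i)
          (λ _ → load-x-spec) (λ fr → cong (λ x → suc x ℕ.* k ℕ.∸ 1) (int₀ fr #jx refl)) ▹ λ {τ₁} fr₁ rank-x →
        realₜ
        pick-spec 1 Y (suc j ℕ.* k ℕ.∸ 1) refl refl (ℕ.≤-trans (ℕ.≤-reflexive (suc-pred-* j 1≤k)) fits-j)
          (λ _ → load-y-spec) (λ fr → cong (λ x → suc x ℕ.* k ℕ.∸ 1) (trans (int₀ fr #jy refl) (int₀ fr₁ #jy refl))) ▹ λ {τ₂} fr₂ rank-y →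
        realₜ
        pick-spec 10 (distance (R τ₁ %result 0) (R τ₂ %result 0)) (k ℕ.∸ 1) refl refl
          (ℕ.≤-trans (ℕ.≤-reflexive (ℕ.m+[n∸m]≡n 1≤k)) (ℕ.≤-trans (ℕ.m≤m+n k (i ℕ.* k)) fits-i))
          (λ fr → load-distance-spec (trans (real₀ fr %vx refl) (real₀ fr₂ %vx refl)) (real₀ fr %vy refl))
          (λ _ → refl) ▹ λ {τ₃} fr₃ rank-d →
        realₜ
        candidate-spec rank-d (trans (real₀ fr₃ %vx refl) (real₀ fr₂ %vx refl)) (real₀ fr₃ %vy refl) refl
          (trans (cong-app (trans (intᶠ fr₃ #M refl) (trans (intᶠ fr₂ #M refl) (intᶠ fr₁ #M refl))) 0) M≡) ▹ λ {τ₄} fr₄ res →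
        let have≡ = cong-app (trans (intᶠ fr₄ #have refl) (trans (intᶠ fr₃ #have refl) (trans (intᶠ fr₂ #have refl) (intᶠ fr₁ #have refl)))) 0
            left≡ = cong-app (trans (realᶠ fr₄ %best-left refl) (trans (realᶠ fr₃ %best-left refl) (trans (realᶠ fr₂ %best-left refl) (realᶠ fr₁ %best-left refl)))) 0
            bottom≡ = cong-app (trans (realᶠ fr₄ %best-bottom refl) (trans (realᶠ fr₃ %best-bottom refl) (trans (realᶠ fr₂ %best-bottom refl) (realᶠ fr₁ %best-bottom refl)))) 0
            side≡ = cong-app (trans (realᶠ fr₄ %best-side refl) (trans (realᶠ fr₃ %best-side refl) (trans (realᶠ fr₂ %best-side refl) (realᶠ fr₁ %best-side refl)))) 0
        in weaken ℕ.≤-refl (improve-spec res (valid-transport τ₄ have≡ left≡ bottom≡ side≡))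
             (λ { {τ} _ (val′ , better , within) → val′ , (λ { (p , q) → better (subst (1 ℕ.≤_) (sym have≡) p , subst (_≤ _) (sym side≡) q) }) ,
                λ fs minimal hx hy → proj₁ within , ≤-trans (proj₂ within) (Result.approx res fs minimal (hx rank-x) (hy rank-y)) })
      where
      valid-transport : ∀ τ → I τ #have 0 ≡ I σ #have 0 → R τ %best-left 0 ≡ R σ %best-left 0 → R τ %best-bottom 0 ≡ R σ %best-bottom 0 →
                        R τ %best-side 0 ≡ R σ %best-side 0 → Valid τ
      valid-transport τ h l b s p = subst₂ (λ l′ b′ → Feasible l′ b′ _) (sym l) (sym b)
        (subst (Feasible _ _) (sym s) (val (subst (1 ℕ.≤_) h p)))

    module _ (c : ℕ) (n≤ck : n ℕ.≤ c ℕ.* k) where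
      instance
        k≢0 : ℕ.NonZero k
        k≢0 = ℕ.>-nonZero 1≤k

      -- This limits both rank loops to c iterations, although c does not occur in the program.
      fits⇒< : ∀ j → suc j ℕ.* k ℕ.≤ n → j ℕ.< c
      fits⇒< j h = ℕ.*-cancelʳ-≤ (suc j) c k (ℕ.≤-trans h n≤ck)

      fits-before : ∀ i j → ¬ (suc j ℕ.* k ℕ.≤ n) → suc i ℕ.* k ℕ.≤ n → i ℕ.< j
      fits-before i j h h′ = ℕ.s≤s⁻¹ (ℕ.*-cancelʳ-< k (suc i) (suc j) (ℕ.≤-<-trans h′ (ℕ.≰⇒> h)))

      Done : ℕ → Store → Set
      Done i τ = ∀ i′ j → i′ ℕ.< i → suc j ℕ.* k ℕ.≤ n → ApproximatesPair i′ j τ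

      Inner : ℕ → ℕ → Store → Set
      Inner i j τ = I τ #jy 0 ≡ j × Valid τ × Done i τ × (∀ {j′} → j′ ℕ.< j → ApproximatesPair i j′ τ)

      inner-spec : ∀ {σ i j} → I σ #M 0 ≡ M → I σ #jx 0 ≡ i → suc i ℕ.* k ℕ.≤ n → suc j ℕ.* k ℕ.≤ n → Inner i j σ →
                   Triple innerStep σ (pair-time n M ℕ.+ 1) (Inner i (suc j))
      inner-spec {σ} {i} {j} M≡ i≡ fits-i fits-j (j≡ , val , done , row) =
        pair-spec i j M≡ i≡ j≡ fits-i fits-j val ▹ λ {τ} fr (val′ , better , new) →
        int-last (cong suc (trans (int₀ fr #jy refl) j≡) , val′ ,
          (λ i′ j′ i′<i fits → better-pair i′ j′ {σ} {τ} better (done i′ j′ i′<i fits)) , λ {j′} j′≤j → extend {τ} better new j′≤j)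
        where
        extend : ∀ {τ} → Better σ τ → ApproximatesPair i j τ → ∀ {j′} → j′ ℕ.< suc j → ApproximatesPair i j′ τ
        extend {τ} better new {j′} (s≤s p) with ≤-split p
        ... | inj₁ q = better-pair i j′ {σ} {τ} better (row q)
        ... | inj₂ refl = new

      Outer : ℕ → Store → Set
      Outer i τ = I τ #jx 0 ≡ i × Valid τ × Done i τ

      outer-time : ℕ
      outer-time = 1 ℕ.+ (suc (c ℕ.* suc (pair-time n M ℕ.+ 1)) ℕ.+ 1)

      outer-spec : ∀ {σ i} → I σ #M 0 ≡ M → suc i ℕ.* k ℕ.≤ n → Outer i σ → Triple outerStep σ outer-time (Outer (suc i))
      outer-spec {σ} {i} M≡ fits-i (i≡ , val , done) =
        intₜ loop c (pair-time n M ℕ.+ 1) (Inner i) (refl , val , done , λ ()) z≤n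
          (λ {j} {τ} fr inv b → let fits-j = subst (λ x → suc x ℕ.* k ℕ.≤ n) (proj₁ inv) (does-true (suc (I τ #jy 0) ℕ.* k ℕ.≤? n) b) in
            fits⇒< j fits-j , inner-spec (trans (int₀ fr #M refl) M≡) (trans (int₀ fr #jx refl) i≡) fits-i fits-j inv) ▹
        λ { {τ} fr (j , (j≡ , val′ , done′ , row) , _ , b) →
            int-last (cong suc (trans (int₀ fr #jx refl) i≡) , val′ ,
              finish {τ} {j} done′ row (subst (λ x → ¬ (suc x ℕ.* k ℕ.≤ n)) j≡ (does-false (suc (I τ #jy 0) ℕ.* k ℕ.≤? n) b))) }
        where
        finish : ∀ {τ j} → Done i τ → (∀ {j′} → j′ ℕ.< j → ApproximatesPair i j′ τ) → ¬ (suc j ℕ.* k ℕ.≤ n) → Done (suc i) τ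
        finish {j = j} done′ row stop i′ j′ (s≤s i′≤i) fits with ≤-split i′≤i
        ... | inj₁ q = done′ i′ j′ q fits
        ... | inj₂ refl = row (fits-before j′ j stop fits)

      approximation-spec : ∀ {σ} → suc (floorᴿ (fromℕ 2 / ε)) ≡ M →
                           Triple approximation σ (total-time c n M)
                             (λ τ → Valid τ × (∀ i j → suc i ℕ.* k ℕ.≤ n → suc j ℕ.* k ℕ.≤ n → ApproximatesPair i j τ))
      approximation-spec {σ} M≡ = intₜ intₜ intₜ weaken ℕ.≤-refl
        (loop c outer-time Outer (refl , (λ ()) , λ _ _ ()) z≤n
          (λ {i} {τ} fr inv b → let fits-i = subst (λ x → suc x ℕ.* k ℕ.≤ n) (proj₁ inv) (does-true (suc (I τ #jx 0) ℕ.* k ℕ.≤? n) b) in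
            fits⇒< i fits-i , outer-spec (trans (int₀ fr #M refl) M≡) fits-i inv))
        (λ { {τ} _ (i , (i≡ , val , done) , _ , b) → val , λ i′ j fits-i fits-j →
          done i′ j (fits-before i′ i (subst (λ x → ¬ (suc x ℕ.* k ℕ.≤ n)) i≡ (does-false (suc (I τ #jx 0) ℕ.* k ℕ.≤? n) b)) fits-i) fits-j })

      -- Projecting the optimal square to each axis gives an interval with at least k coordinates;
      -- `rank-in-interval` then names the pair whose iteration was good enough.
      conclude : ∀ {τ l b s} → Valid τ → (∀ i j → suc i ℕ.* k ℕ.≤ n → suc j ℕ.* k ℕ.≤ n → ApproximatesPair i j τ) →
                 Feasible l b s → Minimal s →
                 Feasible (R τ %best-left 0) (R τ %best-bottom 0) (R τ %best-side 0) × R τ %best-side 0 ≤ (1# + ε) * s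
      conclude {τ} {l} {b} {s} val approx fs@(feasible _ enough) minimal
        with rank-in-interval X l (l + s) (ℕ.≤-trans enough (count-mono n (λ {i} _ h → proj₁ (∧-elim {between l (l + s) (X i)} h))))
           | rank-in-interval Y b (b + s) (ℕ.≤-trans enough (count-mono n (λ {i} _ h → proj₂ (∧-elim {between l (l + s) (X i)} h))))
      ... | i , fits-i , hits-x | j , fits-j , hits-y with approx i j fits-i fits-j fs minimal hits-x hits-y
      ...   | have , small = val have , small

-- From counts to finite subsets

select-cardinality : ∀ n (P : ℕ → Bool) → ∣ Vec.tabulate {n = n} (λ i → P (toℕ i)) ∣ ≡ count P n
select-cardinality zero P = refl
-- `count` peels off the last index and `tabulate` the first; `count-shift` reconciles them.
select-cardinality (suc n) P = trans (head (P 0)) (trans (cong (ℕ._+ count (λ i → P (suc i)) n) (sym (ℕ.+-identityʳ (bit (P 0))))) (sym (count-shift P 1 n)))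
  where
  head : ∀ b → ∣ b Vec.∷ Vec.tabulate {n = n} (λ i → P (suc (toℕ i))) ∣ ≡ bit b ℕ.+ count (λ i → P (suc i)) n
  head true = cong suc (select-cardinality n (λ i → P (suc i)))
  head false = select-cardinality n (λ i → P (suc i))

cardinality-≤ : ∀ {n} (S : Subset n) (P : ℕ → Bool) → (∀ {i} → i ∈ S → P (toℕ i) ≡ true) → ∣ S ∣ ℕ.≤ count P n
cardinality-≤ Vec.[] P h = z≤n
cardinality-≤ {suc n} (true Vec.∷ S) P h = ℕ.≤-trans
  (ℕ.+-mono-≤ (ℕ.≤-reflexive (sym (cong (λ b → bit b ℕ.+ 0) (h here)))) (cardinality-≤ S (λ i → P (suc i)) (λ p → h (there p))))
  (ℕ.≤-reflexive (sym (count-shift P 1 n)))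
cardinality-≤ {suc n} (false Vec.∷ S) P h = ℕ.≤-trans (cardinality-≤ S (λ i → P (suc i)) (λ p → h (there p)))
  (ℕ.≤-trans (ℕ.m≤n+m _ (count P 1)) (ℕ.≤-reflexive (sym (count-shift P 1 n))))

module Encloses (ℝ : CompleteOrderedField) (n k : ℕ) (1≤k : 1 ℕ.≤ k) (X Y : ℕ → CompleteOrderedField.Carrier ℝ)
                (P : Fin n → Geometry.Point ℝ)
                (X≡ : ∀ i → X (toℕ i) ≡ Geometry.xcoord (P i)) (Y≡ : ∀ i → Y (toℕ i) ≡ Geometry.ycoord (P i)) where
  open CompleteOrderedField ℝ
  open Geometry ℝ using (Square; left; bottom; side; side-nonNeg) renaming (Encloses to Enclosing)
  open Ranks ℝ using (le; le-intro; le-elim)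
  open Geometric ℝ n k 1≤k X Y

  enclosed⇒feasible : ∀ Q → Enclosing k P Q → Feasible (left Q) (bottom Q) (side Q)
  enclosed⇒feasible Q (S , k≤ , inQ) = feasible (side-nonNeg Q) (ℕ.≤-trans k≤ (cardinality-≤ S (inside (left Q) (bottom Q) (side Q)) λ {i} i∈S →
    let ((p , q) , (r , s)) = inQ i∈S in
    ∧-intro (∧-intro (le-intro (subst (left Q ≤_) (sym (X≡ i)) p)) (le-intro (subst (_≤ left Q + side Q) (sym (X≡ i)) q)))
            (∧-intro (le-intro (subst (bottom Q ≤_) (sym (Y≡ i)) r)) (le-intro (subst (_≤ bottom Q + side Q) (sym (Y≡ i)) s)))))

  feasible⇒enclosed : ∀ Q → Feasible (left Q) (bottom Q) (side Q) → Enclosing k P Q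
  feasible⇒enclosed Q (feasible _ many) = S , ℕ.≤-trans many (ℕ.≤-reflexive (sym (select-cardinality n I))) , λ {i} i∈S →
    let h = trans (sym (lookup∘tabulate (λ i → I (toℕ i)) i)) ([]=⇒lookup i∈S)
        (hx , hy) = ∧-elim {between (left Q) (left Q + side Q) (X (toℕ i))} h
        (p , q) = ∧-elim {le (left Q) (X (toℕ i))} hx ; (r , s) = ∧-elim {le (bottom Q) (Y (toℕ i))} hy
    in (subst (left Q ≤_) (X≡ i) (le-elim p) , subst (_≤ left Q + side Q) (X≡ i) (le-elim q)) ,
       (subst (bottom Q ≤_) (Y≡ i) (le-elim r) , subst (_≤ bottom Q + side Q) (Y≡ i) (le-elim s))
    where
    I : ℕ → Bool
    I = inside (left Q) (bottom Q) (side Q)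
    S : Subset n
    S = Vec.tabulate (λ i → I (toℕ i))

-- The running time in terms of the bound

module Times (ℝ : CompleteOrderedField) where
  open CompleteOrderedField ℝ renaming (floor to floorᴿ)
  open Bound ℝ
  open Field ℝ

  precision : Carrier → ℕ
  precision ε = suc (floorᴿ (fromℕ 2 / ε))

  2≤ε*precision : ∀ {ε} → Positive ε → fromℕ 2 ≤ ε * fromℕ (precision ε)
  2≤ε*precision {ε} ε>0 = ≤-resp (div-mul (fromℕ 2) ε>0) (*-comm _ ε)
    (*-monoʳ ε (≰⇒≥ ε>0) (≰⇒≥ (λ h → ℕ.1+n≰n (floor-≥ h))))

  -- If 1 / ε ≤ 1, then M ≤ 3 and M² ≤ 9 ≤ 9 n, so the first summand suffices. Otherwise M ≤ 1 + 2 /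
  -- ε ≤ 3 / ε, and the rounded logarithm is at least 1, so the second summand does.
  precision-bound : ∀ {ε} n → Positive ε → 1 ℕ.≤ n → fromℕ (precision ε ℕ.* precision ε) ≤ fromℕ 9 * bound n ε
  precision-bound {ε} n ε>0 1≤n with ε ⁻¹ ≤? fromℕ 1
  ... | yes y≤1 = ≤-trans (fromℕ-mono (ℕ.≤-trans (ℕ.*-mono-≤ small small) (ℕ.*-monoʳ-≤ 9 1≤n)))
          (≤-trans (≤-reflexive (fromℕ-* 9 n)) (*-monoˡ (fromℕ 9) (fromℕ-nonneg 9)
            (≤-trans (≤-reflexive (≈-sym (+-identityʳ _))) (+-mono ≤-refl (*-nonNeg (*-nonNeg y≥0 y≥0) (fromℕ-nonneg ⌈log₂ ceiling (ε ⁻¹) ⌉))))))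
    where
    y≥0 : 0# ≤ ε ⁻¹
    y≥0 = inverse-nonneg ε>0
    small : precision ε ℕ.≤ 3
    small = s≤s (fromℕ-reflects (≤-trans (floor-≤ (*-nonNeg (fromℕ-nonneg 2) y≥0))
      (≤-trans (*-monoˡ (fromℕ 2) (fromℕ-nonneg 2) y≤1) (≤-reflexive (≈-sym (fromℕ-* 2 1))))))
  ... | no y>1 = ≤-trans (≤-reflexive (fromℕ-* (precision ε) (precision ε))) (≤-trans
          (≤-trans (*-monoʳ _ (fromℕ-nonneg (precision ε)) small) (*-monoˡ _ (*-nonNeg (fromℕ-nonneg 3) y≥0) small))
          (≤-trans (≤-reflexive (≈-trans (rearrange (fromℕ 3) y) (*-congʳ (≈-sym (fromℕ-* 3 3)))))
            (*-monoˡ (fromℕ 9) (fromℕ-nonneg 9) (≤-trans (≤-trans (≤-reflexive (≈-sym (*-identityʳ _)))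
              (*-monoˡ (y * y) (*-nonNeg y≥0 y≥0) (≤-trans (≤-reflexive (≈-sym (+-identityʳ 1#))) (fromℕ-mono log≥1))))
              (≤-trans (≤-reflexive (≈-sym (+-identityˡ _))) (+-mono (fromℕ-nonneg n) ≤-refl))))))
    where
    y : Carrier
    y = ε ⁻¹
    y≥0 : 0# ≤ y
    y≥0 = inverse-nonneg ε>0
    rearrange : ∀ t y → t * y * (t * y) ≈ t * t * (y * y)
    rearrange t y = solveʳ 2 (λ t y → t :* y :* (t :* y) :≈ t :* t :* (y :* y)) ≈-refl t y
    small : fromℕ (precision ε) ≤ fromℕ 3 * y
    small = ≤-trans (+-mono (≤-trans (≤-reflexive (≈-sym (+-identityʳ 1#))) (≰⇒≥ y>1)) (floor-≤ (*-nonNeg (fromℕ-nonneg 2) y≥0)))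
      (≤-reflexive (≈-trans (+-congʳ (≈-sym (*-identityˡ y))) (solveʳ 2 (λ e y → e :* y :+ (e :+ (e :+ con 0)) :* y :≈ (e :+ (e :+ (e :+ con 0))) :* y) ≈-refl 1# y)))
    log≥1 : 1 ℕ.≤ ⌈log₂ ceiling (ε ⁻¹) ⌉
    log≥1 = subst (ℕ._≤ ⌈log₂ ceiling (ε ⁻¹) ⌉) (⌈log₂2^n⌉≡n 1)
      (⌈log₂⌉-mono-≤ (ceilingFrom-≥2 (proj₁ (archimedean (ε ⁻¹))) y>1 (proj₂ (archimedean (ε ⁻¹)))))

  -- The 10 is 1 + 9: n is at most the bound and M² at most nine times the bound.
  bound-≤ : ∀ {ε} F n {u} → Positive ε → 1 ℕ.≤ n → u ℕ.≤ F ℕ.* (n ℕ.+ precision ε ℕ.* precision ε) →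
            fromℕ u ≤ fromℕ (F ℕ.* 10) * bound n ε
  bound-≤ {ε} F n ε>0 1≤n u≤ = ≤-trans (fromℕ-mono u≤) (≤-trans (≤-reflexive (≈-trans (fromℕ-* F (n ℕ.+ precision ε ℕ.* precision ε))
      (*-congˡ (fromℕ-+ n (precision ε ℕ.* precision ε)))))
    (≤-trans (*-monoˡ (fromℕ F) (fromℕ-nonneg F) (+-mono n≤ (precision-bound n ε>0 1≤n)))
      (≤-reflexive (≈-trans (*-congˡ (ten (fromℕ 9) (bound n ε))) (≈-trans (≈-sym (*-assoc _ _ _)) (*-congʳ (≈-sym (fromℕ-* F 10))))))))
    where
    n≤ : fromℕ n ≤ bound n ε
    n≤ = ≤-trans (≤-reflexive (≈-sym (+-identityʳ _))) (+-mono ≤-refl (*-nonNeg (*-nonNeg (inverse-nonneg ε>0) (inverse-nonneg ε>0))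
      (fromℕ-nonneg ⌈log₂ ceiling (ε ⁻¹) ⌉)))
    ten : ∀ t b → b + t * b ≈ (1# + t) * b
    ten t b = ≈-trans (+-congʳ (≈-sym (*-identityˡ b))) (solveʳ 3 (λ e t b → e :* b :+ t :* b :≈ (e :+ t) :* b) ≈-refl 1# t b)

-- Output and assembly

output : Cmd 1
-- These writes hit input cells and destroy the representation of the store, so they are plain
-- machine commands at the very end. The values still to be read lie above cell 2 n ≥ 2 and survive.
output = real[ const 0 ]≔ compileʳ (rvar %best-left) ⨾
         real[ const 1 ]≔ compileʳ (rvar %best-bottom) ⨾
         real[ const 2 ]≔ compileʳ (rvar %best-side)

output-time : ℕ
output-time = suc (1 ℕ.+ costʳ (compileʳ (rvar %best-left))) ℕ.+
              (suc (1 ℕ.+ costʳ (compileʳ (rvar %best-bottom))) ℕ.+ suc (1 ℕ.+ costʳ (compileʳ (rvar %best-side))))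

program : Program
program = record { bodies = compile select Vec.∷ Vec.[] ; main = compile approximation ⨾ output }

-- Abstract, since unfolding the product of this literal with a variable is slow.
abstract
  step-weight : ℕ
  step-weight = weight approximation ℕ.+ weight select

  approximation-weight : weight approximation ℕ.≤ step-weight
  approximation-weight = ℕ.m≤m+n (weight approximation) (weight select)

  select-weight : weight select ℕ.≤ step-weight
  select-weight = ℕ.m≤n+m (weight select) (weight approximation)

machine-time-≤ : ∀ K W c n f {u t} → 1 ℕ.≤ n → u ℕ.≤ K ℕ.* t → t ℕ.≤ total-time c n (suc f) →
                 u ℕ.+ W ℕ.≤ (K ℕ.* total-factor c ℕ.+ W) ℕ.* (n ℕ.+ suc f ℕ.* suc f)
machine-time-≤ K W c n f {u} {t} 1≤n u≤ t≤ = begin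
    u ℕ.+ W  ≤⟨ ℕ.≤-trans u≤ (ℕ.*-monoʳ-≤ K (ℕ.≤-trans t≤ (total-time-≤ c n f 1≤n))) +≤
                                                                   ℕ.m≤m*n W q {{ℕ.>-nonZero (ℕ.≤-trans 1≤n (ℕ.m≤m+n n _))}} ⟩
    K ℕ.* (total-factor c ℕ.* q) ℕ.+ W ℕ.* q  ≡⟨ cong (ℕ._+ W ℕ.* q) (sym (ℕ.*-assoc K (total-factor c) q)) ⟩
    K ℕ.* total-factor c ℕ.* q ℕ.+ W ℕ.* q  ≡⟨ sym (ℕ.*-distribʳ-+ q (K ℕ.* total-factor c) W) ⟩
    (K ℕ.* total-factor c ℕ.+ W) ℕ.* q  ∎
  where
  open ℕ.≤-Reasoning
  q : ℕ
  q = n ℕ.+ suc f ℕ.* suc f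

time-factor : ℕ → ℕ
time-factor c = (step-weight ℕ.* total-factor c ℕ.+ output-time) ℕ.* 10

theorem7 : (ℝ : CompleteOrderedField) →
    let open CompleteOrderedField ℝ
        open Geometry ℝ
        open Machine ℝ
        open Bound ℝ
    in
    Σ[ prog ∈ Program ] ((c : ℕ) →
      Σ[ C ∈ ℕ ] ((n k : ℕ) (P : Fin n → Point) (ε : Carrier) →
        IsPointSet P → 1 ℕ.≤ k → k ℕ.≤ n → n ℕ.≤ c ℕ.* k → 0# < ε →
        (s : State) → IsInput P k ε s →
        Σ[ s′ ∈ State ] Σ[ t ∈ ℕ ] Σ[ Q ∈ Square ]
          (Runs prog s s′ t
           × (fromℕ t ≤ fromℕ C * bound n ε)
           × IsOutput Q s′
           × IsApproximation ε k P Q)))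
theorem7 ℝ = program , λ c → time-factor c , λ n k P ε _ 1≤k k≤n n≤ck 0<ε s input → solution c n k P ε 1≤k k≤n n≤ck 0<ε s input
  where
  open CompleteOrderedField ℝ renaming (floor to floorᴿ)
  open Geometry ℝ
  open Machine ℝ
  open Bound ℝ
  open Field ℝ
  open Times ℝ

  solution : ∀ c n k (P : Fin n → Point) ε → 1 ℕ.≤ k → k ℕ.≤ n → n ℕ.≤ c ℕ.* k → 0# < ε → (s : State) → IsInput P k ε s →
             Σ[ s′ ∈ State ] Σ[ t ∈ ℕ ] Σ[ Q ∈ Square ]
               (Runs program s s′ t × (fromℕ t ≤ fromℕ (time-factor c) * bound n ε) × IsOutput Q s′ × IsApproximation ε k P Q)
  solution c n k P ε 1≤k k≤n n≤ck (0≤ε , 0≉ε) s input =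
      finish (minimal-exists k≤n) (approximation-spec 0≤ε (precision ε) (s≤s z≤n) (2≤ε*precision ε>0) c n≤ck refl)
    where
    open IsInput input
    X Y : ℕ → Carrier
    X i = reals s (1 ℕ.+ 2 ℕ.* i)
    Y i = reals s (2 ℕ.+ 2 ℕ.* i)
    E : Env Carrier
    E = record { n = n ; k = k ; ε = ε ; X = X ; Y = Y }
    open Arrays ℝ E select
    open Approximation ℝ E 1≤k
    open Smallest ℝ n k 1≤k X Y
    open Geometric ℝ n k 1≤k X Y
    open Encloses ℝ n k 1≤k X Y P x-cell y-cell
    1≤n : 1 ℕ.≤ n
    1≤n = ℕ.≤-trans 1≤k k≤n
    ε>0 : Positive ε
    ε>0 ε≤0 = 0≉ε (≤-antisym 0≤ε ε≤0)
    initial : Store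
    -- The arrays are read off from whatever the memory contains, so any initial state represents a
    -- store.
    initial = store (λ a i → ints s (1 ℕ.+ code a i)) (λ a i → reals s (2 ℕ.* n ℕ.+ code a i))
    rep : Represents s initial
    rep = record { n-rep = n-cell ; k-rep = k-cell ; ε-rep = ε-cell ; x-rep = λ _ → refl ; y-rep = λ _ → refl
                 ; I-rep = λ _ _ → refl ; R-rep = λ _ _ → refl }
    finish : (∃[ l ] ∃[ b ] ∃[ s* ] Feasible l b s* × Minimal s*) →
             Triple approximation initial (total-time c n (precision ε)) (λ τ → Valid 0≤ε (precision ε) (s≤s z≤n) (2≤ε*precision ε>0) τ ×
               (∀ i j → suc i ℕ.* k ℕ.≤ n → suc j ℕ.* k ℕ.≤ n → ApproximatesPair 0≤ε (precision ε) (s≤s z≤n) (2≤ε*precision ε>0) i j τ)) →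
             Σ[ s′ ∈ State ] Σ[ t ∈ ℕ ] Σ[ Q ∈ Square ]
               (Runs program s s′ t × (fromℕ t ≤ fromℕ (time-factor c) * bound n ε) × IsOutput Q s′ × IsApproximation ε k P Q)
    finish (l , b , s* , optimal , minimal) (triple {τ} p t≤ (val , approx))
      with simulate 1≤n step-weight select-weight approximation-weight p rep
    ... | s₁ , u , steps , u≤ , rep₁ =
        _ , _ , Q , ⇓-seq steps (⇓-seq ⇓-real (⇓-seq ⇓-real ⇓-real)) ,
        bound-≤ (step-weight ℕ.* total-factor c ℕ.+ output-time) n ε>0 1≤n
          (machine-time-≤ step-weight output-time c n (floorᴿ (fromℕ 2 / ε)) 1≤n u≤ t≤) ,
        record { left-cell = sound-evalʳ 1≤n rep₁ (rvar %best-left)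
               ; bottom-cell = trans (update-there (reals s₁) 0 _ (λ e → away %best-bottom z≤n (sym e))) (sound-evalʳ 1≤n rep₁ (rvar %best-bottom))
               ; side-cell = trans (update-there r₁ 1 _ (λ e → away %best-side 1≤2n (sym e)))
                               (trans (update-there (reals s₁) 0 _ (λ e → away %best-side z≤n (sym e))) (sound-evalʳ 1≤n rep₁ (rvar %best-side))) } ,
        feasible⇒enclosed Q (proj₁ result) ,
        Q* , (feasible⇒enclosed Q* optimal , λ Q′ enc → minimal (enclosed⇒feasible Q′ enc)) , proj₂ result
      where
      r₁ : ℕ → Carrier
      r₁ = update (reals s₁) 0 (⟦ compileʳ (rvar %best-left) ⟧ʳ s₁)
      result : Feasible (R τ %best-left 0) (R τ %best-bottom 0) (R τ %best-side 0) × R τ %best-side 0 ≤ (1# + ε) * s*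
      result = conclude 0≤ε (precision ε) (s≤s z≤n) (2≤ε*precision ε>0) c n≤ck {τ} val approx optimal minimal
      Q Q* : Square
      Q = record { left = R τ %best-left 0 ; bottom = R τ %best-bottom 0 ; side = R τ %best-side 0 ; side-nonNeg = Feasible.nonneg (proj₁ result) }
      Q* = record { left = l ; bottom = b ; side = s* ; side-nonNeg = Feasible.nonneg optimal }
      1≤2n : 1 ℕ.≤ 2 ℕ.* n
      1≤2n = ℕ.≤-trans 1≤n (ℕ.m≤n*m n 2)
      away : ∀ a {j} → j ℕ.≤ 2 ℕ.* n → ¬ (2 ℕ.* ints s₁ 0 ℕ.+ code a 0 ≡ j)
      away a j≤ e = array-above 1≤n a 0 j≤ (subst (λ m → 2 ℕ.* m ℕ.+ code a 0 ≡ _) (n-rep rep₁) e)
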